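{- There exist an absolute constant $c > 0$ and $n_0$ such that for every integer $n \geq n_0$ and every $\varepsilon = \varepsilon(n) > 0$ the following holds. If $q \geq n/2 - 1$ is a positive integer, then in the $(1:q)$ Client-Waiter game played on $E(K_n)$, Waiter has a strategy to keep Client's graph $K_3$-minor free throughout the game. On the other hand, if $q \leq (1/2 - \varepsilon) n$ is a positive integer, then in the $(1:q)$ Client-Waiter game played on $E(K_n)$, Client has a strategy to build a graph which admits a $K_t$-minor for $t = (\varepsilon n)^{c \varepsilon}$.
   Context: The $(1:q)$ Client-Waiter game on the board $E(K_n)$ is played as follows: in each round Waiter offers Client some number $s$ of previously unoffered (free) edges with $1 \le s \le q+1$ (if fewer free edges remain, he offers at most those); Client claims one of the offered edges and Waiter claims the remaining $s-1$. The game ends when all edges are claimed. Client's graph is the graph on $V(K_n)$ formed by the edges Client claimed. A graph $G$ admits a $K_t$-minor if there exist pairwise disjoint vertex sets $B_1,\dots,B_t \subseteq V(G)$ such that each $G[B_i]$ is connected and for every $i<j$ there is an edge of $G$ between $B_i$ and $B_j$. (A graph is $K_3$-minor free iff it is a forest.)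
   Formalization: The parameter ε is taken to be a positive rational rather than a positive real (and the constant c found is rational); "a K_t-minor for t = (εn)^{cε}" is read as a K_t-minor for some natural number t ≥ (εn)^{cε}. -}

module Defs where

open import Data.Nat as ℕ using (ℕ; zero; suc)
open import Data.Integer as ℤ using (+_)
open import Data.Rational as ℚ using (ℚ; _/_; 1ℚ)
open import Data.Fin using (Fin; toℕ)
open import Data.Fin.Properties using () renaming (_≟_ to _≟ᶠ_)
open import Data.Bool using (Bool; true; false; _∧_; _∨_; if_then_else_)
open import Data.Maybe using (Maybe; just)
open import Data.Product using (_×_; _,_; Σ; ∃; ∃-syntax)
open import Data.Sum using (_⊎_)
open import Data.List using (List; []; _∷_; length)
open import Data.Bool.ListAction using (any)
open import Data.List.Membership.Propositional using (_∈_)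
open import Data.List.Relation.Unary.All using (All)
open import Data.List.Relation.Unary.Unique.Propositional using (Unique)
open import Relation.Binary.PropositionalEquality using (_≡_; _≢_)
open import Relation.Nullary using (¬_)
open import Relation.Nullary.Decidable using (⌊_⌋)

toℚ : ℕ → ℚ
toℚ n = + n / 1

_^ℚ_ : ℚ → ℕ → ℚ
x ^ℚ zero  = 1ℚ
x ^ℚ suc k = x ℚ.* (x ^ℚ k)

Graph : ℕ → Set₁
Graph n = Fin n → Fin n → Set

data PathIn {n : ℕ} (G : Graph n) (S : Fin n → Set) : Fin n → Fin n → Set where
  here : ∀ {u} → PathIn G S u u
  step : ∀ {u w v} → G u w → S w → PathIn G S w v → PathIn G S u v

-- G admits a K_t-minor: branch sets B_1..B_t, given by a partial map
-- β : V → Maybe (Fin t) (B_i = β⁻¹(just i), so they are pairwise disjoint),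
-- each nonempty and inducing a connected subgraph, and an edge of G
-- between B_i and B_j for every i ≠ j.
HasMinor : {n : ℕ} → Graph n → ℕ → Set
HasMinor {n} G t =
  Σ (Fin n → Maybe (Fin t)) λ β →
      (∀ (i : Fin t) → ∃[ v ] β v ≡ just i)
    × (∀ (i : Fin t) (u v : Fin n) → β u ≡ just i → β v ≡ just i →
         PathIn G (λ w → β w ≡ just i) u v)
    × (∀ (i j : Fin t) → i ≢ j →
         ∃[ u ] ∃[ v ] (β u ≡ just i × β v ≡ just j × G u v))

data Owner : Set where
  free client waiter : Owner

Pair : ℕ → Set
Pair n = Fin n × Fin n

IsEdge : {n : ℕ} → Pair n → Set
IsEdge (i , j) = toℕ i ℕ.< toℕ j

-- a position: the owner of each edge (only entries (i , j), i < j, matter)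
Position : ℕ → Set
Position n = Fin n → Fin n → Owner

initial : (n : ℕ) → Position n
initial n _ _ = free

ClientGraph : {n : ℕ} → Position n → Graph n
ClientGraph s u v = (IsEdge (u , v) × s u v ≡ client) ⊎ (IsEdge (v , u) × s v u ≡ client)

AllClaimed : {n : ℕ} → Position n → Set
AllClaimed {n} s = ∀ (i j : Fin n) → IsEdge (i , j) → s i j ≢ free

ValidOffer : {n : ℕ} → ℕ → Position n → List (Pair n) → Set
ValidOffer q s offer =
    Unique offer
  × All (λ e → IsEdge e × s (Data.Product.proj₁ e) (Data.Product.proj₂ e) ≡ free) offer
  × 1 ℕ.≤ length offer
  × length offer ℕ.≤ suc q

_==_ : {n : ℕ} → Pair n → Pair n → Bool
(a , b) == (c , d) = ⌊ a ≟ᶠ c ⌋ ∧ ⌊ b ≟ᶠ d ⌋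

update : {n : ℕ} → Position n → List (Pair n) → Pair n → Position n
update s offer e u v =
  if (u , v) == e then client
  else if any (λ f → (u , v) == f) offer then waiter
  else s u v

data WaiterKeeps {n : ℕ} (q : ℕ) (P : Graph n → Set) : Position n → Set where
  finished : ∀ {s} → P (ClientGraph s) → AllClaimed s → WaiterKeeps q P s
  offerMove : ∀ {s} → P (ClientGraph s) →
    (offer : List (Pair n)) → ValidOffer q s offer →
    (∀ e → e ∈ offer → WaiterKeeps q P (update s offer e)) →
    WaiterKeeps q P s

data ClientBuilds {n : ℕ} (q : ℕ) (Q : Graph n → Set) : Position n → Set where
  finished : ∀ {s} → AllClaimed s → Q (ClientGraph s) → ClientBuilds q Q s
  chooseMove : ∀ {s} → ¬ AllClaimed s →
    (∀ offer → ValidOffer q s offer →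
       ∃[ e ] (e ∈ offer × ClientBuilds q Q (update s offer e))) →
    ClientBuilds q Q s

{-# OPTIONS --safe #-}
module Submission where

-- Waiter keeps Client's edges in a forest on a growing vertex set C. In each round he offers all
-- free edges between C and a set T of outside vertices; whichever edge Client takes, one vertex
-- of T joins C and the others have no free edge to the old C. Since every round creates only one
-- new free edge from each outside vertex to C, suitable sets T need at most q + 1 offered edges.
--
-- Client plays a potential strategy. A labelling of the vertices by 0, ..., k allows the pairs
-- with equal labels and the pairs meeting label 0. Client makes at least (1 + ε/2)n moves, and
-- choosing the edge that minimises a weighted count of the labellings allowing all his edges,
-- he obtains a graph G in which every labelling with few allowed pairs fails to allow an edge.
-- Hence G cannot be shattered into small pieces by removing few vertices, so some vertex set R
-- has no small balanced separator. In R branch sets of a K_t-minor are grown one at a time: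
-- either breadth-first search from all the present branch sets reaches a common vertex and
-- yields the next one, or a thin layer allows a branch set to absorb the ball it bounds.

open import Defs
open import Data.Nat using (ℕ; _≤_; _+_; _*_)
open import Data.Integer using (∣_∣)
open import Data.Rational using (ℚ; 0ℚ; ½; ↥_; ↧ₙ_) renaming (_<_ to _<ℚ_; _≤_ to _≤ℚ_; _*_ to _*ℚ_; _-_ to _-ℚ_)
open import Data.Product using (_×_; Σ; ∃-syntax)
open import Relation.Nullary using (¬_)

open import Data.Bool using (Bool; true; false; _∧_; _∨_; not; if_then_else_)
open import Data.Bool.ListAction using (any)
import Data.Bool.Properties as 𝔹
open import Data.Empty using (⊥; ⊥-elim)
open import Data.Fin using (Fin; zero; suc; toℕ)
import Data.Fin.Properties as Fin
import Data.Integer as ℤ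
import Data.Integer.Properties as ℤ
open import Data.List using (List; []; _∷_; _++_; _∷ʳ_; map; length; allFin; tabulate; filter; take; drop; upTo; cartesianProductWith)
open import Data.List.Membership.Propositional using (_∈_)
open import Data.List.Membership.Propositional.Properties using (∈-++⁺ˡ; ∈-++⁺ʳ; ∈-++⁻; ∈-map⁺; ∈-map⁻; ∈-allFin; ∈-tabulate⁺; ∈-filter⁺; ∈-filter⁻; ∈-upTo⁺; ∈-cartesianProductWith⁺)
open import Data.List.Properties using (map-tabulate; length-tabulate; length-map; length-++; length-take; length-drop; take++drop≡id; ++-identityʳ; length-upTo; length-filter)
open import Data.List.Relation.Unary.All using (All; []; _∷_)
import Data.List.Relation.Unary.All as All
open import Data.List.Relation.Unary.AllPairs using ([]; _∷_)
open import Data.List.Relation.Unary.Any using (here; there)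
open import Data.List.Relation.Unary.Unique.Propositional using (Unique)
import Data.List.Relation.Unary.Unique.Propositional.Properties as Unique
open import Data.Maybe using (Maybe; just; nothing)
open import Data.Maybe.Properties using (just-injective) renaming (≡-dec to maybe-≡-dec)
open import Data.Nat using (zero; suc; _^_; _∸_; _/_; _%_; _<_; z≤n; s≤s; _≤?_; _<?_; NonZero; >-nonZero; >-nonZero⁻¹)
open import Data.Nat.DivMod using (m/n*n≤m; m≡m%n+[m/n]*n; m%n<n)
open import Data.Nat.Induction using (<-wellFounded)
open import Data.Nat.ListAction using (sum; product)
open import Data.Nat.Properties
open import Data.Nat.Tactic.RingSolver using (solve-∀)
open import Data.Product using (_,_; proj₁; proj₂; uncurry)
open import Data.Rational using (1ℚ; mkℚ; toℚᵘ; nonNegative; positive) renaming (_+_ to _+ℚ_; _/_ to _/ℚ_)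
import Data.Rational as ℚ-Base
import Data.Rational.Properties as ℚ
import Data.Rational.Solver as ℚ-Solver
import Data.Rational.Unnormalised as ℚᵘ
import Data.Rational.Unnormalised.Properties as ℚᵘ
open import Data.Sum using (_⊎_; inj₁; inj₂; swap)
open import Function using (_∘_; id)
open import Induction.WellFounded using (Acc; acc)
open import Relation.Binary.PropositionalEquality
open import Relation.Nullary using (Dec; yes; no)
open import Relation.Nullary.Decidable using (⌊_⌋; ¬?; _×-dec_; _⊎-dec_; _→-dec_)

-- Client's graph may have average degree only slightly above 2, so no density argument produces a
-- minor; it has to come from the absence of small separators. The constant 1/2 in Client's bound is
-- a balance of entropy. A shattering uses about `2 * t * x` labels, where `x` is a small fixed
-- power of n up to bounded variation of the exponent, so there are about (2tx)^n labellings to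
-- defeat. In the potential, a block of Q free edges is worth a factor of about `x`. Thus n rounds
-- of Q edges merely cancel the x^n in the number of labellings. The e = ⌊εn/2⌋ rounds beyond these
-- contribute x^e, which must pay for t^n and for a constant to the power n. This is affordable
-- while t is at most x to a small multiple of ε, and that is where the exponent cε comes from. If ε
-- log n is bounded there is nothing left to pay with, but then a single edge, a K_2-minor, is
-- enough. For Waiter the budget is 2q + 2 = 1 + (q + 1) + q: a first vertex, a first offer of q + 1
-- edges at it, and q vertices that can be fed in while the costs of the others rise.

private variable
  Elt Elt′ : Set

-- Boolean reasoning.

true≢false : ∀ {b} → b ≡ true → b ≡ false → ⊥
true≢false refl ()

∧-elim : ∀ {a b} → a ∧ b ≡ true → a ≡ true × b ≡ true
∧-elim {true} {true} _ = refl , refl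

∧-intro : ∀ {a b} → a ≡ true → b ≡ true → a ∧ b ≡ true
∧-intro refl refl = refl

∨-elim : ∀ {a b} → a ∨ b ≡ true → a ≡ true ⊎ b ≡ true
∨-elim {true} _ = inj₁ refl
∨-elim {false} p = inj₂ p

∨-introˡ : ∀ {a b} → a ≡ true → a ∨ b ≡ true
∨-introˡ refl = refl

∨-introʳ : ∀ {a b} → b ≡ true → a ∨ b ≡ true
∨-introʳ {true} _ = refl
∨-introʳ {false} p = p

not-elim : ∀ {a} → not a ≡ true → a ≡ false
not-elim {false} _ = refl

not-intro : ∀ {a} → a ≡ false → not a ≡ true
not-intro refl = refl

bool-case : ∀ b → b ≡ true ⊎ b ≡ false
bool-case true = inj₁ refl
bool-case false = inj₂ refl

dec-true : ∀ {P : Set} (d : Dec P) → ⌊ d ⌋ ≡ true → P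
dec-true (yes p) _ = p

dec-intro : ∀ {P : Set} (d : Dec P) → P → ⌊ d ⌋ ≡ true
dec-intro (yes _) _ = refl
dec-intro (no ¬p) p = ⊥-elim (¬p p)

bit : Bool → ℕ
bit true = 1
bit false = 0

bit≤1 : ∀ b → bit b ≤ 1
bit≤1 true = ≤-refl
bit≤1 false = z≤n

-- Sums and counts over finite lists.

Σ[_]_ : List Elt → (Elt → ℕ) → ℕ
Σ[ xs ] f = sum (map f xs)

cnt : (Elt → Bool) → List Elt → ℕ
cnt p xs = Σ[ xs ] (bit ∘ p)

Σ-mono : (xs : List Elt) {f g : Elt → ℕ} → (∀ x → x ∈ xs → f x ≤ g x) → Σ[ xs ] f ≤ Σ[ xs ] g
Σ-mono [] h = z≤n
Σ-mono (x ∷ xs) h = +-mono-≤ (h x (here refl)) (Σ-mono xs (λ y m → h y (there m)))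

Σ-cong : (xs : List Elt) {f g : Elt → ℕ} → (∀ x → x ∈ xs → f x ≡ g x) → Σ[ xs ] f ≡ Σ[ xs ] g
Σ-cong [] h = refl
Σ-cong (x ∷ xs) h = cong₂ _+_ (h x (here refl)) (Σ-cong xs (λ y m → h y (there m)))

Σ-+ : (xs : List Elt) (f g : Elt → ℕ) → Σ[ xs ] (λ x → f x + g x) ≡ Σ[ xs ] f + Σ[ xs ] g
Σ-+ [] f g = refl
Σ-+ (x ∷ xs) f g = trans (cong (f x + g x +_) (Σ-+ xs f g)) (lem (f x) (g x) (Σ[ xs ] f) (Σ[ xs ] g))
  where
  lem : ∀ a b c d → a + b + (c + d) ≡ a + c + (b + d)
  lem = solve-∀

Σ-*ʳ : (xs : List Elt) (f : Elt → ℕ) (k : ℕ) → Σ[ xs ] (λ x → f x * k) ≡ Σ[ xs ] f * k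
Σ-*ʳ [] f k = refl
Σ-*ʳ (x ∷ xs) f k = trans (cong (f x * k +_) (Σ-*ʳ xs f k)) (sym (*-distribʳ-+ k (f x) _))

Σ-const : (xs : List Elt) (k : ℕ) → Σ[ xs ] (λ _ → k) ≡ length xs * k
Σ-const [] k = refl
Σ-const (x ∷ xs) k = cong (k +_) (Σ-const xs k)

Σ-≤-const : (xs : List Elt) {f : Elt → ℕ} {k : ℕ} → (∀ x → x ∈ xs → f x ≤ k) → Σ[ xs ] f ≤ length xs * k
Σ-≤-const xs {k = k} h = ≤-trans (Σ-mono xs h) (≤-reflexive (Σ-const xs k))

Σ-map : (h : Elt → Elt′) (xs : List Elt) (f : Elt′ → ℕ) → Σ[ map h xs ] f ≡ Σ[ xs ] (f ∘ h)
Σ-map h [] f = refl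
Σ-map h (x ∷ xs) f = cong (f (h x) +_) (Σ-map h xs f)

Σ-++ : (xs ys : List Elt) (f : Elt → ℕ) → Σ[ xs ++ ys ] f ≡ Σ[ xs ] f + Σ[ ys ] f
Σ-++ [] ys f = refl
Σ-++ (x ∷ xs) ys f = trans (cong (f x +_) (Σ-++ xs ys f)) (sym (+-assoc (f x) _ _))

Σ-swap : (xs : List Elt) (ys : List Elt′) (f : Elt → Elt′ → ℕ) →
  Σ[ xs ] (λ x → Σ[ ys ] (f x)) ≡ Σ[ ys ] (λ y → Σ[ xs ] (λ x → f x y))
Σ-swap [] ys f = sym (trans (Σ-const ys 0) (*-zeroʳ (length ys)))
Σ-swap (x ∷ xs) ys f = trans (cong (Σ[ ys ] (f x) +_) (Σ-swap xs ys f)) (sym (Σ-+ ys (f x) _))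

bit-mono : ∀ {a b} → (a ≡ true → b ≡ true) → bit a ≤ bit b
bit-mono {false} h = z≤n
bit-mono {true} h = ≤-reflexive (cong bit (sym (h refl)))

cnt-mono : (xs : List Elt) {p q : Elt → Bool} → (∀ x → p x ≡ true → q x ≡ true) → cnt p xs ≤ cnt q xs
cnt-mono xs h = Σ-mono xs (λ x _ → bit-mono (h x))

cnt-cong : (xs : List Elt) {p q : Elt → Bool} → (∀ x → p x ≡ q x) → cnt p xs ≡ cnt q xs
cnt-cong xs h = Σ-cong xs (λ x _ → cong bit (h x))

cnt-≤-length : (p : Elt → Bool) (xs : List Elt) → cnt p xs ≤ length xs
cnt-≤-length p xs = ≤-trans (Σ-≤-const xs (λ x _ → bit≤1 (p x))) (≤-reflexive (*-identityʳ (length xs)))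

cnt-true : (xs : List Elt) {p : Elt → Bool} → (∀ x → p x ≡ true) → cnt p xs ≡ length xs
cnt-true [] h = refl
cnt-true (x ∷ xs) h = cong₂ _+_ (cong bit (h x)) (cnt-true xs h)

cnt-false : (xs : List Elt) {p : Elt → Bool} → (∀ x → x ∈ xs → p x ≡ false) → cnt p xs ≡ 0
cnt-false [] h = refl
cnt-false (x ∷ xs) h = cong₂ _+_ (cong bit (h x (here refl))) (cnt-false xs (λ y m → h y (there m)))

cnt-∪ : (xs : List Elt) {p q r : Elt → Bool} → (∀ x → p x ≡ true → q x ≡ true ⊎ r x ≡ true) →
  cnt p xs ≤ cnt q xs + cnt r xs
cnt-∪ xs {p} {q} {r} h = ≤-trans (Σ-mono xs (λ x _ → lem x)) (≤-reflexive (Σ-+ xs (bit ∘ q) (bit ∘ r)))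
  where
  lem : ∀ x → bit (p x) ≤ bit (q x) + bit (r x)
  lem x with p x in eq
  ... | false = z≤n
  ... | true with h x eq
  ...   | inj₁ e rewrite e = s≤s z≤n
  ...   | inj₂ e rewrite e = m≤n+m 1 (bit (q x))

cnt-disjoint : (xs : List Elt) {p q r : Elt → Bool} → (∀ x → q x ≡ true → p x ≡ true) →
  (∀ x → r x ≡ true → p x ≡ true) → (∀ x → q x ≡ true → r x ≡ true → ⊥) →
  cnt q xs + cnt r xs ≤ cnt p xs
cnt-disjoint xs {p} {q} {r} hq hr d =
  ≤-trans (≤-reflexive (sym (Σ-+ xs (bit ∘ q) (bit ∘ r)))) (Σ-mono xs (λ x _ → lem x))
  where
  lem : ∀ x → bit (q x) + bit (r x) ≤ bit (p x)
  lem x with q x in eq | r x in er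
  ... | false | _ = bit-mono (λ e → hr x (trans er e))
  ... | true | false = ≤-reflexive (cong bit (sym (hq x eq)))
  ... | true | true = ⊥-elim (d x eq er)

cnt-pos : (xs : List Elt) {p : Elt → Bool} {x : Elt} → x ∈ xs → p x ≡ true → 1 ≤ cnt p xs
cnt-pos (x ∷ xs) (here refl) e rewrite e = s≤s z≤n
cnt-pos (y ∷ xs) {p} (there m) e = ≤-trans (cnt-pos xs m e) (m≤n+m _ (bit (p y)))

cnt-strict : (xs : List Elt) {p q : Elt → Bool} {x : Elt} → (∀ x → p x ≡ true → q x ≡ true) →
  x ∈ xs → q x ≡ true → p x ≡ false → cnt p xs < cnt q xs
cnt-strict xs {p} {q} {x} h m eq ep =
  ≤-trans (+-monoˡ-≤ (cnt p xs) (cnt-pos xs {λ y → q y ∧ not (p y)} m (∧-intro eq (not-intro ep))))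
    (cnt-disjoint xs (λ y → proj₁ ∘ ∧-elim) h (λ y a b → true≢false b (not-elim (proj₂ (∧-elim {q y} a)))))

cnt-unique : {xs : List Elt} → Unique xs → {p : Elt → Bool} (x₀ : Elt) → (∀ x → p x ≡ true → x ≡ x₀) → cnt p xs ≤ 1
cnt-unique [] x₀ h = z≤n
cnt-unique {xs = x ∷ xs} (a ∷ u) {p} x₀ h with p x in eq
... | false = cnt-unique u x₀ h
... | true = s≤s (≤-reflexive (cnt-false xs lem))
  where
  lem : ∀ y → y ∈ xs → p y ≡ false
  lem y m with p y in e
  ... | false = refl
  ... | true = ⊥-elim (All.lookup a m (trans (h x eq) (sym (h y e))))

cnt-⋃ : {I : Set} (is : List I) (xs : List Elt) {p : Elt → Bool} (q : I → Elt → Bool) →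
  (∀ x → p x ≡ true → ∃[ i ] (i ∈ is × q i x ≡ true)) → cnt p xs ≤ Σ[ is ] (λ i → cnt (q i) xs)
cnt-⋃ [] xs {p} q h = ≤-reflexive (cnt-false xs (λ x _ → lem x))
  where
  lem : ∀ x → p x ≡ false
  lem x with p x in eq
  ... | false = refl
  ... | true with h x eq
  ...   | _ , () , _
cnt-⋃ (i ∷ is) xs {p} q h =
  ≤-trans (cnt-∪ xs {r = λ x → p x ∧ not (q i x)} split)
    (+-monoʳ-≤ (cnt (q i) xs) (cnt-⋃ is xs q rest))
  where
  split : ∀ x → p x ≡ true → q i x ≡ true ⊎ p x ∧ not (q i x) ≡ true
  split x e with q i x in eq
  ... | true = inj₁ refl
  ... | false = inj₂ (∧-intro e refl)
  rest : ∀ x → p x ∧ not (q i x) ≡ true → ∃[ j ] (j ∈ is × q j x ≡ true)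
  rest x e with ∧-elim {p x} e
  ... | e₁ , e₂ with h x e₁
  ...   | _ , here refl , e₃ = ⊥-elim (true≢false e₃ (not-elim e₂))
  ...   | j , there m , e₃ = j , m , e₃

-- The edges of the complete graph.

edges : ∀ n → List (Pair n)
edges zero = []
edges (suc n) = map (λ j → zero , suc j) (allFin n) ++ map (λ e → suc (proj₁ e) , suc (proj₂ e)) (edges n)

edges-complete : ∀ {n} (e : Pair n) → IsEdge e → e ∈ edges n
edges-complete {suc n} (zero , suc j) lt = ∈-++⁺ˡ (∈-map⁺ _ (∈-allFin j))
edges-complete {suc n} (suc i , suc j) (s≤s lt) = ∈-++⁺ʳ _ (∈-map⁺ _ (edges-complete (i , j) lt))

edges-sound : ∀ {n} {e : Pair n} → e ∈ edges n → IsEdge e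
edges-sound {suc n} m with ∈-++⁻ (map (λ j → zero , suc j) (allFin n)) m
... | inj₁ m₁ with ∈-map⁻ _ m₁
...   | j , _ , refl = s≤s z≤n
edges-sound {suc n} m | inj₂ m₂ with ∈-map⁻ _ m₂
...   | e , m₃ , refl = s≤s (edges-sound m₃)

edges-unique : ∀ n → Unique (edges n)
edges-unique zero = []
edges-unique (suc n) = Unique.++⁺
  (Unique.map⁺ (λ { refl → refl }) (Unique.allFin⁺ n))
  (Unique.map⁺ (λ { refl → refl }) (edges-unique n))
  (λ { (a , b) → disj a b })
  where
  disj : ∀ {e} → e ∈ map (λ j → zero , suc j) (allFin n) →
    e ∈ map (λ e → suc (proj₁ e) , suc (proj₂ e)) (edges n) → ⊥
  disj a b with ∈-map⁻ _ a | ∈-map⁻ _ b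
  ... | _ , _ , refl | _ , _ , ()

length-edges : ∀ n → 2 * length (edges n) + n ≡ n * n
length-edges zero = refl
length-edges (suc n) = begin
  2 * length (edges (suc n)) + suc n
    ≡⟨ cong (λ z → 2 * z + suc n) (length-++ (map (λ j → zero , suc j) (allFin n))) ⟩
  2 * (length (map (λ j → zero , suc j) (allFin n)) + length (map (λ e → suc (proj₁ e) , suc (proj₂ e)) (edges n))) + suc n
    ≡⟨ cong₂ (λ y z → 2 * (y + z) + suc n) (trans (length-map (λ j → zero , suc j) (allFin n)) (length-tabulate {n = n} id)) (length-map _ (edges n)) ⟩
  2 * (n + length (edges n)) + suc n ≡⟨ lem n (length (edges n)) ⟩
  2 * length (edges n) + n + (n + suc n) ≡⟨ cong (_+ (n + suc n)) (length-edges n) ⟩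
  n * n + (n + suc n) ≡⟨ lem₂ n ⟩
  suc n * suc n ∎
  where
  open ≡-Reasoning
  lem : ∀ n e → 2 * (n + e) + suc n ≡ 2 * e + n + (n + suc n)
  lem = solve-∀
  lem₂ : ∀ n → n * n + (n + suc n) ≡ suc n * suc n
  lem₂ = solve-∀

Σ-allFin-suc : ∀ n (f : Fin (suc n) → ℕ) → Σ[ allFin (suc n) ] f ≡ f zero + Σ[ allFin n ] (f ∘ suc)
Σ-allFin-suc n f = cong (f zero +_) (trans (cong (λ z → Σ[ z ] f) (sym (map-tabulate id suc))) (Σ-map suc (allFin n) f))

-- Every edge is one of the ordered pairs counted row by row. The loss of a factor of about 2 is
-- absorbed by the constants.
cnt-edges : ∀ n (p : Fin n → Fin n → Bool) →
  cnt (λ e → p (proj₁ e) (proj₂ e)) (edges n) ≤ Σ[ allFin n ] (λ i → cnt (p i) (allFin n))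
cnt-edges zero p = z≤n
cnt-edges (suc n) p = begin
  cnt p′ (edges (suc n)) ≡⟨ Σ-++ (map (λ j → zero , suc j) (allFin n)) _ (bit ∘ p′) ⟩
  cnt p′ (map (λ j → zero , suc j) (allFin n)) + cnt p′ (map (λ e → suc (proj₁ e) , suc (proj₂ e)) (edges n))
    ≡⟨ cong₂ _+_ (Σ-map _ (allFin n) (bit ∘ p′)) (Σ-map _ (edges n) (bit ∘ p′)) ⟩
  cnt (λ j → p zero (suc j)) (allFin n) + cnt (λ e → p (suc (proj₁ e)) (suc (proj₂ e))) (edges n)
    ≤⟨ +-mono-≤ (≤-trans (m≤n+m _ (bit (p zero zero))) (≤-reflexive (sym (Σ-allFin-suc n (bit ∘ p zero)))))
         (≤-trans (cnt-edges n (λ i j → p (suc i) (suc j)))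
           (Σ-mono (allFin n) (λ i _ → ≤-trans (m≤n+m _ (bit (p (suc i) zero)))
                                         (≤-reflexive (sym (Σ-allFin-suc n (bit ∘ p (suc i)))))))) ⟩
  cnt (p zero) (allFin (suc n)) + Σ[ allFin n ] (λ i → cnt (p (suc i)) (allFin (suc n)))
    ≡⟨ Σ-allFin-suc n (λ i → cnt (p i) (allFin (suc n))) ⟨
  Σ[ allFin (suc n) ] (λ i → cnt (p i) (allFin (suc n))) ∎
  where
  open ≤-Reasoning
  p′ : Pair (suc n) → Bool
  p′ e = p (proj₁ e) (proj₂ e)

-- Complete minors from unbreakable vertex sets

Sub : ℕ → Set
Sub n = Fin n → Bool

# : ∀ {n} → Sub n → ℕ
# {n} p = cnt p (allFin n)

#≤n : ∀ {n} (p : Sub n) → # p ≤ n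
#≤n {n} p = ≤-trans (cnt-≤-length p (allFin n)) (≤-reflexive (length-tabulate id))

sing : ∀ {n} → Fin n → Sub n
sing v w = ⌊ w Fin.≟ v ⌋

#-sing : ∀ {n} (v : Fin n) → # (sing v) ≤ 1
#-sing {n} v = cnt-unique (Unique.allFin⁺ n) v (λ w → dec-true (w Fin.≟ v))

module _ {n : ℕ} {G : Graph n} where

  path-trans : ∀ {S : Fin n → Set} {u v w} → PathIn G S u v → PathIn G S v w → PathIn G S u w
  path-trans here q = q
  path-trans (step g s p) q = step g s (path-trans p q)

  path-mono : ∀ {S S′ : Fin n → Set} {u v} → (∀ w → S w → S′ w) → PathIn G S u v → PathIn G S′ u v
  path-mono h here = here
  path-mono h (step g s p) = step g (h _ s) (path-mono h p)

  path-sym : (∀ {u v} → G u v → G v u) → ∀ {S : Fin n → Set} {u v} → S u → PathIn G S u v → PathIn G S v u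
  path-sym G-sym su here = here
  path-sym G-sym su (step g sw p) = path-trans (path-sym G-sym sw p) (step (G-sym g) su here)

  anchored : (∀ {u v} → G u v → G v u) → ∀ {S : Fin n → Set} a → (∀ v → S v → PathIn G S v a) →
    ∀ u v → S u → S v → PathIn G S u v
  anchored G-sym a h u v su sv = path-trans (h u su) (path-sym G-sym sv (h v sv))

-- In the parameters, t is the number of branch sets, ρ bounds the radius of
-- breadth-first balls, r the part of a branch set charged to the separator,
-- and t * r the size of a separator.
module Separate {n : ℕ} (G : Graph n) (G-sym : ∀ {u v} → G u v → G v u) (G? : ∀ u v → Dec (G u v))
  (t ρ : ℕ) (2≤t : 2 ≤ t) (large-ρ : n < ρ * suc (t * suc ρ)) where

  r s : ℕ
  -- A union of `t` trees with at most `suc ρ` vertices each: the size of a newly created branch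
  -- set.
  r = t * suc ρ
  s = t * r

  is : Fin t → Maybe (Fin t) → Bool
  is i m = ⌊ maybe-≡-dec Fin._≟_ m (just i) ⌋

  is-true : ∀ {i} m → is i m ≡ true → m ≡ just i
  is-true {i} m = dec-true (maybe-≡-dec Fin._≟_ m (just i))

  is-intro : ∀ {i} m → m ≡ just i → is i m ≡ true
  is-intro {i} m = dec-intro (maybe-≡-dec Fin._≟_ m (just i))

  nbr? : (S : Sub n) (v : Fin n) → Dec (∃[ w ] (S w ≡ true × G w v))
  nbr? S v = Fin.any? (λ w → (S w 𝔹.≟ true) ×-dec G? w v)

  nbr : Sub n → Sub n
  nbr S v = ⌊ nbr? S v ⌋

  module Ball (C A : Sub n) (A⊂C : ∀ v → A v ≡ true → C v ≡ true) where

    ball : ℕ → Sub n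
    ball zero = A
    ball (suc ℓ) v = ball ℓ v ∨ (C v ∧ nbr (ball ℓ) v)

    layer : ℕ → Sub n
    layer ℓ v = ball (suc ℓ) v ∧ not (ball ℓ v)

    ball-suc : ∀ ℓ v → ball ℓ v ≡ true → ball (suc ℓ) v ≡ true
    ball-suc ℓ v = ∨-introˡ

    ball-step : ∀ ℓ {v w} → ball ℓ v ≡ true → G v w → C w ≡ true → ball (suc ℓ) w ≡ true
    ball-step ℓ {v} {w} b g c = ∨-introʳ {ball ℓ w} (∧-intro c (dec-intro (nbr? (ball ℓ) w) (v , b , g)))

    centre : ∀ ℓ v → A v ≡ true → ball ℓ v ≡ true
    centre zero v a = a
    centre (suc ℓ) v a = ball-suc ℓ v (centre ℓ v a)

    ball-mono : ∀ {ℓ k} → ℓ ≤ k → ∀ v → ball ℓ v ≡ true → ball k v ≡ true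
    ball-mono {ℓ} {zero} z≤n v b = b
    ball-mono {ℓ} {suc k} ℓ≤k v b with m≤n⇒m<n∨m≡n ℓ≤k
    ... | inj₁ (s≤s h) = ball-suc k v (ball-mono h v b)
    ... | inj₂ refl = b

    ball⊂C : ∀ ℓ v → ball ℓ v ≡ true → C v ≡ true
    ball⊂C zero v b = A⊂C v b
    ball⊂C (suc ℓ) v b with ∨-elim {ball ℓ v} b
    ... | inj₁ b′ = ball⊂C ℓ v b′
    ... | inj₂ b′ = proj₁ (∧-elim b′)

    ball-pred : ∀ ℓ v → ball (suc ℓ) v ≡ true →
      ball ℓ v ≡ true ⊎ ∃[ w ] (ball ℓ w ≡ true × G w v)
    ball-pred ℓ v b with ∨-elim {ball ℓ v} b
    ... | inj₁ b′ = inj₁ b′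
    ... | inj₂ b′ = inj₂ (dec-true (nbr? (ball ℓ) v) (proj₂ (∧-elim {C v} b′)))

    -- In effect a path from `v` back to `A`. Only its vertex set is kept, because later steps use
    -- its size and connectedness but not the order of its vertices.
    record Tree (ℓ : ℕ) (v : Fin n) : Set where
      field
        T : Sub n
        root : T v ≡ true
        T⊂C : ∀ w → T w ≡ true → C w ≡ true
        meets : ∃[ u ] (T u ≡ true × A u ≡ true)
        connected : ∀ w → T w ≡ true → PathIn G (λ x → T x ≡ true) w v
        size : # T ≤ suc ℓ

    tree : ∀ ℓ v → ball ℓ v ≡ true → Tree ℓ v
    tree zero v b = record
      { T = sing v ; root = dec-intro (v Fin.≟ v) refl
      ; T⊂C = λ w e → subst (λ z → C z ≡ true) (sym (dec-true (w Fin.≟ v) e)) (A⊂C v b)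
      ; meets = v , dec-intro (v Fin.≟ v) refl , b
      ; connected = λ w e → subst (λ z → PathIn G _ z v) (sym (dec-true (w Fin.≟ v) e)) here
      ; size = #-sing v }
    tree (suc ℓ) v b with ball-pred ℓ v b
    ... | inj₁ b′ = let open Tree (tree ℓ v b′) in record
      { T = T ; root = root ; T⊂C = T⊂C ; meets = meets ; connected = connected ; size = m≤n⇒m≤1+n size }
    ... | inj₂ (w , bw , g) = record
      { T = T′ ; root = root′ ; T⊂C = T′⊂C
      ; meets = let u , tu , au = meets in u , ∨-introˡ tu , au
      ; connected = conn′
      ; size = ≤-trans (cnt-∪ (allFin n) {q = T} {r = sing v} (λ x → ∨-elim))
                 (≤-trans (+-mono-≤ size (#-sing v)) (≤-reflexive (+-comm (suc ℓ) 1))) }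
      where
      open Tree (tree ℓ w bw)
      T′ : Sub n
      T′ x = T x ∨ sing v x
      root′ : T′ v ≡ true
      root′ = ∨-introʳ {T v} (dec-intro (v Fin.≟ v) refl)
      T′⊂C : ∀ x → T′ x ≡ true → C x ≡ true
      T′⊂C x e with ∨-elim {T x} e
      ... | inj₁ e′ = T⊂C x e′
      ... | inj₂ e′ = subst (λ z → C z ≡ true) (sym (dec-true (x Fin.≟ v) e′)) (ball⊂C (suc ℓ) v b)
      conn′ : ∀ x → T′ x ≡ true → PathIn G (λ y → T′ y ≡ true) x v
      conn′ x e with ∨-elim {T x} e
      ... | inj₁ e′ = path-trans (path-mono (λ y → ∨-introˡ) (connected x e′)) (step g root′ here)
      ... | inj₂ e′ = subst (λ z → PathIn G _ z v) (sym (dec-true (x Fin.≟ v) e′)) here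

    -- The layers below `k` are disjoint subsets of `ball k`, so if each had more than `r` vertices
    -- they would fill it with `k * suc r`. For `k = ρ` this exceeds n by `large-ρ`.
    thin-layer : ∀ k → (∃[ ℓ ] (ℓ < k × # (layer ℓ) ≤ r)) ⊎ k * suc r ≤ # (ball k)
    thin-layer zero = inj₂ z≤n
    thin-layer (suc k) with thin-layer k
    ... | inj₁ (ℓ , ℓ<k , h) = inj₁ (ℓ , m≤n⇒m≤1+n ℓ<k , h)
    ... | inj₂ h with # (layer k) ≤? r
    ...   | yes h′ = inj₁ (k , ≤-refl , h′)
    ...   | no h′ = inj₂ (≤-trans (+-mono-≤ (≰⇒> h′) h)
              (cnt-disjoint (allFin n) (λ v → proj₁ ∘ ∧-elim) (ball-suc k)
                (λ v a b → true≢false b (not-elim (proj₂ (∧-elim {ball (suc k) v} a))))))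

    exists-thin-layer : ∃[ ℓ ] (ℓ < ρ × # (layer ℓ) ≤ r)
    exists-thin-layer with thin-layer ρ
    ... | inj₁ x = x
    ... | inj₂ h = ⊥-elim (<-irrefl refl (≤-trans large-ρ (≤-trans h (#≤n (ball ρ)))))

  -- The fraction 1/(2t) is what a union bound over `t` branch sets affords: `t` sets below that
  -- fraction of `R` cannot cover more than half of `R`.
  record BalancedSeparation (R : Sub n) : Set where
    field
      A B : Sub n
      A⊂R : ∀ v → A v ≡ true → R v ≡ true
      B⊂R : ∀ v → B v ≡ true → R v ≡ true
      disjoint : ∀ v → A v ≡ true → B v ≡ true → ⊥
      no-edge : ∀ u v → A u ≡ true → B v ≡ true → ¬ G u v
      A-large : # R ≤ 2 * t * # A
      B-large : # R ≤ 2 * t * # B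
      small : # (λ v → R v ∧ not (A v ∨ B v)) ≤ s

  module InSubset (R : Sub n) (R-large : 4 * s < # R) where

    -- The classes of β are disjoint, connected, pairwise adjacent branch sets.
    -- C is the unused part of R; it is separated from the rest of R by X,
    -- which takes at most r vertices from each branch set.
    record PreState : Set where
      field
        β : Fin n → Maybe (Fin t)
        C X : Sub n
        C⊂R : ∀ v → C v ≡ true → R v ≡ true
        C-free : ∀ v → C v ≡ true → β v ≡ nothing
        boundary : ∀ u v → C u ≡ true → G u v → R v ≡ true → C v ≡ true ⊎ X v ≡ true
        X-label : ∀ v → X v ≡ true → ∃[ i ] β v ≡ just i
        X-small : ∀ i → # (λ v → X v ∧ is i (β v)) ≤ r
        conn : ∀ i u v → β u ≡ just i → β v ≡ just i → PathIn G (λ w → β w ≡ just i) u v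
        -- Labels not yet in use are empty classes, so adjacency is asked of nonempty ones.
        adj : ∀ i j → i ≢ j → ∃[ u ] β u ≡ just i → ∃[ v ] β v ≡ just j →
          ∃[ u ] ∃[ v ] (β u ≡ just i × β v ≡ just j × G u v)

      rest : Sub n
      rest v = R v ∧ not (C v ∨ X v)

      Alive : Fin t → Set
      Alive i = ∃[ u ] (β u ≡ just i × ∃[ v ] (C v ≡ true × G u v))

      alive? : ∀ i → Dec (Alive i)
      alive? i = Fin.any? (λ u → maybe-≡-dec Fin._≟_ (β u) (just i) ×-dec
        Fin.any? (λ v → (C v 𝔹.≟ true) ×-dec G? u v))

      not-both : ∀ {v i} → C v ≡ true → β v ≡ just i → ⊥
      not-both c e with trans (sym e) (C-free _ c)
      ... | ()

      #X≤s : # X ≤ s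
      #X≤s = ≤-trans
        (cnt-⋃ (allFin t) (allFin n) {X} (λ i v → X v ∧ is i (β v))
          (λ v x → let i , e = X-label v x in i , ∈-allFin i , ∧-intro x (is-intro (β v) e)))
        (≤-trans (Σ-≤-const (allFin t) (λ i _ → X-small i)) (≤-reflexive (cong (_* r) (length-tabulate {n = t} id))))

      #R≤ : # R ≤ # C + (# X + # rest)
      #R≤ = ≤-trans (cnt-∪ (allFin n) {q = C} {r = λ v → X v ∨ rest v} f)
        (+-monoʳ-≤ (# C) (cnt-∪ (allFin n) (λ v → ∨-elim)))
        where
        f : ∀ v → R v ≡ true → C v ≡ true ⊎ (X v ∨ rest v) ≡ true
        f v e with C v | X v
        ... | true | _ = inj₁ refl
        ... | false | true = inj₂ refl
        ... | false | false = inj₂ (∧-intro e refl)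

    record State : Set where
      field
        pre : PreState
      open PreState pre public
      field
        rest-small : 2 * t * # rest < # R

      -- `X` takes at most s < #R/4 and `rest` less than #R/(2t) ≤ #R/4, which leaves more than half
      -- of `R` for `C`.
      C-large : # R < 2 * # C
      C-large = *-cancelˡ-< 2 (# R) (2 * # C) (+-cancelʳ-< (# R + # R) (2 * # R) (2 * (2 * # C)) (begin-strict
        2 * # R + (# R + # R) ≡⟨ e₁ (# R) ⟩
        4 * # R ≤⟨ *-monoʳ-≤ 4 #R≤ ⟩
        4 * (# C + (# X + # rest)) ≡⟨ e₂ (# C) (# X) (# rest) ⟩
        2 * (2 * # C) + (4 * # X + 4 * # rest)
          <⟨ +-monoʳ-< (2 * (2 * # C)) (+-mono-< (≤-<-trans (*-monoʳ-≤ 4 #X≤s) R-large)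
               (≤-<-trans (*-monoˡ-≤ (# rest) (*-monoʳ-≤ 2 2≤t)) rest-small)) ⟩
        2 * (2 * # C) + (# R + # R) ∎))
        where
        open ≤-Reasoning
        e₁ : ∀ x → 2 * x + (x + x) ≡ 4 * x
        e₁ = solve-∀
        e₂ : ∀ a b c → 4 * (a + (b + c)) ≡ 2 * (2 * a) + (4 * b + 4 * c)
        e₂ = solve-∀

    1≤t : 1 ≤ t
    1≤t = ≤-trans (s≤s z≤n) 2≤t

    -- If `rest` is too large for a `State`, then `C` and `rest` are themselves the sides of a
    -- separation: by `boundary`, edges leaving `C` inside `R` end in `X`, and `X` has at most `s`
    -- vertices.
    complete : (p : PreState) → # R ≤ 2 * t * # (PreState.C p) →
      BalancedSeparation R ⊎ (Σ State λ σ → State.pre σ ≡ p)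
    complete p C-big with 2 * t * # (PreState.rest p) <? # R
    ... | yes h = inj₂ (record { pre = p ; rest-small = h } , refl)
    ... | no h = inj₁ (record
      { A = C ; B = rest ; A⊂R = C⊂R ; B⊂R = λ v → proj₁ ∘ ∧-elim
      ; disjoint = λ v c e → in-rest v e (inj₁ c)
      ; no-edge = λ u v c e g → in-rest v e (boundary u v c g (proj₁ (∧-elim e)))
      ; A-large = C-big ; B-large = ≮⇒≥ h
      ; small = ≤-trans (cnt-mono (allFin n) outside) #X≤s })
      where
      open PreState p
      in-rest : ∀ v → rest v ≡ true → C v ≡ true ⊎ X v ≡ true → ⊥
      in-rest v e h with R v | C v | X v
      in-rest v () h | true | true | _
      in-rest v () h | true | false | true
      in-rest v e (inj₁ ()) | true | false | false
      in-rest v e (inj₂ ()) | true | false | false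
      outside : ∀ v → R v ∧ not (C v ∨ rest v) ≡ true → X v ≡ true
      outside v e with R v | C v | X v
      ... | true | false | true = refl
      outside v () | true | true | _
      outside v () | true | false | false

    Clean : PreState → Set
    Clean p = ∀ i v → PreState.β p v ≡ just i → PreState.Alive p i

    -- A branch set without neighbours in `C` cannot be joined to any later one, so it is dissolved
    -- and its label set free. `X` may lose its vertices, since a vertex of `X` with a neighbour in
    -- `C` belongs to a live set. They may enlarge `rest`, which is why `complete` is applied
    -- afterwards.
    module CleanUp (p : PreState) where
      open PreState p

      β₁ : Fin n → Maybe (Fin t)
      β₁ v with β v
      ... | nothing = nothing
      ... | just i with alive? i
      ...   | yes _ = just i
      ...   | no _ = nothing

      β₁-elim : ∀ v {i} → β₁ v ≡ just i → β v ≡ just i × Alive i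
      β₁-elim v e with β v
      ... | just i with alive? i
      β₁-elim v refl | just i | yes a = refl , a

      β₁-intro : ∀ v {i} → β v ≡ just i → Alive i → β₁ v ≡ just i
      β₁-intro v {i} e a rewrite e with alive? i
      ... | yes _ = refl
      ... | no ¬a = ⊥-elim (¬a a)

      β₁-nothing : ∀ v → β v ≡ nothing → β₁ v ≡ nothing
      β₁-nothing v e rewrite e = refl

      labelled? : ∀ v → Dec (∃[ i ] β₁ v ≡ just i)
      labelled? v with β₁ v
      ... | just i = yes (i , refl)
      ... | nothing = no λ ()

      X₁ : Sub n
      X₁ v = X v ∧ ⌊ labelled? v ⌋

      cleaned : PreState
      cleaned = record
        { β = β₁ ; C = C ; X = X₁ ; C⊂R = C⊂R
        ; C-free = λ v c → β₁-nothing v (C-free v c)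
        ; boundary = boundary₁
        ; X-label = λ v x → dec-true (labelled? v) (proj₂ (∧-elim {X v} x))
        ; X-small = λ i → ≤-trans (cnt-mono (allFin n) (λ v e → let x , l = ∧-elim {X₁ v} e in
            ∧-intro (proj₁ (∧-elim {X v} x)) (is-intro (β v) (proj₁ (β₁-elim v (is-true (β₁ v) l)))))) (X-small i)
        ; conn = λ i u v eu ev → let eu′ , a = β₁-elim u eu in
            path-mono (λ w e → β₁-intro w e a) (conn i u v eu′ (proj₁ (β₁-elim v ev)))
        ; adj = λ i j i≢j (u , eu) (v , ev) →
            let eu′ , ai = β₁-elim u eu
                ev′ , aj = β₁-elim v ev
                u′ , v′ , e₁ , e₂ , g = adj i j i≢j (u , eu′) (v , ev′)
            in u′ , v′ , β₁-intro u′ e₁ ai , β₁-intro v′ e₂ aj , g }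
        where
        boundary₁ : ∀ u v → C u ≡ true → G u v → R v ≡ true → C v ≡ true ⊎ X₁ v ≡ true
        boundary₁ u v c g rv with boundary u v c g rv
        ... | inj₁ c′ = inj₁ c′
        ... | inj₂ x = let i , e = X-label v x in
          inj₂ (∧-intro x (dec-intro (labelled? v) (i , β₁-intro v e (v , e , u , c , G-sym g))))

      clean : Clean cleaned
      clean i v e = let e′ , (u , eu , w , c , g) = β₁-elim v e in
        u , β₁-intro u eu (u , eu , w , c , g) , w , c , g

      dead : ∀ j → ¬ Alive j → ∀ v → β₁ v ≢ just j
      dead j ¬a v e = ¬a (proj₂ (β₁-elim v e))

    -- Absorbing into branch set i the breadth-first ball around its
    -- neighbourhood replaces the charge of i by the thin last layer.
    module Absorb (p : PreState) (i : Fin t) (alive : PreState.Alive p i) (ℓ : ℕ) where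
      open PreState p

      A : Sub n
      A v = C v ∧ nbr (λ w → is i (β w)) v

      A-nbr : ∀ v → A v ≡ true → ∃[ w ] (β w ≡ just i × G w v)
      A-nbr v e = let w , l , g = dec-true (nbr? (λ w → is i (β w)) v) (proj₂ (∧-elim {C v} e)) in
        w , is-true (β w) l , g

      A-intro : ∀ {w} v → C v ≡ true → β w ≡ just i → G w v → A v ≡ true
      A-intro {w} v c e g = ∧-intro c (dec-intro (nbr? (λ w → is i (β w)) v) (w , is-intro (β w) e , g))

      open Ball C A (λ v → proj₁ ∘ ∧-elim) public

      D : Sub n
      D = ball (suc ℓ)

      β₁ : Fin n → Maybe (Fin t)
      β₁ v = if D v then just i else β v

      C₁ X₁ : Sub n
      C₁ v = C v ∧ not (D v)
      X₁ v = (X v ∧ not (is i (β v))) ∨ layer ℓ v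

      not-D : ∀ v {k} → β v ≡ just k → D v ≡ false
      not-D v e with bool-case (D v)
      ... | inj₁ d = ⊥-elim (not-both (ball⊂C (suc ℓ) v d) e)
      ... | inj₂ d = d

      keep : ∀ v {k} → β v ≡ just k → β₁ v ≡ just k
      keep v e rewrite not-D v e = e

      in-D : ∀ v → D v ≡ true → β₁ v ≡ just i
      in-D v d rewrite d = refl

      back : ∀ v {k} → β₁ v ≡ just k → (D v ≡ true × k ≡ i) ⊎ β v ≡ just k
      back v e with D v
      ... | true = inj₁ (refl , sym (just-injective e))
      ... | false = inj₂ e

      nonempty : ∀ k v → β₁ v ≡ just k → ∃[ u ] β u ≡ just k
      nonempty k v e with back v e
      ... | inj₁ (_ , refl) = proj₁ alive , proj₁ (proj₂ alive)
      ... | inj₂ e′ = v , e′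

      anchor : Fin n
      anchor = proj₁ alive

      to-anchor : ∀ v → β v ≡ just i → PathIn G (λ w → β₁ w ≡ just i) v anchor
      to-anchor v e = path-mono (λ w → keep w) (conn i v anchor e (proj₁ (proj₂ alive)))

      D-to-anchor : ∀ k → k ≤ suc ℓ → ∀ v → ball k v ≡ true → PathIn G (λ w → β₁ w ≡ just i) v anchor
      D-to-anchor zero _ v b = let w , e , g = A-nbr v b in step (G-sym g) (keep w e) (to-anchor w e)
      D-to-anchor (suc k) k≤ v b with ball-pred k v b
      ... | inj₁ b′ = D-to-anchor k (≤-trans (n≤1+n k) k≤) v b′
      ... | inj₂ (w , bw , g) = step (G-sym g) (in-D w (ball-mono (≤-trans (n≤1+n k) k≤) w bw))
              (D-to-anchor k (≤-trans (n≤1+n k) k≤) w bw)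

      boundary₁ : ∀ u v → C₁ u ≡ true → G u v → R v ≡ true → C₁ v ≡ true ⊎ X₁ v ≡ true
      boundary₁ u v c g rv with ∧-elim {C u} c
      ... | cu , du with boundary u v cu g rv
      ...   | inj₁ cv with bool-case (D v) | bool-case (ball ℓ v)
      ...     | inj₂ d | _ = inj₁ (∧-intro cv (not-intro d))
      ...     | inj₁ d | inj₂ b = inj₂ (∨-introʳ {X v ∧ not (is i (β v))} (∧-intro d (not-intro b)))
      ...     | inj₁ d | inj₁ b = ⊥-elim (true≢false (ball-step ℓ b (G-sym g) cu) (not-elim du))
      boundary₁ u v c g rv | cu , du | inj₂ xv with bool-case (is i (β v))
      ...     | inj₁ l = ⊥-elim (true≢false (centre (suc ℓ) u (A-intro u cu (is-true (β v) l) (G-sym g))) (not-elim du))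
      ...     | inj₂ l = inj₂ (∨-introˡ (∧-intro xv (not-intro l)))

      X₁-label : ∀ v → X₁ v ≡ true → ∃[ k ] β₁ v ≡ just k
      X₁-label v e with ∨-elim {X v ∧ not (is i (β v))} e
      ... | inj₁ x = let k , e′ = X-label v (proj₁ (∧-elim {X v} x)) in k , keep v e′
      ... | inj₂ x = i , in-D v (proj₁ (∧-elim {D v} x))

      X₁-small : # (layer ℓ) ≤ r → ∀ k → # (λ v → X₁ v ∧ is k (β₁ v)) ≤ r
      X₁-small thin k with k Fin.≟ i
      ... | yes refl = ≤-trans (cnt-mono (allFin n) f) thin
        where
        f : ∀ v → X₁ v ∧ is k (β₁ v) ≡ true → layer ℓ v ≡ true
        f v e with ∧-elim {X₁ v} e
        ... | x , l with ∨-elim {X v ∧ not (is k (β v))} x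
        ...   | inj₂ y = y
        ...   | inj₁ y with ∧-elim {X v} y
        ...     | xv , nl with back v (is-true (β₁ v) l)
        ...       | inj₁ (d , _) = ⊥-elim (not-both (ball⊂C (suc ℓ) v d) (proj₂ (X-label v xv)))
        ...       | inj₂ e′ = ⊥-elim (true≢false (is-intro (β v) e′) (not-elim nl))
      ... | no k≢i = ≤-trans (cnt-mono (allFin n) f) (X-small k)
        where
        f : ∀ v → X₁ v ∧ is k (β₁ v) ≡ true → X v ∧ is k (β v) ≡ true
        f v e with ∧-elim {X₁ v} e
        ... | x , l with back v (is-true (β₁ v) l)
        ...   | inj₁ (_ , k≡i) = ⊥-elim (k≢i k≡i)
        ...   | inj₂ e′ with ∨-elim {X v ∧ not (is i (β v))} x
        ...     | inj₁ y = ∧-intro (proj₁ (∧-elim {X v} y)) (is-intro (β v) e′)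
        ...     | inj₂ y = ⊥-elim (true≢false (proj₁ (∧-elim {D v} y)) (not-D v e′))

      conn₁ : ∀ k u v → β₁ u ≡ just k → β₁ v ≡ just k → PathIn G (λ w → β₁ w ≡ just k) u v
      conn₁ k u v eu ev with k Fin.≟ i
      ... | yes refl = anchored G-sym anchor f u v eu ev
        where
        f : ∀ v → β₁ v ≡ just k → PathIn G (λ w → β₁ w ≡ just k) v anchor
        f v e with back v e
        ... | inj₁ (d , _) = D-to-anchor (suc ℓ) ≤-refl v d
        ... | inj₂ e′ = to-anchor v e′
      ... | no k≢i with back u eu | back v ev
      ...   | inj₁ (_ , k≡i) | _ = ⊥-elim (k≢i k≡i)
      ...   | inj₂ _ | inj₁ (_ , k≡i) = ⊥-elim (k≢i k≡i)
      ...   | inj₂ eu′ | inj₂ ev′ = path-mono (λ w → keep w) (conn k u v eu′ ev′)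

      absorbed : # (layer ℓ) ≤ r → PreState
      absorbed thin = record
        { β = β₁ ; C = C₁ ; X = X₁ ; C⊂R = λ v c → C⊂R v (proj₁ (∧-elim c))
        ; C-free = C₁-free
        ; boundary = boundary₁
        ; X-label = X₁-label
        ; X-small = X₁-small thin
        ; conn = conn₁
        ; adj = λ k l k≢l (u , eu) (v , ev) →
            let u′ , v′ , e₁ , e₂ , g = adj k l k≢l (nonempty k u eu) (nonempty l v ev)
            in u′ , v′ , keep u′ e₁ , keep v′ e₂ , g }
        where
        C₁-free : ∀ v → C₁ v ≡ true → β₁ v ≡ nothing
        C₁-free v c with ∧-elim {C v} c
        ... | cv , dv rewrite not-elim dv = C-free v cv

      shrinks : # C₁ < # C
      shrinks = let u , eu , v , cv , g = alive in cnt-strict (allFin n) (λ x → proj₁ ∘ ∧-elim) (∈-allFin v) cv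
        (subst (λ z → C v ∧ not z ≡ false) (sym (centre (suc ℓ) v (A-intro v cv eu g))) (𝔹.∧-zeroʳ (C v)))

    -- Every live branch set is within distance `ρ` of `v₀`. The union of the paths from `v₀` to
    -- each of them becomes branch set `j`; it has at most `r` vertices, so all of it can be charged
    -- to `X`.
    module Extend (p : PreState) (clean : Clean p) (j : Fin t) (j-unused : ∀ v → PreState.β p v ≢ just j)
      (v₀ : Fin n) (v₀∈C : PreState.C p v₀ ≡ true)
      (near : ∀ i (a : PreState.Alive p i) → Absorb.ball p i a 0 ρ v₀ ≡ true) where
      open PreState p

      record Branch (i : Fin t) : Set where
        field
          S : Sub n
          root : S v₀ ≡ true
          S⊂C : ∀ w → S w ≡ true → C w ≡ true
          connected : ∀ w → S w ≡ true → PathIn G (λ x → S x ≡ true) w v₀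
          size : # S ≤ suc ρ
          meets : Alive i → ∃[ u ] ∃[ w ] (S u ≡ true × β w ≡ just i × G w u)

      branch : ∀ i → Branch i
      branch i with alive? i
      -- A dead label has to be met by nothing; the singleton still contains the common root `v₀`.
      ... | no ¬a = record
        { S = sing v₀ ; root = dec-intro (v₀ Fin.≟ v₀) refl
        ; S⊂C = λ w e → subst (λ z → C z ≡ true) (sym (dec-true (w Fin.≟ v₀) e)) v₀∈C
        ; connected = λ w e → subst (λ z → PathIn G _ z v₀) (sym (dec-true (w Fin.≟ v₀) e)) here
        ; size = ≤-trans (#-sing v₀) (s≤s z≤n)
        ; meets = λ a → ⊥-elim (¬a a) }
      ... | yes a = record
        { S = T ; root = root ; S⊂C = T⊂C ; connected = connected ; size = size
        ; meets = λ _ → let u , tu , au = meets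
                            w , e , g = A-nbr u au
                        in u , w , tu , e , g }
        where
        open Absorb p i a 0
        open Tree (tree ρ v₀ (near i a))

      S : Fin t → Sub n
      S i = Branch.S (branch i)

      inT? : ∀ v → Dec (∃[ i ] S i v ≡ true)
      inT? v = Fin.any? (λ i → S i v 𝔹.≟ true)

      T : Sub n
      T v = ⌊ inT? v ⌋

      T⊂C : ∀ v → T v ≡ true → C v ≡ true
      T⊂C v e = let i , e′ = dec-true (inT? v) e in Branch.S⊂C (branch i) v e′

      T-intro : ∀ i v → S i v ≡ true → T v ≡ true
      T-intro i v e = dec-intro (inT? v) (i , e)

      #T≤r : # T ≤ r
      #T≤r = ≤-trans (cnt-⋃ (allFin t) (allFin n) {T} S (λ v e → let i , e′ = dec-true (inT? v) e in i , ∈-allFin i , e′))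
        (≤-trans (Σ-≤-const (allFin t) (λ i _ → Branch.size (branch i)))
          (≤-reflexive (cong (_* suc ρ) (length-tabulate {n = t} id))))

      β₁ : Fin n → Maybe (Fin t)
      β₁ v = if T v then just j else β v

      C₁ X₁ : Sub n
      C₁ v = C v ∧ not (T v)
      X₁ v = X v ∨ T v

      not-T : ∀ v {k} → β v ≡ just k → T v ≡ false
      not-T v e with bool-case (T v)
      ... | inj₁ d = ⊥-elim (not-both (T⊂C v d) e)
      ... | inj₂ d = d

      keep : ∀ v {k} → β v ≡ just k → β₁ v ≡ just k
      keep v e rewrite not-T v e = e

      in-T : ∀ v → T v ≡ true → β₁ v ≡ just j
      in-T v d rewrite d = refl

      back : ∀ v {k} → β₁ v ≡ just k → (T v ≡ true × k ≡ j) ⊎ (β v ≡ just k × k ≢ j)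
      back v e with T v
      ... | true = inj₁ (refl , sym (just-injective e))
      ... | false = inj₂ (e , λ { refl → j-unused v e })

      boundary₁ : ∀ u v → C₁ u ≡ true → G u v → R v ≡ true → C₁ v ≡ true ⊎ X₁ v ≡ true
      boundary₁ u v c g rv with boundary u v (proj₁ (∧-elim c)) g rv
      ... | inj₂ x = inj₂ (∨-introˡ x)
      ... | inj₁ cv with bool-case (T v)
      ...   | inj₁ d = inj₂ (∨-introʳ {X v} d)
      ...   | inj₂ d = inj₁ (∧-intro cv (not-intro d))

      X₁-small : ∀ k → # (λ v → X₁ v ∧ is k (β₁ v)) ≤ r
      X₁-small k with k Fin.≟ j
      ... | yes refl = ≤-trans (cnt-mono (allFin n) f) #T≤r
        where
        f : ∀ v → X₁ v ∧ is k (β₁ v) ≡ true → T v ≡ true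
        f v e with back v (is-true (β₁ v) (proj₂ (∧-elim {X₁ v} e)))
        ... | inj₁ (d , _) = d
        ... | inj₂ (_ , k≢k) = ⊥-elim (k≢k refl)
      ... | no k≢j = ≤-trans (cnt-mono (allFin n) f) (X-small k)
        where
        f : ∀ v → X₁ v ∧ is k (β₁ v) ≡ true → X v ∧ is k (β v) ≡ true
        f v e with ∧-elim {X₁ v} e
        ... | x , l with back v (is-true (β₁ v) l)
        ...   | inj₁ (_ , k≡j) = ⊥-elim (k≢j k≡j)
        ...   | inj₂ (e′ , _) with ∨-elim {X v} x
        ...     | inj₁ xv = ∧-intro xv (is-intro (β v) e′)
        ...     | inj₂ d = ⊥-elim (true≢false d (not-T v e′))

      conn₁ : ∀ k u v → β₁ u ≡ just k → β₁ v ≡ just k → PathIn G (λ w → β₁ w ≡ just k) u v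
      conn₁ k u v eu ev with back u eu | back v ev
      ... | inj₁ (_ , refl) | _ = anchored G-sym v₀ f u v eu ev
        where
        f : ∀ v → β₁ v ≡ just k → PathIn G (λ w → β₁ w ≡ just k) v v₀
        f v e with back v e
        ... | inj₂ (_ , k≢k) = ⊥-elim (k≢k refl)
        ... | inj₁ (d , _) = let i , e′ = dec-true (inT? v) d in
          path-mono (λ w e″ → in-T w (T-intro i w e″)) (Branch.connected (branch i) v e′)
      ... | inj₂ (_ , k≢j) | inj₁ (_ , k≡j) = ⊥-elim (k≢j k≡j)
      ... | inj₂ (eu′ , _) | inj₂ (ev′ , _) = path-mono (λ w → keep w) (conn k u v eu′ ev′)

      meets-T : ∀ l v → β v ≡ just l → ∃[ u ] ∃[ w ] (β₁ u ≡ just j × β₁ w ≡ just l × G w u)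
      meets-T l v e = let u , w , su , e′ , g = Branch.meets (branch l) (clean l v e) in
        u , w , in-T u (T-intro l u su) , keep w e′ , g

      adj₁ : ∀ k l → k ≢ l → ∃[ u ] β₁ u ≡ just k → ∃[ v ] β₁ v ≡ just l →
        ∃[ u ] ∃[ v ] (β₁ u ≡ just k × β₁ v ≡ just l × G u v)
      adj₁ k l k≢l (u , eu) (v , ev) with back u eu | back v ev
      ... | inj₁ (_ , k≡j) | inj₁ (_ , l≡j) = ⊥-elim (k≢l (trans k≡j (sym l≡j)))
      ... | inj₁ (_ , refl) | inj₂ (e , _) = let a , b , e₁ , e₂ , g = meets-T l v e in a , b , e₁ , e₂ , G-sym g
      ... | inj₂ (e , _) | inj₁ (_ , refl) = let a , b , e₁ , e₂ , g = meets-T k u e in b , a , e₂ , e₁ , g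
      ... | inj₂ (e , _) | inj₂ (e′ , _) =
        let a , b , e₁ , e₂ , g = adj k l k≢l (u , e) (v , e′) in a , b , keep a e₁ , keep b e₂ , g

      extended : PreState
      extended = record
        { β = β₁ ; C = C₁ ; X = X₁ ; C⊂R = λ v c → C⊂R v (proj₁ (∧-elim c))
        ; C-free = C₁-free
        ; boundary = boundary₁
        ; X-label = X₁-label
        ; X-small = X₁-small
        ; conn = conn₁
        ; adj = adj₁ }
        where
        C₁-free : ∀ v → C₁ v ≡ true → β₁ v ≡ nothing
        C₁-free v c with ∧-elim {C v} c
        ... | cv , dv rewrite not-elim dv = C-free v cv
        X₁-label : ∀ v → X₁ v ≡ true → ∃[ k ] β₁ v ≡ just k
        X₁-label v e with ∨-elim {X v} e
        ... | inj₁ x = let k , e′ = X-label v x in k , keep v e′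
        ... | inj₂ x = j , in-T v x

      -- All vertices that leave `C` enter `X`, so the smallness of `rest` carries over without
      -- another call of `complete`.
      rest-mono : ∀ v → PreState.rest extended v ≡ true → rest v ≡ true
      rest-mono v e with R v | C v | X v | T v
      ... | true | false | false | _ = refl
      rest-mono v () | true | true | true | false
      rest-mono v () | true | true | true | true
      rest-mono v () | true | true | false | false
      rest-mono v () | true | true | false | true
      rest-mono v () | true | false | true | _

      shrinks : # C₁ < # C
      shrinks = cnt-strict (allFin n) (λ x → proj₁ ∘ ∧-elim) (∈-allFin v₀) v₀∈C
        (subst (λ z → C v₀ ∧ not z ≡ false) (sym (T-intro j v₀ (Branch.root (branch j)))) (𝔹.∧-zeroʳ (C v₀)))

    Outcome : ℕ → Set
    Outcome k = HasMinor G t ⊎ BalancedSeparation R ⊎ (Σ State λ σ → # (State.C σ) < k)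

    C-large-enough : (σ : State) → # R ≤ 2 * t * # (State.C σ)
    C-large-enough σ = ≤-trans (<⇒≤ (State.C-large σ)) (*-monoˡ-≤ _ (≤-trans (≤-reflexive (sym (*-identityʳ 2))) (*-monoʳ-≤ 2 1≤t)))

    module Progress (σ : State) (clean : Clean (State.pre σ)) (j : Fin t)
      (j-unused : ∀ v → State.β σ v ≢ just j) where
      open State σ

      -- The argument `0` is an arbitrary layer index: the balls are the same for all `ℓ`, so `far`
      -- can be compared with an absorption at a layer found later.
      far : ∀ i → Alive i → Sub n
      far i a v = C v ∧ not (Absorb.ball pre i a 0 ρ v)

      -- The thin layer has `ℓ < ρ`, so the absorbed ball stays inside the ball of radius `ρ`. Hence
      -- `C₁` contains `far i a` and is large enough for `complete`.
      absorb : ∀ i (a : Alive i) → # R ≤ 2 * t * # (far i a) → Outcome (# C)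
      absorb i a big = go (Absorb.exists-thin-layer pre i a 0)
        where
        go : ∃[ ℓ ] (ℓ < ρ × # (Absorb.layer pre i a 0 ℓ) ≤ r) → Outcome (# C)
        go (ℓ , ℓ<ρ , thin) with complete (absorbed thin) (≤-trans big (*-monoʳ-≤ (2 * t) (cnt-mono (allFin n) f)))
          where
          open Absorb pre i a ℓ
          f : ∀ v → far i a v ≡ true → C₁ v ≡ true
          f v e with ∧-elim {C v} e
          ... | c , h with bool-case (D v)
          ...   | inj₁ d = ⊥-elim (true≢false (ball-mono ℓ<ρ v d) (not-elim h))
          ...   | inj₂ d = ∧-intro c (not-intro d)
        ... | inj₁ sep = inj₂ (inj₁ sep)
        ... | inj₂ (σ′ , refl) = inj₂ (inj₂ (σ′ , Absorb.shrinks pre i a ℓ))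

      extend : ∀ v₀ → C v₀ ≡ true → (∀ i (a : Alive i) → Absorb.ball pre i a 0 ρ v₀ ≡ true) → Outcome (# C)
      extend v₀ c near = inj₂ (inj₂ (record { pre = extended
          ; rest-small = ≤-<-trans (*-monoʳ-≤ (2 * t) (cnt-mono (allFin n) rest-mono)) rest-small } , shrinks))
        where open Extend pre clean j j-unused v₀ c near

      farAt : Fin t → Sub n
      farAt i v with alive? i
      ... | yes a = far i a v
      ... | no _ = false

      -- Union bound: `t` sets with fewer than #R/(2t) vertices each have together fewer than #R/2 <
      -- #C.
      common : (∀ i → 2 * t * # (farAt i) < # R) → ∃[ v ] (C v ≡ true × (∀ i → farAt i v ≡ false))
      common small with Fin.any? (λ v → (C v 𝔹.≟ true) ×-dec Fin.all? (λ i → farAt i v 𝔹.≟ false))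
      ... | yes x = x
      ... | no ¬x = ⊥-elim (<-irrefl refl (begin-strict
        t * # R <⟨ *-monoʳ-< t {{>-nonZero 1≤t}} C-large ⟩
        t * (2 * # C) ≡⟨ trans (sym (*-assoc t 2 (# C))) (cong (_* # C) (*-comm t 2)) ⟩
        2 * t * # C ≤⟨ *-monoʳ-≤ (2 * t) (cnt-⋃ (allFin t) (allFin n) farAt f) ⟩
        2 * t * (Σ[ allFin t ] (λ i → # (farAt i))) ≡⟨ *-comm (2 * t) _ ⟩
        (Σ[ allFin t ] (λ i → # (farAt i))) * (2 * t) ≡⟨ Σ-*ʳ (allFin t) (λ i → # (farAt i)) (2 * t) ⟨
        (Σ[ allFin t ] (λ i → # (farAt i) * (2 * t)))
          ≤⟨ Σ-≤-const (allFin t) (λ i _ → ≤-trans (≤-reflexive (*-comm _ (2 * t))) (<⇒≤ (small i))) ⟩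
        length (allFin t) * # R ≡⟨ cong (_* # R) (length-tabulate {n = t} id) ⟩
        t * # R ∎))
        where
        open ≤-Reasoning
        f : ∀ v → C v ≡ true → ∃[ i ] (i ∈ allFin t × farAt i v ≡ true)
        f v c with Fin.any? (λ i → farAt i v 𝔹.≟ true)
        ... | yes (i , e) = i , ∈-allFin i , e
        ... | no ¬e = ⊥-elim (¬x (v , c , λ i → 𝔹.¬-not (λ e → ¬e (i , e))))

      progress : Outcome (# C)
      progress with Fin.any? (λ i → # R ≤? 2 * t * # (farAt i))
      ... | yes (i , h) = go
        where
        go : Outcome (# C)
        go with alive? i
        ... | yes a = absorb i a h
        ... | no _ = ⊥-elim (<-irrefl refl (begin-strict
          0 ≤⟨ z≤n ⟩
          4 * s <⟨ R-large ⟩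
          # R ≤⟨ h ⟩
          2 * t * # {n} (λ _ → false) ≡⟨ cong (2 * t *_) (cnt-false (allFin n) (λ _ _ → refl)) ⟩
          2 * t * 0 ≡⟨ *-zeroʳ (2 * t) ⟩
          0 ∎))
          where open ≤-Reasoning
      ... | no h with common (λ i → ≰⇒> (λ x → h (i , x)))
      ...   | v₀ , c , near = extend v₀ c near′
        where
        near′ : ∀ i (a : Alive i) → Absorb.ball pre i a 0 ρ v₀ ≡ true
        near′ i a with alive? i | near i
        ... | no ¬a | _ = ⊥-elim (¬a a)
        ... | yes a′ | e with bool-case (Absorb.ball pre i a 0 ρ v₀)
        ...   | inj₁ b = b
        ...   | inj₂ b = ⊥-elim (true≢false (∧-intro c (not-intro b)) e)

    -- If all `t` labels are alive, their classes are nonempty and `adj` yields the minor. Otherwise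
    -- a dead label is available for the next branch set. Absorbing and extending both remove
    -- vertices from `C`, the measure of `iterate`.
    advance : (σ : State) → Outcome (# (State.C σ))
    advance σ with Fin.all? (State.alive? σ)
    ... | yes alive = inj₁ (β , (λ i → let u , e , _ = alive i in u , e) , conn ,
            (λ i j i≢j → adj i j i≢j (proj₁ (alive i) , proj₁ (proj₂ (alive i)))
                                      (proj₁ (alive j) , proj₁ (proj₂ (alive j)))))
      where open State σ
    ... | no ¬alive with Fin.¬∀⟶∃¬ t _ (State.alive? σ) ¬alive
    ...   | j , ¬a with complete (CleanUp.cleaned (State.pre σ)) (C-large-enough σ)
    ...     | inj₁ sep = inj₂ (inj₁ sep)
    ...     | inj₂ (σ′ , refl) = Progress.progress σ′ (CleanUp.clean (State.pre σ)) j
                (CleanUp.dead (State.pre σ) j ¬a)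

    iterate : (σ : State) → Acc _<_ (# (State.C σ)) → HasMinor G t ⊎ BalancedSeparation R
    iterate σ (acc rs) with advance σ
    ... | inj₁ m = inj₁ m
    ... | inj₂ (inj₁ sep) = inj₂ sep
    ... | inj₂ (inj₂ (σ′ , lt)) = iterate σ′ (rs lt)

    start : State
    start = record
      { pre = record
        { β = λ _ → nothing ; C = R ; X = λ _ → false ; C⊂R = λ _ e → e ; C-free = λ _ _ → refl
        ; boundary = λ _ _ _ _ e → inj₁ e ; X-label = λ _ ()
        ; X-small = λ i → ≤-trans (≤-reflexive (cnt-false (allFin n) (λ _ _ → refl))) z≤n
        ; conn = λ _ _ _ () ; adj = λ _ _ _ () }
      ; rest-small = ≤-<-trans (≤-reflexive (trans (cong (2 * t *_) (cnt-false (allFin n) (λ v _ → f v))) (*-zeroʳ (2 * t))))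
          (≤-<-trans z≤n R-large) }
      where
      f : ∀ v → R v ∧ not (R v ∨ false) ≡ false
      f v with R v
      ... | true = refl
      ... | false = refl

    minor-or-separation : HasMinor G t ⊎ BalancedSeparation R
    minor-or-separation = iterate start (<-wellFounded _)

-- Shattering

module Shatter {n : ℕ} (G : Graph n) (G-sym : ∀ {u v} → G u v → G v u) (G? : ∀ u v → Dec (G u v))
  (t ρ : ℕ) (2≤t : 2 ≤ t) (large-ρ : n < ρ * suc (t * suc ρ))
  (m : ℕ) (small-s : 4 * (t * (t * suc ρ)) ≤ m) where

  open Separate G G-sym G? t ρ 2≤t large-ρ

  class : Sub n → (Fin n → ℕ) → ℕ → Sub n
  class R χ c v = R v ∧ ⌊ χ v ≟ c ⌋

  class-elim : ∀ R χ c v → class R χ c v ≡ true → R v ≡ true × χ v ≡ c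
  class-elim R χ c v e = let a , b = ∧-elim {R v} e in a , dec-true (χ v ≟ c) b

  class-intro : ∀ R χ c v → R v ≡ true → χ v ≡ c → class R χ c v ≡ true
  class-intro R χ c v a b = ∧-intro a (dec-intro (χ v ≟ c) b)

  -- Label 0 marks the separator; there are k other labels.
  record Shattering (R : Sub n) : Set where
    field
      χ : Fin n → ℕ
      k : ℕ
      bound : ∀ v → χ v ≤ k
      no-edge : ∀ u v → R u ≡ true → R v ≡ true → χ u ≢ 0 → χ v ≢ 0 → G u v → χ u ≡ χ v
      -- The summand `s` on the left is an off-by-one: `k` pieces arise from `k` - 1 separations,
      -- each adding at most `s` vertices to label 0.
      separator : # (class R χ 0) + s ≤ s * k
      classes : ∀ c → # (class R χ (suc c)) ≤ m
      few : k * m ≤ 2 * t * # R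

  leaf : ∀ R → # R ≤ m → m ≤ 2 * t * # R → Shattering R
  leaf R R≤ ≤R = record
    { χ = λ _ → 1 ; k = 1 ; bound = λ _ → ≤-refl ; no-edge = λ _ _ _ _ _ _ _ → refl
    ; separator = ≤-reflexive (trans (cong (_+ s) (cnt-false (allFin n) (λ v _ → f v))) (sym (*-identityʳ s)))
    ; classes = λ c → ≤-trans (cnt-mono (allFin n) (λ v → proj₁ ∘ ∧-elim)) R≤
    ; few = ≤-trans (≤-reflexive (*-identityˡ m)) ≤R }
    where
    f : ∀ v → class R (λ _ → 1) 0 v ≡ false
    f v with R v
    ... | true = refl
    ... | false = refl

  module Glue (R : Sub n) (sep : BalancedSeparation R)
    (ShA : Shattering (BalancedSeparation.A sep)) (ShB : Shattering (BalancedSeparation.B sep)) where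
    open BalancedSeparation sep
    open Shattering ShA using () renaming (χ to χA; k to kA)
    open Shattering ShB using () renaming (χ to χB; k to kB)
    module SA = Shattering ShA
    module SB = Shattering ShB

    -- The labels of `B` move past those of `A`, while both separators keep the common label 0.
    shift : ℕ → ℕ
    shift zero = zero
    shift (suc c) = kA + suc c

    χ : Fin n → ℕ
    χ v = if A v then χA v else (if B v then shift (χB v) else 0)

    χ-A : ∀ v → A v ≡ true → χ v ≡ χA v
    χ-A v a rewrite a = refl

    χ-B : ∀ v → B v ≡ true → χ v ≡ shift (χB v)
    χ-B v b with A v in a
    ... | true = ⊥-elim (disjoint v a b)
    ... | false rewrite b = refl

    χ-cases : ∀ v → A v ≡ true ⊎ B v ≡ true ⊎ (A v ∨ B v ≡ false × χ v ≡ 0)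
    χ-cases v with A v in a
    ... | true = inj₁ refl
    ... | false with B v in b
    ...   | true = inj₂ (inj₁ refl)
    ...   | false = inj₂ (inj₂ (refl , refl))

    shift≡0 : ∀ c → shift c ≡ 0 → c ≡ 0
    shift≡0 zero _ = refl
    shift≡0 (suc c) e with trans (sym (+-suc kA c)) e
    ... | ()

    shift-bound : ∀ c → c ≤ kB → shift c ≤ kA + kB
    shift-bound zero _ = z≤n
    shift-bound (suc c) h = +-monoʳ-≤ kA h

    shift-big : ∀ c → c ≢ 0 → kA < shift c
    shift-big zero h = ⊥-elim (h refl)
    shift-big (suc c) _ = m<m+n kA (s≤s z≤n)

    shift-∸ : ∀ c d → shift c ≡ suc d → c ≡ suc d ∸ kA
    shift-∸ (suc c) d e = sym (trans (cong (_∸ kA) (sym e)) (m+n∸m≡n kA (suc c)))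

    bound : ∀ v → χ v ≤ kA + kB
    bound v with χ-cases v
    ... | inj₁ a = ≤-trans (≤-reflexive (χ-A v a)) (≤-trans (SA.bound v) (m≤m+n kA kB))
    ... | inj₂ (inj₁ b) = ≤-trans (≤-reflexive (χ-B v b)) (shift-bound _ (SB.bound v))
    ... | inj₂ (inj₂ (_ , e)) = ≤-trans (≤-reflexive e) z≤n

    glued-no-edge : ∀ u v → R u ≡ true → R v ≡ true → χ u ≢ 0 → χ v ≢ 0 → G u v → χ u ≡ χ v
    glued-no-edge u v ru rv hu hv g with χ-cases u | χ-cases v
    ... | inj₂ (inj₂ (_ , e)) | _ = ⊥-elim (hu e)
    ... | _ | inj₂ (inj₂ (_ , e)) = ⊥-elim (hv e)
    ... | inj₁ a | inj₂ (inj₁ b) = ⊥-elim (no-edge u v a b g)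
    ... | inj₂ (inj₁ b) | inj₁ a = ⊥-elim (no-edge v u a b (G-sym g))
    ... | inj₁ a | inj₁ a′ = trans (χ-A u a) (trans
            (SA.no-edge u v a a′ (hu ∘ trans (χ-A u a)) (hv ∘ trans (χ-A v a′)) g) (sym (χ-A v a′)))
    ... | inj₂ (inj₁ b) | inj₂ (inj₁ b′) = trans (χ-B u b) (trans (cong shift
            (SB.no-edge u v b b′ (λ e → hu (trans (χ-B u b) (cong shift e)))
              (λ e → hv (trans (χ-B v b′) (cong shift e))) g)) (sym (χ-B v b′)))

    separator : # (class R χ 0) + s ≤ s * (kA + kB)
    separator = begin
      # (class R χ 0) + s ≤⟨ +-monoˡ-≤ s (≤-trans (cnt-∪ (allFin n) {q = class A χA 0} {r = λ v → class B χB 0 v ∨ (R v ∧ not (A v ∨ B v))} f)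
         (+-monoʳ-≤ (# (class A χA 0)) (cnt-∪ (allFin n) (λ v → ∨-elim)))) ⟩
      # (class A χA 0) + (# (class B χB 0) + # (λ v → R v ∧ not (A v ∨ B v))) + s
        ≤⟨ +-monoˡ-≤ s (+-monoʳ-≤ (# (class A χA 0)) (+-monoʳ-≤ (# (class B χB 0)) small)) ⟩
      # (class A χA 0) + (# (class B χB 0) + s) + s ≡⟨ e₁ (# (class A χA 0)) (# (class B χB 0)) s ⟩
      (# (class A χA 0) + s) + (# (class B χB 0) + s) ≤⟨ +-mono-≤ SA.separator SB.separator ⟩
      s * kA + s * kB ≡⟨ *-distribˡ-+ s kA kB ⟨
      s * (kA + kB) ∎
      where
      open ≤-Reasoning
      e₁ : ∀ a b s → a + (b + s) + s ≡ (a + s) + (b + s)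
      e₁ = solve-∀
      f : ∀ v → class R χ 0 v ≡ true → class A χA 0 v ≡ true ⊎ class B χB 0 v ∨ (R v ∧ not (A v ∨ B v)) ≡ true
      f v e with class-elim R χ 0 v e | χ-cases v
      ... | rv , z | inj₁ a = inj₁ (class-intro A χA 0 v a (trans (sym (χ-A v a)) z))
      ... | rv , z | inj₂ (inj₁ b) = inj₂ (∨-introˡ (class-intro B χB 0 v b (shift≡0 _ (trans (sym (χ-B v b)) z))))
      ... | rv , z | inj₂ (inj₂ (o , _)) = inj₂ (∨-introʳ {class B χB 0 v} (∧-intro rv (not-intro o)))

    classes : ∀ c → # (class R χ (suc c)) ≤ m
    classes c with suc c ≤? kA
    ... | yes h = ≤-trans (cnt-mono (allFin n) f) (SA.classes c)
      where
      f : ∀ v → class R χ (suc c) v ≡ true → class A χA (suc c) v ≡ true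
      f v e with class-elim R χ (suc c) v e | χ-cases v
      ... | rv , z | inj₁ a = class-intro A χA (suc c) v a (trans (sym (χ-A v a)) z)
      ... | rv , z | inj₂ (inj₂ (_ , o)) = ⊥-elim (0≢1+n (trans (sym o) z))
      ... | rv , z | inj₂ (inj₁ b) = ⊥-elim (<⇒≱ (shift-big (χB v) nz) (≤-trans (≤-reflexive z′) h))
        where
        z′ : shift (χB v) ≡ suc c
        z′ = trans (sym (χ-B v b)) z
        nz : χB v ≢ 0
        nz e₀ = 0≢1+n (trans (sym (cong shift e₀)) z′)
    ... | no h = ≤-trans (cnt-mono (allFin n) f) (≤-trans (≤-reflexive (cong (λ z → # (class B χB z)) eq)) (SB.classes (c ∸ kA)))
      where
      eq : suc c ∸ kA ≡ suc (c ∸ kA)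
      eq = +-∸-assoc 1 (≤-pred (≰⇒> h))
      f : ∀ v → class R χ (suc c) v ≡ true → class B χB (suc c ∸ kA) v ≡ true
      f v e with class-elim R χ (suc c) v e | χ-cases v
      ... | rv , z | inj₁ a = ⊥-elim (h (≤-trans (≤-reflexive (trans (sym z) (χ-A v a))) (SA.bound v)))
      ... | rv , z | inj₂ (inj₂ (_ , o)) = ⊥-elim (0≢1+n (trans (sym o) z))
      ... | rv , z | inj₂ (inj₁ b) = class-intro B χB (suc c ∸ kA) v b (shift-∸ _ c (trans (sym (χ-B v b)) z))

    glued : Shattering R
    glued = record
      { χ = χ ; k = kA + kB ; bound = bound ; no-edge = glued-no-edge
      ; separator = separator ; classes = classes
      ; few = begin
          (kA + kB) * m ≡⟨ *-distribʳ-+ m kA kB ⟩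
          kA * m + kB * m ≤⟨ +-mono-≤ SA.few SB.few ⟩
          2 * t * # A + 2 * t * # B ≡⟨ *-distribˡ-+ (2 * t) (# A) (# B) ⟨
          2 * t * (# A + # B) ≤⟨ *-monoʳ-≤ (2 * t) (cnt-disjoint (allFin n) A⊂R B⊂R disjoint) ⟩
          2 * t * # R ∎ }
      where open ≤-Reasoning

  nonempty : ∀ (R A : Sub n) → m < # R → # R ≤ 2 * t * # A → 1 ≤ # A
  nonempty R A h h′ with # A
  ... | suc _ = s≤s z≤n
  ... | zero = ⊥-elim (<⇒≱ (≤-<-trans z≤n h) (≤-trans h′ (≤-reflexive (*-zeroʳ (2 * t)))))

  -- The lower bound on `# R` is inherited: a set is split only if it has more than `m` vertices,
  -- and each side keeps a fraction 1/(2t) of them. On the leaves it becomes the bound `few` on the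
  -- number of pieces.
  shatter-acc : ∀ R → Acc _<_ (# R) → m ≤ 2 * t * # R → HasMinor G t ⊎ Shattering R
  shatter-acc R (acc rs) h with # R ≤? m
  ... | yes R≤ = inj₂ (leaf R R≤ h)
  ... | no R≰ with InSubset.minor-or-separation R (≤-<-trans small-s (≰⇒> R≰))
  ...   | inj₁ minor = inj₁ minor
  ...   | inj₂ sep with shatter-acc A (rs A<R) (≤-trans (<⇒≤ m<R) A-large) | shatter-acc B (rs B<R) (≤-trans (<⇒≤ m<R) B-large)
    where
    open BalancedSeparation sep
    m<R : m < # R
    m<R = ≰⇒> R≰
    A+B≤R : # A + # B ≤ # R
    A+B≤R = cnt-disjoint (allFin n) A⊂R B⊂R disjoint
    A<R : # A < # R
    A<R = ≤-trans (≤-reflexive (+-comm 1 (# A))) (≤-trans (+-monoʳ-≤ (# A) (nonempty R B m<R B-large)) A+B≤R)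
    B<R : # B < # R
    B<R = ≤-trans (+-monoˡ-≤ (# B) (nonempty R A m<R A-large)) A+B≤R
  ...     | inj₁ minor | _ = inj₁ minor
  ...     | inj₂ _ | inj₁ minor = inj₁ minor
  ...     | inj₂ ShA | inj₂ ShB = inj₂ (Glue.glued R sep ShA ShB)

  shatter : ∀ R → m ≤ 2 * t * # R → HasMinor G t ⊎ Shattering R
  shatter R = shatter-acc R (<-wellFounded _)

-- Client's potential

==-sound : ∀ {n} {e f : Pair n} → (e == f) ≡ true → e ≡ f
==-sound {e = a , b} {c , d} h with ∧-elim {⌊ a Fin.≟ c ⌋} h
... | p , q = cong₂ _,_ (dec-true (a Fin.≟ c) p) (dec-true (b Fin.≟ d) q)

==-refl : ∀ {n} (e : Pair n) → (e == e) ≡ true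
==-refl (a , b) = ∧-intro (dec-intro (a Fin.≟ a) refl) (dec-intro (b Fin.≟ b) refl)

offered : ∀ {n} → List (Pair n) → Pair n → Bool
offered offer e = any (λ f → e == f) offer

offered-∈ : ∀ {n} {e : Pair n} (offer : List (Pair n)) → e ∈ offer → offered offer e ≡ true
offered-∈ {e = e} (f ∷ offer) (here refl) = ∨-introˡ (==-refl e)
offered-∈ {e = e} (f ∷ offer) (there m) = ∨-introʳ {e == f} (offered-∈ offer m)

∈-offered : ∀ {n} {e : Pair n} (offer : List (Pair n)) → offered offer e ≡ true → e ∈ offer
∈-offered {e = e} (f ∷ offer) h with ∨-elim {e == f} h
... | inj₁ p = here (==-sound p)
... | inj₂ p = there (∈-offered offer p)

not-offered : ∀ {n} {e : Pair n} (offer : List (Pair n)) → ¬ e ∈ offer → offered offer e ≡ false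
not-offered {e = e} offer h with bool-case (offered offer e)
... | inj₁ p = ⊥-elim (h (∈-offered offer p))
... | inj₂ p = p

at : ∀ {n} → Position n → Pair n → Owner
at s = uncurry s

update-chosen : ∀ {n} (s : Position n) offer (e : Pair n) → at (update s offer e) e ≡ client
update-chosen s offer e rewrite ==-refl e = refl

update-offered : ∀ {n} (s : Position n) offer (e x : Pair n) → x ∈ offer → x ≢ e →
  at (update s offer e) x ≡ waiter
update-offered s offer e x m h with bool-case (x == e)
... | inj₁ p = ⊥-elim (h (==-sound p))
... | inj₂ p rewrite p | offered-∈ offer m = refl

update-other : ∀ {n} (s : Position n) offer (e x : Pair n) → e ∈ offer → ¬ x ∈ offer →
  at (update s offer e) x ≡ at s x
update-other s offer e x m h with bool-case (x == e)
... | inj₁ p = ⊥-elim (h (subst (_∈ offer) (sym (==-sound p)) m))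
... | inj₂ p rewrite p | not-offered offer h = refl

-- Products over lists, split at the offered edges.

Π[_]_ : {A : Set} → List A → (A → ℕ) → ℕ
Π[ xs ] f = product (map f xs)

Π-cong : {A : Set} (xs : List A) {f g : A → ℕ} → (∀ x → x ∈ xs → f x ≡ g x) → Π[ xs ] f ≡ Π[ xs ] g
Π-cong [] h = refl
Π-cong (x ∷ xs) h = cong₂ _*_ (h x (here refl)) (Π-cong xs (λ y m → h y (there m)))

Π-one : {A : Set} (xs : List A) {f : A → ℕ} → (∀ x → x ∈ xs → f x ≡ 1) → Π[ xs ] f ≡ 1
Π-one [] h = refl
Π-one (x ∷ xs) h = cong₂ _*_ (h x (here refl)) (Π-one xs (λ y m → h y (there m)))

Π-const : {A : Set} (xs : List A) (z : ℕ) → Π[ xs ] (λ _ → z) ≡ z ^ length xs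
Π-const [] z = refl
Π-const (x ∷ xs) z = cong (z *_) (Π-const xs z)

Π-zero : {A : Set} (xs : List A) {f : A → ℕ} → Π[ xs ] f ≡ 0 → ∃[ x ] (x ∈ xs × f x ≡ 0)
Π-zero (x ∷ xs) {f} h with m*n≡0⇒m≡0∨n≡0 (f x) h
... | inj₁ e = x , here refl , e
... | inj₂ e = let y , m , e′ = Π-zero xs e in y , there m , e′

Π-bool : {A : Set} (xs : List A) (p : A → Bool) (U W : ℕ) →
  Π[ xs ] (λ x → if p x then U else W) ≡ U ^ cnt p xs * W ^ cnt (not ∘ p) xs
Π-bool [] p U W = refl
Π-bool (x ∷ xs) p U W with p x
... | true = trans (cong (U *_) (Π-bool xs p U W)) (sym (*-assoc U _ _))
... | false = trans (cong (W *_) (Π-bool xs p U W)) (lem W (U ^ cnt p xs) (W ^ cnt (not ∘ p) xs))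
  where
  lem : ∀ w a b → w * (a * b) ≡ a * (w * b)
  lem = solve-∀

cnt-not : {A : Set} (xs : List A) (p : A → Bool) → cnt p xs + cnt (not ∘ p) xs ≡ length xs
cnt-not [] p = refl
cnt-not (x ∷ xs) p with p x
... | true = cong suc (cnt-not xs p)
... | false = trans (+-suc _ _) (cong suc (cnt-not xs p))

Π-extract : ∀ {n} {xs : List (Pair n)} → Unique xs → (f : Pair n → ℕ) {e : Pair n} → e ∈ xs →
  Π[ xs ] f ≡ f e * Π[ xs ] (λ x → if x == e then 1 else f x)
Π-extract {xs = x ∷ xs} (a ∷ u) f (here refl) rewrite ==-refl x =
  cong (f x *_) (trans (Π-cong xs (λ y m → lem y m)) (sym (*-identityˡ _)))
  where
  lem : ∀ y → y ∈ xs → f y ≡ (if y == x then 1 else f y)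
  lem y m with bool-case (y == x)
  ... | inj₁ p = ⊥-elim (All.lookup a m (sym (==-sound p)))
  ... | inj₂ p rewrite p = refl
Π-extract {xs = x ∷ xs} (a ∷ u) f {e} (there m) with bool-case (x == e)
... | inj₁ p = ⊥-elim (All.lookup a m (==-sound p))
... | inj₂ p rewrite p = trans (cong (f x *_) (Π-extract u f m)) (lem (f x) (f e) _)
  where
  lem : ∀ a b c → a * (b * c) ≡ b * (a * c)
  lem = solve-∀

Π-extract-all : ∀ {n} {xs : List (Pair n)} → Unique xs → (f : Pair n → ℕ) {offer : List (Pair n)} →
  Unique offer → (∀ e → e ∈ offer → e ∈ xs) →
  Π[ xs ] f ≡ Π[ offer ] f * Π[ xs ] (λ x → if offered offer x then 1 else f x)
Π-extract-all {xs = xs} u f [] h = sym (*-identityˡ _)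
Π-extract-all {n} {xs} u f {e ∷ os} (a ∷ uo) h = begin
  Π[ xs ] f ≡⟨ Π-extract u f (h e (here refl)) ⟩
  f e * Π[ xs ] f₁ ≡⟨ cong (f e *_) (Π-extract-all u f₁ uo (λ x m → h x (there m))) ⟩
  f e * (Π[ os ] f₁ * Π[ xs ] (λ x → if offered os x then 1 else f₁ x))
    ≡⟨ cong₂ (λ y z → f e * (y * z)) (Π-cong os same) (Π-cong xs (λ x _ → merge x)) ⟩
  f e * (Π[ os ] f * Π[ xs ] (λ x → if offered (e ∷ os) x then 1 else f x)) ≡⟨ *-assoc (f e) _ _ ⟨
  f e * Π[ os ] f * Π[ xs ] (λ x → if offered (e ∷ os) x then 1 else f x) ∎
  where
  open ≡-Reasoning
  f₁ : Pair n → ℕ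
  f₁ x = if x == e then 1 else f x
  same : ∀ x → x ∈ os → f₁ x ≡ f x
  same x m with bool-case (x == e)
  ... | inj₁ p = ⊥-elim (All.lookup a m (sym (==-sound p)))
  ... | inj₂ p rewrite p = refl
  merge : ∀ x → (if offered os x then 1 else f₁ x) ≡ (if offered (e ∷ os) x then 1 else f x)
  merge x with x == e | offered os x
  ... | true | true = refl
  ... | true | false = refl
  ... | false | _ = refl

claimed? : ∀ {n} (s : Position n) → Dec (AllClaimed s)
claimed? s = Fin.all? (λ i → Fin.all? (λ j → (toℕ i <? toℕ j) →-dec ¬? (free? (s i j))))
  where
  free? : (o : Owner) → Dec (o ≡ free)
  free? free = yes refl
  free? client = no λ ()
  free? waiter = no λ ()

isFree : Owner → Bool
isFree free = true
isFree client = false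
isFree waiter = false

freeEdges : ∀ {n} → Position n → ℕ
freeEdges {n} s = cnt (isFree ∘ at s) (edges n)

freeEdges-decreases : ∀ {n} (s : Position n) offer (e : Pair n) →
  e ∈ offer → IsEdge e → at s e ≡ free → freeEdges (update s offer e) < freeEdges s
freeEdges-decreases {n} s offer e m ie fr = cnt-strict (edges n) mono (edges-complete e ie)
  (cong isFree fr) (cong isFree (update-chosen s offer e))
  where
  mono : ∀ x → isFree (at (update s offer e) x) ≡ true → isFree (at s x) ≡ true
  mono x h with x == e | offered offer x
  mono x () | true | _
  mono x () | false | true
  ... | false | false = h

some-≤-average : {A : Set} (x : A) (xs : List A) (f : A → ℕ) (c : ℕ) →
  Σ[ x ∷ xs ] f ≤ length (x ∷ xs) * c → ∃[ y ] (y ∈ x ∷ xs × f y ≤ c)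
some-≤-average x [] f c h = x , here refl ,
  ≤-trans (≤-reflexive (sym (+-identityʳ (f x)))) (≤-trans h (≤-reflexive (+-identityʳ c)))
some-≤-average x (y ∷ xs) f c h with f x ≤? c
... | yes p = x , here refl , p
... | no p = let z , m , q = some-≤-average y xs f c
                   (+-cancelˡ-≤ c _ _ (≤-trans (+-monoˡ-≤ _ (<⇒≤ (≰⇒> p))) h)) in z , there m , q

-- Client keeps Σ_p Π_e weight below Z ^ (number of free edges), where a free edge
-- weighs U if p allows it and W otherwise, and an edge of Client outside p weighs 0.
module Potential {n : ℕ} (Q U W Z : ℕ) .{{_ : NonZero Z}}
  (key : ∀ j k → j + k ≤ Q → j * Z ^ (j + k) ≤ (j + k) * (U ^ j * W ^ k)) where

  weight : (Pair n → Bool) → Owner → Pair n → ℕ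
  weight p free e = if p e then U else W
  weight p client e = bit (p e)
  weight p waiter e = 1

  unit : Owner → Pair n → ℕ
  unit free e = Z
  unit client e = 1
  unit waiter e = 1

  value : (Owner → Pair n → ℕ) → Position n → ℕ
  value w s = Π[ edges n ] (λ x → w (at s x) x)

  -- A move changes only the factors of offered edges, and afterwards only the chosen one can have a
  -- factor other than 1. So the products before and after share `remaining`, whichever edge Client
  -- takes.
  module Round (w : Owner → Pair n → ℕ) (w-waiter : ∀ x → w waiter x ≡ 1) (s : Position n)
    (offer : List (Pair n)) (uo : Unique offer) (fr : ∀ e → e ∈ offer → IsEdge e × at s e ≡ free) where

    remaining : ℕ
    remaining = Π[ edges n ] (λ x → if offered offer x then 1 else w (at s x) x)

    offer⊂edges : ∀ e → e ∈ offer → e ∈ edges n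
    offer⊂edges e m = edges-complete e (proj₁ (fr e m))

    before : value w s ≡ Π[ offer ] (w free) * remaining
    before = trans (Π-extract-all (edges-unique n) (λ x → w (at s x) x) uo offer⊂edges)
      (cong (_* remaining) (Π-cong offer (λ x m → cong (λ o → w o x) (proj₂ (fr x m)))))

    after : ∀ e → e ∈ offer → value w (update s offer e) ≡ w client e * remaining
    after e m = trans (Π-extract-all (edges-unique n) w′ uo offer⊂edges)
      (cong₂ _*_
        (trans (Π-extract uo w′ m)
          (trans (cong₂ _*_ (cong (λ o → w o e) (update-chosen s offer e)) (Π-one offer one)) (*-identityʳ (w client e))))
        (Π-cong (edges n) (λ x _ → same x)))
      where
      w′ : Pair n → ℕ
      w′ x = w (at (update s offer e) x) x
      one : ∀ x → x ∈ offer → (if x == e then 1 else w′ x) ≡ 1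
      one x m′ with bool-case (x == e)
      ... | inj₁ p rewrite p = refl
      ... | inj₂ p = trans (cong (λ b → if b then 1 else w′ x) p)
              (trans (cong (λ o → w o x) (update-offered s offer e x m′ ne)) (w-waiter x))
        where
        ne : x ≢ e
        ne refl = true≢false (==-refl x) p
      same : ∀ x → (if offered offer x then 1 else w′ x) ≡ (if offered offer x then 1 else w (at s x) x)
      same x with bool-case (offered offer x)
      ... | inj₁ p rewrite p = refl
      ... | inj₂ p = cong (λ z → if offered offer x then 1 else z)
              (cong (λ o → w o x) (update-other s offer e x m (λ m′ → true≢false (offered-∈ offer m′) p)))

  total : List (Pair n → Bool) → Position n → ℕ
  total family s = Σ[ family ] (λ p → value (weight p) s)

  key-offer : ∀ p (offer : List (Pair n)) → length offer ≤ Q →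
    cnt p offer * Z ^ length offer ≤ length offer * Π[ offer ] (weight p free)
  key-offer p offer h = begin
    cnt p offer * Z ^ length offer ≡⟨ cong (λ l → cnt p offer * Z ^ l) (sym (cnt-not offer p)) ⟩
    cnt p offer * Z ^ (cnt p offer + cnt (not ∘ p) offer)
      ≤⟨ key (cnt p offer) (cnt (not ∘ p) offer) (≤-trans (≤-reflexive (cnt-not offer p)) h) ⟩
    (cnt p offer + cnt (not ∘ p) offer) * (U ^ cnt p offer * W ^ cnt (not ∘ p) offer)
      ≡⟨ cong₂ _*_ (cnt-not offer p) (sym (Π-bool offer p U W)) ⟩
    length offer * Π[ offer ] (weight p free) ∎
    where open ≤-Reasoning

  choice : (family : List (Pair n → Bool)) (s : Position n) (offer : List (Pair n)) → Unique offer →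
    (∀ e → e ∈ offer → IsEdge e × at s e ≡ free) → 1 ≤ length offer → length offer ≤ Q →
    total family s < value unit s →
    ∃[ e ] (e ∈ offer × total family (update s offer e) < value unit (update s offer e))
  choice family s offer@(x ∷ xs) uo fr nonempty short inv =
    let e , m , h = some-≤-average x xs (λ e → total family (update s offer e) * Z ^ l) (total family s) average
    in e , m , *-cancelˡ-< (Z ^ l) _ _ (begin-strict
      Z ^ l * total family (update s offer e) ≡⟨ *-comm (Z ^ l) _ ⟩
      total family (update s offer e) * Z ^ l ≤⟨ h ⟩
      total family s <⟨ inv ⟩
      value unit s ≡⟨ Ru.before ⟩
      Π[ offer ] (λ _ → Z) * Ru.remaining ≡⟨ cong₂ _*_ (Π-const offer Z) (sym (trans (Ru.after e m) (*-identityˡ _))) ⟩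
      Z ^ l * value unit (update s offer e) ∎)
    where
    open ≤-Reasoning
    l : ℕ
    l = length offer
    module Ru = Round unit (λ _ → refl) s offer uo fr
    module Rw (p : Pair n → Bool) = Round (weight p) (λ _ → refl) s offer uo fr
    rearrange : ∀ a b c → a * b * c ≡ a * c * b
    rearrange = solve-∀
    -- A uniformly random offered edge is allowed by `p` with probability `cnt p offer` / `l`. By
    -- `key` this is at most the product of the `l` lost weights divided by `Z ^ l`, so the expected
    -- total, scaled by `Z ^ l`, does not grow.
    average : Σ[ offer ] (λ e → total family (update s offer e) * Z ^ l) ≤ l * total family s
    average = begin
      Σ[ offer ] (λ e → total family (update s offer e) * Z ^ l)
        ≡⟨ Σ-*ʳ offer (λ e → total family (update s offer e)) (Z ^ l) ⟩
      Σ[ offer ] (λ e → total family (update s offer e)) * Z ^ l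
        ≡⟨ cong (_* Z ^ l) (Σ-cong offer (λ e m → Σ-cong family (λ p _ → Rw.after p e m))) ⟩
      Σ[ offer ] (λ e → Σ[ family ] (λ p → bit (p e) * Rw.remaining p)) * Z ^ l
        ≡⟨ cong (_* Z ^ l) (Σ-swap offer family _) ⟩
      Σ[ family ] (λ p → Σ[ offer ] (λ e → bit (p e) * Rw.remaining p)) * Z ^ l
        ≡⟨ cong (_* Z ^ l) (Σ-cong family (λ p _ → Σ-*ʳ offer (bit ∘ p) (Rw.remaining p))) ⟩
      Σ[ family ] (λ p → cnt p offer * Rw.remaining p) * Z ^ l
        ≡⟨ Σ-*ʳ family _ (Z ^ l) ⟨
      Σ[ family ] (λ p → cnt p offer * Rw.remaining p * Z ^ l)
        ≤⟨ Σ-mono family (λ p _ → per-member p) ⟩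
      Σ[ family ] (λ p → value (weight p) s * l)
        ≡⟨ Σ-*ʳ family _ l ⟩
      total family s * l ≡⟨ *-comm _ l ⟩
      l * total family s ∎
      where
      per-member : ∀ p → cnt p offer * Rw.remaining p * Z ^ l ≤ value (weight p) s * l
      per-member p = begin
        cnt p offer * Rw.remaining p * Z ^ l ≡⟨ rearrange (cnt p offer) _ (Z ^ l) ⟩
        cnt p offer * Z ^ l * Rw.remaining p ≤⟨ *-monoˡ-≤ (Rw.remaining p) (key-offer p offer short) ⟩
        l * Π[ offer ] (weight p free) * Rw.remaining p ≡⟨ *-assoc l (Π[ offer ] (weight p free)) (Rw.remaining p) ⟩
        l * (Π[ offer ] (weight p free) * Rw.remaining p) ≡⟨ cong (l *_) (sym (Rw.before p)) ⟩
        l * value (weight p) s ≡⟨ *-comm l _ ⟩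
        value (weight p) s * l ∎
    instance
      Z^l≢0 : NonZero (Z ^ l)
      Z^l≢0 = m^n≢0 Z l

  Escapes : (Pair n → Bool) → Position n → Set
  Escapes p s = ∃[ e ] (IsEdge e × at s e ≡ client × p e ≡ false)

  -- Without free edges the bound `value unit s` is 1, so every product is 0. A zero factor can only
  -- be an edge of Client outside `p`.
  finished-escapes : ∀ family s → AllClaimed s → total family s < value unit s → ∀ p → p ∈ family → Escapes p s
  finished-escapes family s done inv p m
    with Π-zero (edges n) (n<1⇒n≡0 (≤-<-trans (member≤ family m) (≤-trans inv (≤-reflexive unit-one))))
    where
    unit-one : value unit s ≡ 1
    unit-one = Π-one (edges n) (λ x m → lem x (edges-sound m))
      where
      lem : ∀ x → IsEdge x → unit (at s x) x ≡ 1
      lem x ie with at s x in eq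
      ... | free = ⊥-elim (done (proj₁ x) (proj₂ x) ie eq)
      ... | client = refl
      ... | waiter = refl
    member≤ : ∀ fam → p ∈ fam → value (weight p) s ≤ total fam s
    member≤ (q ∷ fam) (here refl) = m≤m+n _ _
    member≤ (q ∷ fam) (there m) = ≤-trans (member≤ fam m) (m≤n+m _ _)
  ... | e , me , z = e , edges-sound me , lem
    where
    lem : at s e ≡ client × p e ≡ false
    lem with at s e in eq
    lem | free = ⊥-elim (done (proj₁ e) (proj₂ e) (edges-sound me) eq)
    lem | client with p e
    ... | false = refl , refl
    lem | waiter = ⊥-elim (1+n≢0 z)

  module _ {q : ℕ} (q<Q : suc q ≤ Q) (family : List (Pair n → Bool)) (P : Graph n → Set)
    (goal : ∀ s → (∀ p → p ∈ family → Escapes p s) → P (ClientGraph s)) where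

    play : ∀ s → Acc _<_ (freeEdges s) → total family s < value unit s → ClientBuilds q P s
    play s (acc rs) inv with claimed? s
    ... | yes done = finished done (goal s (finished-escapes family s done inv))
    ... | no ¬done = chooseMove ¬done λ offer (uo , fr , nonempty , short) →
          let fr′ = λ e (m : e ∈ offer) → All.lookup fr m
              e , m , inv′ = choice family s offer uo fr′ nonempty (≤-trans short q<Q) inv
          in e , m , play (update s offer e)
               (rs (freeEdges-decreases s offer e m (proj₁ (fr′ e m)) (proj₂ (fr′ e m)))) inv′

    client-escapes : total family (initial n) < Z ^ length (edges n) → ClientBuilds q P (initial n)
    client-escapes h = play (initial n) (<-wellFounded _)
      (≤-trans h (≤-reflexive (sym (Π-const (edges n) Z))))

  -- Since `W ≤ U`, the product grows with the number of allowed edges, so `a` of them is the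
  -- extreme case.
  total-initial : W ≤ U → ∀ family a → a ≤ length (edges n) → (∀ p → p ∈ family → cnt p (edges n) ≤ a) →
    total family (initial n) ≤ length family * (U ^ a * W ^ (length (edges n) ∸ a))
  total-initial W≤U family a a≤N h = Σ-≤-const family (λ p m → ≤-trans (≤-reflexive (Π-bool (edges n) p U W))
    (lem (cnt p (edges n)) (cnt (not ∘ p) (edges n)) (h p m) (cnt-not (edges n) p)))
    where
    open ≤-Reasoning
    N : ℕ
    N = length (edges n)
    lem : ∀ c d → c ≤ a → c + d ≡ N → U ^ c * W ^ d ≤ U ^ a * W ^ (N ∸ a)
    lem c d c≤a e = begin
      U ^ c * W ^ d ≡⟨ cong (λ z → U ^ c * W ^ z) d≡ ⟩
      U ^ c * W ^ ((a ∸ c) + (N ∸ a)) ≡⟨ cong (U ^ c *_) (^-distribˡ-+-* W (a ∸ c) (N ∸ a)) ⟩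
      U ^ c * (W ^ (a ∸ c) * W ^ (N ∸ a)) ≤⟨ *-monoʳ-≤ (U ^ c) (*-monoˡ-≤ (W ^ (N ∸ a)) (^-monoˡ-≤ (a ∸ c) W≤U)) ⟩
      U ^ c * (U ^ (a ∸ c) * W ^ (N ∸ a)) ≡⟨ *-assoc (U ^ c) _ _ ⟨
      U ^ c * U ^ (a ∸ c) * W ^ (N ∸ a) ≡⟨ cong (_* W ^ (N ∸ a)) (sym (^-distribˡ-+-* U c (a ∸ c))) ⟩
      U ^ (c + (a ∸ c)) * W ^ (N ∸ a) ≡⟨ cong (λ z → U ^ z * W ^ (N ∸ a)) (m+[n∸m]≡n c≤a) ⟩
      U ^ a * W ^ (N ∸ a) ∎
      where
      d≡ : d ≡ (a ∸ c) + (N ∸ a)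
      d≡ = +-cancelˡ-≡ c _ _ (trans e (sym (trans (sym (+-assoc c (a ∸ c) (N ∸ a)))
             (trans (cong (_+ (N ∸ a)) (m+[n∸m]≡n c≤a)) (m+[n∸m]≡n a≤N)))))

-- Waiter's strategy

-- A certificate of acyclicity that is easily extended by a leaf: every edge leads to a parent of
-- smaller rank.
record Forest {n : ℕ} (G : Graph n) : Set where
  field
    parent : Fin n → Fin n
    rank : Fin n → ℕ
    edge : ∀ {u v} → G u v → (parent u ≡ v × rank v < rank u) ⊎ (parent v ≡ u × rank u < rank v)

-- Only the root of a branch set can have its parent in another branch set, so
-- the three adjacencies of a K₃-minor orient a triangle on the branch sets with
-- out-degrees at most one; around the resulting cycle the rank of the roots
-- would strictly decrease.
module NoK₃ {n : ℕ} {G : Graph n} (F : Forest G) (β : Fin n → Maybe (Fin 3))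
  (connected : ∀ i u v → β u ≡ just i → β v ≡ just i → PathIn G (λ w → β w ≡ just i) u v)
  (adjacent : ∀ i j → i ≢ j → ∃[ u ] ∃[ v ] (β u ≡ just i × β v ≡ just j × G u v)) where
  open Forest F

  record _⇒_ (i j : Fin 3) : Set where
    constructor root
    field
      top : Fin n
      top-in : β top ≡ just i
      parent-in : β (parent top) ≡ just j
      decreasing : rank (parent top) < rank top
  open _⇒_

  data Below (i : Fin 3) (u : Fin n) : Fin n → Set where
    base : Below i u u
    up : ∀ {w} → β (parent w) ≡ just i → rank (parent w) < rank w → Below i u (parent w) → Below i u w

  rank-below : ∀ {i u w} → Below i u w → rank u ≤ rank w
  rank-below base = ≤-refl
  rank-below (up _ lt b) = ≤-trans (rank-below b) (<⇒≤ lt)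

  -- The parent of the top lies in class `j`, so a path inside class `i` that starts at the top can
  -- ascend only along links by which the current vertex is already known to lie below the top.
  follow : ∀ {i j} → i ≢ j → (e : i ⇒ j) → ∀ {x w} → β x ≡ just i → Below i (top e) x →
    PathIn G (λ w → β w ≡ just i) x w → Below i (top e) w
  follow i≢j e x∈ b here = b
  follow i≢j e x∈ b (step {w = y} g y∈ p) with edge g
  ... | inj₂ (refl , lt) = follow i≢j e y∈ (up x∈ lt b) p
  ... | inj₁ (refl , lt) with b
  ...   | base = ⊥-elim (i≢j (just-injective (trans (sym y∈) (parent-in e))))
  ...   | up _ _ b′ = follow i≢j e y∈ b′ p

  below-top : ∀ {i j} → i ≢ j → (e : i ⇒ j) → ∀ w → β w ≡ just i → Below i (top e) w
  below-top i≢j e w w∈ = follow i≢j e (top-in e) base (connected _ _ w (top-in e) w∈)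

  out-unique : ∀ {i j k} → i ≢ j → i ≢ k → i ⇒ j → i ⇒ k → j ≡ k
  out-unique i≢j i≢k e f with top f | top-in f | parent-in f | below-top i≢j e (top f) (top-in f)
  ... | _ | _ | p | base = just-injective (trans (sym (parent-in e)) p)
  ... | _ | _ | p | up q _ _ = ⊥-elim (i≢k (just-injective (trans (sym q) p)))

  descend : ∀ {i j k} → j ≢ k → (e : i ⇒ j) (f : j ⇒ k) → rank (top f) < rank (top e)
  descend j≢k e f = ≤-<-trans (rank-below (below-top j≢k f _ (parent-in e))) (decreasing e)

  orient : ∀ i j → i ≢ j → i ⇒ j ⊎ j ⇒ i
  orient i j i≢j with adjacent i j i≢j
  ... | u , v , eu , ev , g with edge g
  ...   | inj₁ (refl , lt) = inj₁ (root u eu ev lt)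
  ...   | inj₂ (refl , lt) = inj₂ (root v ev eu lt)

  no-cycle : ∀ {i j k} → i ≢ j → j ≢ k → k ≢ i → i ⇒ j → j ⇒ k → k ⇒ i → ⊥
  no-cycle i≢j j≢k k≢i e f g = <-irrefl refl
    (<-trans (descend j≢k e f) (<-trans (descend i≢j g e) (descend k≢i f g)))

  impossible : ⊥
  impossible = go (orient a b a≢b) (orient b c b≢c) (orient c a c≢a)
    where
    a b c : Fin 3
    a = zero
    b = suc zero
    c = suc (suc zero)
    a≢b : a ≢ b
    a≢b ()
    b≢c : b ≢ c
    b≢c ()
    c≢a : c ≢ a
    c≢a ()
    go : a ⇒ b ⊎ b ⇒ a → b ⇒ c ⊎ c ⇒ b → c ⇒ a ⊎ a ⇒ c → ⊥
    go (inj₁ e) (inj₁ f) (inj₁ g) = no-cycle a≢b b≢c c≢a e f g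
    go (inj₂ e) (inj₂ f) (inj₂ g) = no-cycle (≢-sym c≢a) (≢-sym b≢c) (≢-sym a≢b) g f e
    go (inj₁ e) _ (inj₂ g) = b≢c (out-unique a≢b (≢-sym c≢a) e g)
    go (inj₂ e) (inj₁ f) _ = c≢a (sym (out-unique (≢-sym a≢b) b≢c e f))
    go _ (inj₂ f) (inj₁ g) = a≢b (sym (out-unique (≢-sym b≢c) c≢a f g))

forest-no-K₃ : ∀ {n} {G : Graph n} → Forest G → ¬ HasMinor G 3
forest-no-K₃ F (β , _ , connected , adjacent) = NoK₃.impossible F β connected adjacent

-- Waiter's offers and the invariant of his strategy.

module _ {n : ℕ} where

  isEdge? : (e : Pair n) → Dec (IsEdge e)
  isEdge? (a , b) = toℕ a <? toℕ b

  freeEdge : Position n → Pair n → Bool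
  freeEdge s e = isFree (at s e) ∧ ⌊ isEdge? e ⌋

  freeEdge-elim : ∀ s e → freeEdge s e ≡ true → at s e ≡ free × IsEdge e
  freeEdge-elim s e h with at s e | ∧-elim {isFree (at s e)} h
  ... | free | _ , b = refl , dec-true (isEdge? e) b
  ... | client | () , _
  ... | waiter | () , _

  freeEdge-intro : ∀ s e → at s e ≡ free → IsEdge e → freeEdge s e ≡ true
  freeEdge-intro s e f i = ∧-intro (cong isFree f) (dec-intro (isEdge? e) i)

  joins : Sub n → Fin n → Pair n → Bool
  joins C y (a , b) = (sing y a ∧ C b) ∨ (sing y b ∧ C a)

  joins-elim : ∀ C y a b → joins C y (a , b) ≡ true → (a ≡ y × C b ≡ true) ⊎ (b ≡ y × C a ≡ true)
  joins-elim C y a b h with ∨-elim {sing y a ∧ C b} h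
  ... | inj₁ p = let x , c = ∧-elim {sing y a} p in inj₁ (dec-true (a Fin.≟ y) x , c)
  ... | inj₂ p = let x , c = ∧-elim {sing y b} p in inj₂ (dec-true (b Fin.≟ y) x , c)

  joins-introˡ : ∀ C y b → C b ≡ true → joins C y (y , b) ≡ true
  joins-introˡ C y b c = ∨-introˡ (∧-intro (dec-intro (y Fin.≟ y) refl) c)

  joins-introʳ : ∀ C y a → C a ≡ true → joins C y (a , y) ≡ true
  joins-introʳ C y a c = ∨-introʳ {sing y a ∧ C y} (∧-intro (dec-intro (y Fin.≟ y) refl) c)

  add : Sub n → Fin n → Sub n
  add C x v = C v ∨ sing x v

  joins-add : ∀ C x y e → joins (add C x) y e ≡ true → joins C y e ≡ true ⊎ joins (sing x) y e ≡ true
  joins-add C x y (a , b) h with joins-elim (add C x) y a b h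
  ... | inj₁ (refl , c) with ∨-elim {C b} c
  ...   | inj₁ c′ = inj₁ (joins-introˡ C y b c′)
  ...   | inj₂ c′ = inj₂ (joins-introˡ (sing x) y b c′)
  joins-add C x y (a , b) h | inj₂ (refl , c) with ∨-elim {C a} c
  ...   | inj₁ c′ = inj₁ (joins-introʳ C y a c′)
  ...   | inj₂ c′ = inj₂ (joins-introʳ (sing x) y a c′)

  -- The cost of putting `y` into an offer, namely its number of free edges to `C`.
  φ : Position n → Sub n → Fin n → ℕ
  φ s C y = cnt (λ e → freeEdge s e ∧ joins C y e) (edges n)

  φ-sing : ∀ s x y → φ s (sing x) y ≤ 1
  φ-sing s x y with toℕ x <? toℕ y
  ... | yes x<y = cnt-unique (edges-unique n) (x , y) f
    where
    f : ∀ e → freeEdge s e ∧ joins (sing x) y e ≡ true → e ≡ (x , y)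
    f (a , b) h with ∧-elim {freeEdge s (a , b)} h
    ... | fr , j with joins-elim (sing x) y a b j
    ...   | inj₁ (refl , c) = ⊥-elim (<-asym x<y (subst (λ z → toℕ a < toℕ z) (dec-true (b Fin.≟ x) c) (proj₂ (freeEdge-elim s (a , b) fr))))
    ...   | inj₂ (refl , c) = cong (_, b) (dec-true (a Fin.≟ x) c)
  ... | no x≮y = cnt-unique (edges-unique n) (y , x) f
    where
    f : ∀ e → freeEdge s e ∧ joins (sing x) y e ≡ true → e ≡ (y , x)
    f (a , b) h with ∧-elim {freeEdge s (a , b)} h
    ... | fr , j with joins-elim (sing x) y a b j
    ...   | inj₁ (refl , c) = cong (a ,_) (dec-true (b Fin.≟ x) c)
    ...   | inj₂ (refl , c) = ⊥-elim (x≮y (subst (λ z → toℕ z < toℕ b) (dec-true (a Fin.≟ x) c) (proj₂ (freeEdge-elim s (a , b) fr))))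

  -- `height` exceeds all ranks given so far and becomes the rank of the next attached vertex, which
  -- thereby lies above its parent whichever vertex of `C` that is.
  record Inv (s : Position n) (C : Sub n) : Set where
    field
      parent : Fin n → Fin n
      rank : Fin n → ℕ
      height : ℕ
      rank<height : ∀ v → rank v < height
      client-inside : ∀ u v → IsEdge (u , v) → s u v ≡ client →
        C u ≡ true × C v ≡ true × ((parent u ≡ v × rank v < rank u) ⊎ (parent v ≡ u × rank u < rank v))
      inside-claimed : ∀ u v → IsEdge (u , v) → C u ≡ true → C v ≡ true → s u v ≢ free

    forest : Forest (ClientGraph s)
    forest = record
      { parent = parent ; rank = rank
      ; edge = λ { (inj₁ (i , c)) → proj₂ (proj₂ (client-inside _ _ i c))
                 ; (inj₂ (i , c)) → swap (proj₂ (proj₂ (client-inside _ _ i c))) } }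
      where open import Data.Sum using (swap)

  module Offer (s : Position n) (C : Sub n) (inv : Inv s C) (T : List (Fin n)) where
    open Inv inv

    joinsT : Pair n → Bool
    joinsT e = any (λ y → joins C y e) T

    joinsT-elim : ∀ e (T : List (Fin n)) → any (λ y → joins C y e) T ≡ true → ∃[ y ] (y ∈ T × joins C y e ≡ true)
    joinsT-elim e (y ∷ T) h with ∨-elim {joins C y e} h
    ... | inj₁ p = y , here refl , p
    ... | inj₂ p = let z , m , q = joinsT-elim e T p in z , there m , q

    joinsT-intro : ∀ e {y} (T : List (Fin n)) → y ∈ T → joins C y e ≡ true → any (λ y → joins C y e) T ≡ true
    joinsT-intro e (y ∷ T) (here refl) p = ∨-introˡ p
    joinsT-intro e (y ∷ T) (there m) p = ∨-introʳ {joins C y e} (joinsT-intro e T m p)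

    candidate : Pair n → Bool
    candidate e = freeEdge s e ∧ joinsT e

    offer : List (Pair n)
    offer = filter (λ e → candidate e 𝔹.≟ true) (edges n)

    offer-elim : ∀ e → e ∈ offer → at s e ≡ free × IsEdge e × ∃[ y ] (y ∈ T × joins C y e ≡ true)
    offer-elim e m with ∧-elim {freeEdge s e} (proj₂ (∈-filter⁻ (λ e → candidate e 𝔹.≟ true) {xs = edges n} m))
    ... | p , q = let a , b = freeEdge-elim s e p in a , b , joinsT-elim e T q

    offer-intro : ∀ e {y} → at s e ≡ free → IsEdge e → y ∈ T → joins C y e ≡ true → e ∈ offer
    offer-intro e f i m j = ∈-filter⁺ (λ e → candidate e 𝔹.≟ true) (edges-complete e i)
      (∧-intro (freeEdge-intro s e f i) (joinsT-intro e T m j))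

    length-filter-cnt : ∀ es → length (filter (λ e → candidate e 𝔹.≟ true) es) ≡ cnt candidate es
    length-filter-cnt [] = refl
    length-filter-cnt (e ∷ es) with candidate e
    ... | true = cong suc (length-filter-cnt es)
    ... | false = length-filter-cnt es

    length-offer : length offer ≤ Σ[ T ] (φ s C)
    length-offer = ≤-trans (≤-reflexive (length-filter-cnt (edges n)))
      (cnt-⋃ T (edges n) (λ y e → freeEdge s e ∧ joins C y e) f)
      where
      f : ∀ e → candidate e ≡ true → ∃[ y ] (y ∈ T × freeEdge s e ∧ joins C y e ≡ true)
      f e h with ∧-elim {freeEdge s e} h
      ... | p , q = let y , m , j = joinsT-elim e T q in y , m , ∧-intro p j

    valid : ∀ {q} → Σ[ T ] (φ s C) ≤ suc q → 1 ≤ length offer → ValidOffer q s offer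
    valid h nonempty = Unique.filter⁺ (λ e → candidate e 𝔹.≟ true) (edges-unique n) ,
      All.tabulate (λ {e} m → let f , i , _ = offer-elim e m in i , f) , nonempty , ≤-trans length-offer h

    record Reached (x : Fin n) (s′ : Position n) : Set where
      field
        inv′ : Inv s′ (add C x)
        fresh : ∀ y → y ∈ T → φ s′ (add C x) y ≤ 1
        older : ∀ y → φ s′ (add C x) y ≤ suc (φ s C y)

    -- Treats together the two ways in which `x` can join `C`, with or without a move. As every free
    -- edge between `T` and the old `C` was offered, a vertex of `T` retains at most its edge to
    -- `x`.
    module Drops (x : Fin n) (s′ : Position n)
      (still-free : ∀ e → IsEdge e → at s′ e ≡ free → at s e ≡ free × ¬ e ∈ offer) where

      split : ∀ y e → freeEdge s′ e ∧ joins (add C x) y e ≡ true →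
        (freeEdge s e ∧ joins C y e ≡ true × ¬ e ∈ offer) ⊎ freeEdge s′ e ∧ joins (sing x) y e ≡ true
      split y e h with ∧-elim {freeEdge s′ e} h
      ... | p , j with freeEdge-elim s′ e p
      ...   | f , i with joins-add C x y e j
      ...     | inj₁ j′ = let f′ , unoffered = still-free e i f in inj₁ (∧-intro (freeEdge-intro s e f′ i) j′ , unoffered)
      ...     | inj₂ j′ = inj₂ (∧-intro p j′)

      older : ∀ y → φ s′ (add C x) y ≤ suc (φ s C y)
      older y = ≤-trans (cnt-∪ (edges n) {r = λ e → freeEdge s′ e ∧ joins (sing x) y e} f)
        (≤-trans (+-monoʳ-≤ (φ s C y) (φ-sing s′ x y)) (≤-reflexive (+-comm (φ s C y) 1)))
        where
        f : ∀ e → freeEdge s′ e ∧ joins (add C x) y e ≡ true →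
          freeEdge s e ∧ joins C y e ≡ true ⊎ freeEdge s′ e ∧ joins (sing x) y e ≡ true
        f e h with split y e h
        ... | inj₁ (p , _) = inj₁ p
        ... | inj₂ p = inj₂ p

      fresh : ∀ y → y ∈ T → φ s′ (add C x) y ≤ 1
      fresh y m = ≤-trans (cnt-mono (edges n) f) (φ-sing s′ x y)
        where
        f : ∀ e → freeEdge s′ e ∧ joins (add C x) y e ≡ true → freeEdge s′ e ∧ joins (sing x) y e ≡ true
        f e h with split y e h
        ... | inj₂ p = p
        ... | inj₁ (p , unoffered) =
          let a , j = ∧-elim {freeEdge s e} p
              fr , i = freeEdge-elim s e a in ⊥-elim (unoffered (offer-intro e fr i m j))

      module _ (x∈T : x ∈ T) where
        claimed′ : ∀ u v → IsEdge (u , v) → add C x u ≡ true → add C x v ≡ true → s′ u v ≢ free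
        claimed′ u v i cu cv f with still-free (u , v) i f
        ... | f′ , unoffered with ∨-elim {C u} cu | ∨-elim {C v} cv
        ...   | inj₁ a | inj₁ b = inside-claimed u v i a b f′
        ...   | inj₁ a | inj₂ b with dec-true (v Fin.≟ x) b
        ...     | refl = unoffered (offer-intro (u , v) f′ i x∈T (joins-introʳ C v u a))
        claimed′ u v i cu cv f | f′ , unoffered | inj₂ a | inj₁ b with dec-true (u Fin.≟ x) a
        ...     | refl = unoffered (offer-intro (u , v) f′ i x∈T (joins-introˡ C u v b))
        claimed′ u v i cu cv f | f′ , unoffered | inj₂ a | inj₂ b =
          <-irrefl (cong toℕ (trans (dec-true (u Fin.≟ x) a) (sym (dec-true (v Fin.≟ x) b)))) i

    -- An empty offer is not a legal move. But then no vertex of `T` has a free edge to `C`, and `x`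
    -- joins `C` without a move and without a new Client edge.
    skipped : (∀ e → ¬ e ∈ offer) → ∀ x → x ∈ T → Reached x s
    skipped none x m = record
      { inv′ = record
        { parent = parent ; rank = rank ; height = height ; rank<height = rank<height
        ; client-inside = λ u v i c → let a , b , r = client-inside u v i c in ∨-introˡ a , ∨-introˡ b , r
        ; inside-claimed = claimed′ m }
      ; fresh = fresh ; older = older }
      where open Drops x s (λ e _ f → f , none e)

    module Chosen (x c : Fin n) (x∈T : x ∈ T) (c∈C : C c ≡ true) (e : Pair n) (e∈ : e ∈ offer)
      (ends : e ≡ (x , c) ⊎ e ≡ (c , x)) where

      s′ : Position n
      s′ = update s offer e

      outside : C x ≡ false
      outside = go (bool-case (C x)) ends (offer-elim e e∈)
        where
        go : C x ≡ true ⊎ C x ≡ false → e ≡ (x , c) ⊎ e ≡ (c , x) →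
          at s e ≡ free × IsEdge e × ∃[ y ] (y ∈ T × joins C y e ≡ true) → C x ≡ false
        go (inj₂ o) _ _ = o
        go (inj₁ o) (inj₁ refl) (f , i , _) = ⊥-elim (inside-claimed x c i o c∈C f)
        go (inj₁ o) (inj₂ refl) (f , i , _) = ⊥-elim (inside-claimed c x i c∈C o f)

      still-free : ∀ e′ → IsEdge e′ → at s′ e′ ≡ free → at s e′ ≡ free × ¬ e′ ∈ offer
      still-free e′ _ f with e′ == e | bool-case (offered offer e′)
      still-free e′ _ () | true | _
      ... | false | inj₁ o rewrite o = case-absurd f
        where
        case-absurd : waiter ≡ free → at s e′ ≡ free × ¬ e′ ∈ offer
        case-absurd ()
      ... | false | inj₂ o rewrite o = f , λ m → true≢false (offered-∈ offer m) o

      now-client : ∀ e′ → at s′ e′ ≡ client → e′ ≡ e ⊎ at s e′ ≡ client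
      now-client e′ h with bool-case (e′ == e) | offered offer e′
      ... | inj₁ p | _ = inj₁ (==-sound p)
      now-client e′ h | inj₂ p | true rewrite p with h
      ... | ()
      now-client e′ h | inj₂ p | false rewrite p = inj₂ h

      parent′ : Fin n → Fin n
      parent′ v = if sing x v then c else parent v
      rank′ : Fin n → ℕ
      rank′ v = if sing x v then height else rank v

      sing-C : ∀ v → C v ≡ true → sing x v ≡ false
      sing-C v h with v Fin.≟ x
      ... | yes refl = ⊥-elim (true≢false h outside)
      ... | no _ = refl

      at-x : parent′ x ≡ c × rank′ x ≡ height
      at-x rewrite dec-intro (x Fin.≟ x) refl = refl , refl

      at-C : ∀ v → C v ≡ true → parent′ v ≡ parent v × rank′ v ≡ rank v
      at-C v h rewrite sing-C v h = refl , refl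

      new-edge : parent′ x ≡ c × rank′ c < rank′ x
      new-edge = proj₁ at-x , subst₂ _<_ (sym (proj₂ (at-C c c∈C))) (sym (proj₂ at-x)) (rank<height c)

      x-in : add C x x ≡ true
      x-in = ∨-introʳ {C x} (dec-intro (x Fin.≟ x) refl)

      client-inside′ : ∀ u v → IsEdge (u , v) → s′ u v ≡ client → add C x u ≡ true × add C x v ≡ true ×
        ((parent′ u ≡ v × rank′ v < rank′ u) ⊎ (parent′ v ≡ u × rank′ u < rank′ v))
      client-inside′ u v i h with now-client (u , v) h
      ... | inj₂ old with client-inside u v i old
      ...   | a , b , r = ∨-introˡ a , ∨-introˡ b , transport r
        where
        transport : (parent u ≡ v × rank v < rank u) ⊎ (parent v ≡ u × rank u < rank v) →
          (parent′ u ≡ v × rank′ v < rank′ u) ⊎ (parent′ v ≡ u × rank′ u < rank′ v)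
        transport (inj₁ (p , lt)) = inj₁ (trans (proj₁ (at-C u a)) p ,
          subst₂ _<_ (sym (proj₂ (at-C v b))) (sym (proj₂ (at-C u a))) lt)
        transport (inj₂ (p , lt)) = inj₂ (trans (proj₁ (at-C v b)) p ,
          subst₂ _<_ (sym (proj₂ (at-C u a))) (sym (proj₂ (at-C v b))) lt)
      client-inside′ u v i h | inj₁ uv≡e = go ends
        where
        go : e ≡ (x , c) ⊎ e ≡ (c , x) → add C x u ≡ true × add C x v ≡ true ×
          ((parent′ u ≡ v × rank′ v < rank′ u) ⊎ (parent′ v ≡ u × rank′ u < rank′ v))
        go (inj₁ e≡) with trans uv≡e e≡
        ... | refl = x-in , ∨-introˡ c∈C , inj₁ new-edge
        go (inj₂ e≡) with trans uv≡e e≡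
        ... | refl = ∨-introˡ c∈C , x-in , inj₂ new-edge

      open Drops x s′ still-free

      reached : Reached x s′
      reached = record
        { inv′ = record
          { parent = parent′ ; rank = rank′ ; height = suc height
          ; rank<height = rank-bound
          ; client-inside = client-inside′
          ; inside-claimed = claimed′ x∈T }
        ; fresh = fresh ; older = older }
        where
        rank-bound : ∀ v → rank′ v < suc height
        rank-bound v with sing x v
        ... | true = ≤-refl
        ... | false = m≤n⇒m≤1+n (rank<height v)

    chosen : ∀ e → e ∈ offer → ∃[ x ] (x ∈ T × Reached x (update s offer e))
    chosen e@(a , b) m with offer-elim e m
    ... | f , i , y , y∈ , j with joins-elim C y a b j
    ...   | inj₁ (refl , c) = y , y∈ , Chosen.reached y b y∈ c e m (inj₁ refl)
    ...   | inj₂ (refl , c) = y , y∈ , Chosen.reached y a y∈ c e m (inj₂ refl)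

  module Strategy (q : ℕ) where

    Keeps : Position n → Set
    Keeps = WaiterKeeps q (λ G → ¬ HasMinor G 3)

    round : ∀ {s C} (inv : Inv s C) x₀ (T : List (Fin n)) → Σ[ x₀ ∷ T ] (φ s C) ≤ suc q →
      (∀ x s′ → x ∈ x₀ ∷ T → Offer.Reached s C inv (x₀ ∷ T) x s′ → Keeps s′) → Keeps s
    round {s} {C} inv x₀ T h continue with offer in eq
      where open Offer s C inv (x₀ ∷ T)
    ... | [] = continue x₀ s (here refl) (skipped (λ e m → absurd (subst (e ∈_) eq m)) x₀ (here refl))
      where
      open Offer s C inv (x₀ ∷ T)
      absurd : ∀ {e : Pair n} → e ∈ [] → ⊥
      absurd ()
    ... | e ∷ es = offerMove (forest-no-K₃ (Inv.forest inv)) offer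
        (valid h (subst (λ l → 1 ≤ length l) (sym eq) (s≤s z≤n)))
        (λ e m → let x , x∈ , r = chosen e m in continue x _ x∈ r)
      where open Offer s C inv (x₀ ∷ T)

    -- The vertex at place i, counted from 0, costs at most `k` - i. When the first vertex is
    -- attached the others become dearer by one and move forward by one place, so the same `k`
    -- bounds every later offer.
    data Staircase (f : Fin n → ℕ) : ℕ → List (Fin n) → Set where
      [] : ∀ {k} → Staircase f k []
      _∷_ : ∀ {k y ys} → f y ≤ suc k → Staircase f k ys → Staircase f (suc k) (y ∷ ys)

    raise : ∀ {f g : Fin n → ℕ} → (∀ y → g y ≤ suc (f y)) → ∀ {k ys} → Staircase f k ys → Staircase g (suc k) ys
    raise h [] = []
    raise h (p ∷ st) = ≤-trans (h _) (s≤s p) ∷ raise h st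

    weaken : ∀ {f k k′ ys} → k ≤ k′ → Staircase f k ys → Staircase f k′ ys
    weaken h [] = []
    weaken (s≤s h) (p ∷ st) = ≤-trans p (s≤s h) ∷ weaken h st

    append : ∀ {f k ys} zs → Staircase f k ys → length ys + length zs ≤ k → (∀ z → z ∈ zs → f z ≤ 1) →
      Staircase f k (ys ++ zs)
    append [] [] h hz = []
    append {k = suc k} (z ∷ zs) [] (s≤s h) hz = ≤-trans (hz z (here refl)) (s≤s z≤n) ∷ append zs [] h (λ y m → hz y (there m))
    append zs (p ∷ st) (s≤s h) hz = p ∷ append zs st h hz

    Covers : Sub n → List (Fin n) → Set
    Covers C ys = ∀ v → C v ≡ true ⊎ v ∈ ys

    add-covers : ∀ {C ys zs x} → Covers C ys → (∀ v → v ∈ ys → v ≡ x ⊎ v ∈ zs) → Covers (add C x) zs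
    add-covers {C} {x = x} cov h v with cov v
    ... | inj₁ c = inj₁ (∨-introˡ c)
    ... | inj₂ m with h v m
    ...   | inj₁ refl = inj₁ (∨-introʳ {C v} (dec-intro (v Fin.≟ v) refl))
    ...   | inj₂ m′ = inj₂ m′

    descend : ∀ ys {s C k} → Inv s C → Covers C ys → Staircase (φ s C) k ys → k ≤ suc q → Keeps s
    descend [] inv cov st h = finished (forest-no-K₃ (Inv.forest inv))
      (λ u v i → Inv.inside-claimed inv u v i (all-in u) (all-in v))
      where
      all-in : ∀ v → _ ≡ true
      all-in v with cov v
      ... | inj₁ c = c
    descend (y ∷ ys) {s} {C} inv cov (p ∷ st) h = round inv y [] (≤-trans (≤-reflexive (+-identityʳ _)) (≤-trans p h)) next
      where
      next : ∀ x s′ → x ∈ y ∷ [] → Offer.Reached s C inv (y ∷ []) x s′ → Keeps s′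
      next x s′ (here refl) r = descend ys (Offer.Reached.inv′ r)
        (add-covers cov λ { v (here e) → inj₁ e ; v (there m) → inj₂ m })
        (raise (Offer.Reached.older r) st) h

    remove : ∀ {x} (T : List (Fin n)) → x ∈ T →
      ∃[ T′ ] (length T ≡ suc (length T′) × (∀ v → v ∈ T → v ≡ x ⊎ v ∈ T′) × (∀ v → v ∈ T′ → v ∈ T))
    remove (y ∷ T) (here refl) = T , refl , (λ { v (here e) → inj₁ e ; v (there m) → inj₂ m }) , λ v m → there m
    remove (y ∷ T) (there m) with remove T m
    ... | T′ , l , f , g = y ∷ T′ , cong suc l ,
          (λ { v (here e) → inj₂ (here e) ; v (there m′) → there-⊎ (f v m′) }) ,
          (λ { v (here e) → here e ; v (there m′) → there (g v m′) })
      where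
      there-⊎ : ∀ {v x} → v ≡ x ⊎ v ∈ T′ → v ≡ x ⊎ v ∈ y ∷ T′
      there-⊎ (inj₁ e) = inj₁ e
      there-⊎ (inj₂ m) = inj₂ (there m)

    -- Offering one vertex of zs together with all but one vertex of fs replaces fs
    -- by equally many fresh vertices, whichever vertex Client attaches; the spared
    -- vertex becomes the last step of the staircase os.
    climb : ∀ zs fs os {s C k} → Inv s C → Covers C (os ++ fs ++ zs) → Staircase (φ s C) k os →
      (∀ y → y ∈ fs → φ s C y ≤ 1) → (∀ y → y ∈ zs → φ s C y ≤ suc k) →
      length os < k → length fs + k ≤ suc q → length zs + k ≤ suc q → Keeps s
    climb [] fs os {k = k} inv cov st hf hz lo lf lz =
      -- The vertices of `fs` cost at most 1, so they can be the lowest steps behind `os` as soon as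
      -- the staircase, raised to `suc q`, has that many steps.
      descend (os ++ fs) inv (subst (λ l → Covers _ (os ++ l)) (++-identityʳ fs) cov)
        (append fs (weaken (≤-trans (m≤n+m k (length fs)) lf) st)
          (≤-trans (≤-trans (≤-reflexive (+-comm (length os) _)) (+-monoʳ-≤ (length fs) (<⇒≤ lo))) lf) hf)
        ≤-refl
    climb (z ∷ zs) [] os {s} {C} {k} inv cov st hf hz lo lf lz =
      round inv z [] (≤-trans (≤-reflexive (+-identityʳ _)) (≤-trans (hz z (here refl)) (≤-trans (s≤s (m≤n+m k (length zs))) lz))) next
      where
      next : ∀ x s′ → x ∈ z ∷ [] → Offer.Reached s C inv (z ∷ []) x s′ → Keeps s′
      next x s′ (here refl) r = climb zs [] os {k = suc k} (Offer.Reached.inv′ r)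
        (add-covers cov cover) (raise (Offer.Reached.older r) st) (λ y ())
        (λ y m → ≤-trans (Offer.Reached.older r y) (s≤s (hz y (there m))))
        (m≤n⇒m≤1+n lo) (≤-trans (s≤s (m≤n+m k (length zs))) lz) (≤-trans (≤-reflexive (+-suc (length zs) k)) lz)
        where
        cover : ∀ v → v ∈ os ++ x ∷ zs → v ≡ x ⊎ v ∈ os ++ zs
        cover v m with ∈-++⁻ os m
        ... | inj₁ m′ = inj₂ (∈-++⁺ˡ m′)
        ... | inj₂ (here e) = inj₁ e
        ... | inj₂ (there m′) = inj₂ (∈-++⁺ʳ os m′)
    climb (z ∷ zs) (f ∷ fs) os {s} {C} {k} inv cov st hf hz lo lf lz = round inv z fs total next
      where
      -- `z` costs `suc k` and each offered vertex of `fs` costs 1. Sparing `f` makes room for the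
      -- one unit by which `suc k` exceeds `k`.
      total : φ s C z + Σ[ fs ] (φ s C) ≤ suc q
      total = ≤-trans (+-mono-≤ (hz z (here refl)) (Σ-≤-const fs (λ y m → hf y (there m))))
        (≤-trans (≤-reflexive (trans (cong (suc k +_) (*-identityʳ (length fs))) (cong suc (+-comm k (length fs))))) lf)
      next : ∀ x s′ → x ∈ z ∷ fs → Offer.Reached s C inv (z ∷ fs) x s′ → Keeps s′
      next x s′ x∈ r with remove (z ∷ fs) x∈
      ... | fs′ , l , split , back = climb zs fs′ (os ∷ʳ f) {k = suc k} (Offer.Reached.inv′ r)
        (add-covers cov cover)
        (raise (Offer.Reached.older r) (append (f ∷ []) st (≤-trans (≤-reflexive (+-comm (length os) 1)) lo)
          (λ { y (here refl) → hf y (here refl) })))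
        (λ y m → Offer.Reached.fresh r y (back y m))
        (λ y m → ≤-trans (Offer.Reached.older r y) (s≤s (hz y (there m))))
        (s≤s (≤-trans (≤-reflexive (trans (length-++ os) (+-comm (length os) 1))) lo))
        (≤-trans (≤-reflexive (trans (cong (_+ suc k) (sym (suc-injective l))) (+-suc (length fs) k))) lf)
        (≤-trans (≤-reflexive (+-suc (length zs) k)) lz)
        where
        cover : ∀ v → v ∈ os ++ (f ∷ fs) ++ (z ∷ zs) → v ≡ x ⊎ v ∈ (os ∷ʳ f) ++ fs′ ++ zs
        fresh-or-x : ∀ v → v ∈ z ∷ fs → v ≡ x ⊎ v ∈ (os ∷ʳ f) ++ fs′ ++ zs
        fresh-or-x v m with split v m
        ... | inj₁ e = inj₁ e
        ... | inj₂ m′ = inj₂ (∈-++⁺ʳ (os ∷ʳ f) (∈-++⁺ˡ m′))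
        cover v m with ∈-++⁻ os m
        ... | inj₁ m₁ = inj₂ (∈-++⁺ˡ (∈-++⁺ˡ m₁))
        ... | inj₂ (here e) = inj₂ (∈-++⁺ˡ (∈-++⁺ʳ os (here e)))
        ... | inj₂ (there m₂) with ∈-++⁻ fs m₂
        ...   | inj₁ m₃ = fresh-or-x v (there m₃)
        ...   | inj₂ (here e) = fresh-or-x v (here e)
        ...   | inj₂ (there m₃) = inj₂ (∈-++⁺ʳ (os ∷ʳ f) (∈-++⁺ʳ fs′ m₃))

waiter-keeps-forest : ∀ n q → 1 ≤ n → n ≤ 2 * q + 2 → WaiterKeeps q (λ G → ¬ HasMinor G 3) (initial n)
-- The vertices are split as 1 in `C₀`, at most `q + 1` in the first offer, and at most `q` in the
-- list `Z`, which `climb` can handle from `k = 1`.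
waiter-keeps-forest (suc n) q _ n≤ = open-game (take (suc q) L) (drop (suc q) L) (take++drop≡id (suc q) L)
    (≤-trans (≤-reflexive (length-take (suc q) L)) (m⊓n≤m (suc q) _))
    (≤-trans (≤-reflexive (trans (length-drop (suc q) L) (cong (_∸ suc q) (length-tabulate {n = n} suc))))
      (m≤n+o⇒m∸n≤o n (suc q) (≤-pred (≤-trans n≤ (≤-reflexive (arith q))))))
  where
  open Strategy {suc n} q
  L : List (Fin (suc n))
  L = tabulate suc
  arith : ∀ q → 2 * q + 2 ≡ suc (suc q + q)
  arith = solve-∀
  C₀ : Sub (suc n)
  C₀ = sing zero
  inv₀ : Inv (initial (suc n)) C₀
  inv₀ = record
    { parent = id ; rank = λ _ → 0 ; height = 1 ; rank<height = λ _ → s≤s z≤n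
    ; client-inside = λ _ _ _ ()
    ; inside-claimed = λ u v i a b _ → <-irrefl (cong toℕ (trans (dec-true (u Fin.≟ zero) a) (sym (dec-true (v Fin.≟ zero) b)))) i }
  covers₀ : Covers C₀ L
  covers₀ zero = inj₁ refl
  covers₀ (suc v) = inj₂ (∈-tabulate⁺ v)
  open-game : ∀ T Z → T ++ Z ≡ L → length T ≤ suc q → length Z ≤ q → Keeps (initial (suc n))
  open-game [] Z eq _ lz = climb Z [] [] {k = 1} inv₀ (subst (Covers C₀) (sym eq) covers₀) [] (λ y ())
    (λ y _ → m≤n⇒m≤1+n (φ-sing (initial (suc n)) zero y)) (s≤s z≤n) (s≤s z≤n)
    (≤-trans (≤-reflexive (+-comm (length Z) 1)) (s≤s lz))
  open-game (x₀ ∷ T) Z eq lt lz = round inv₀ x₀ T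
      (≤-trans (Σ-≤-const (x₀ ∷ T) (λ y _ → φ-sing (initial (suc n)) zero y)) (≤-trans (≤-reflexive (*-identityʳ _)) lt)) next
    where
    next : ∀ x s′ → x ∈ x₀ ∷ T → Offer.Reached (initial (suc n)) C₀ inv₀ (x₀ ∷ T) x s′ → Keeps s′
    next x s′ x∈ r with remove (x₀ ∷ T) x∈
    ... | fs , l , split , back = climb Z fs [] {k = 1} (Offer.Reached.inv′ r)
      (add-covers (subst (Covers C₀) (sym eq) covers₀) cover) []
      (λ y m → Offer.Reached.fresh r y (back y m))
      (λ y _ → ≤-trans (Offer.Reached.older r y) (s≤s (φ-sing (initial (suc n)) zero y)))
      (s≤s z≤n) (≤-trans (≤-reflexive (trans (+-comm (length fs) 1) (sym l))) lt)
      (≤-trans (≤-reflexive (+-comm (length Z) 1)) (s≤s lz))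
      where
      cover : ∀ v → v ∈ (x₀ ∷ T) ++ Z → v ≡ x ⊎ v ∈ fs ++ Z
      cover v m with ∈-++⁻ (x₀ ∷ T) m
      ... | inj₂ m′ = inj₂ (∈-++⁺ʳ fs m′)
      ... | inj₁ m′ with split v m′
      ...   | inj₁ e = inj₁ e
      ...   | inj₂ m″ = inj₂ (∈-++⁺ˡ m″)

-- Inequalities between powers

module _ where
  open ≤-Reasoning

  m<[1+m/n]*n : ∀ m n .{{_ : NonZero n}} → m < suc (m / n) * n
  m<[1+m/n]*n m n = begin-strict
    m ≡⟨ m≡m%n+[m/n]*n m n ⟩
    m % n + m / n * n <⟨ +-monoˡ-< (m / n * n) (m%n<n m n) ⟩
    n + m / n * n ∎

  ^-distrib-* : ∀ a b k → (a * b) ^ k ≡ a ^ k * b ^ k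
  ^-distrib-* a b zero = refl
  ^-distrib-* a b (suc k) = trans (cong (a * b *_) (^-distrib-* a b k)) (lem a b (a ^ k) (b ^ k))
    where
    lem : ∀ a b c d → a * b * (c * d) ≡ a * c * (b * d)
    lem = solve-∀

  -- (1 + 1/k)-weighted AM-GM for A^k and A^(k+1), A = D + l.
  weighted-AM-GM : ∀ D l k → suc k * (D + l) ^ k * D ≤ k * (D + l) ^ suc k + D ^ suc k
  weighted-AM-GM D l zero = ≤-reflexive (e D)
    where
    e : ∀ D → 1 * 1 * D ≡ 0 + D * 1
    e = solve-∀
  -- Adding `k * P * A * D` to both sides allows 2AD ≤ A² + D² to be used and leaves exactly the
  -- induction hypothesis times `D`.
  weighted-AM-GM D l (suc k) = +-cancelʳ-≤ (k * P * A * D) _ _ (begin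
    suc (suc k) * (A * P) * D + k * P * A * D ≡⟨ e₁ k D l P ⟩
    suc k * P * (2 * A * D) ≤⟨ *-monoʳ-≤ (suc k * P) (≤-trans (m≤m+n _ (l * l)) (≤-reflexive (e₂ D l))) ⟩
    suc k * P * (A * A + D * D) ≡⟨ e₃ k D l P ⟩
    suc k * (A * (A * P)) + D * (suc k * P * D) ≤⟨ +-monoʳ-≤ (suc k * (A * (A * P))) (*-monoʳ-≤ D (weighted-AM-GM D l k)) ⟩
    suc k * (A * (A * P)) + D * (k * (A * P) + D ^ suc k) ≡⟨ e₄ (suc k * (A * (A * P))) D k A P (D ^ suc k) ⟩
    suc k * (A * (A * P)) + D * D ^ suc k + k * P * A * D ∎)
    where
    A P : ℕ
    A = D + l
    P = A ^ k
    e₁ : ∀ k D l P → suc (suc k) * ((D + l) * P) * D + k * P * (D + l) * D ≡ suc k * P * (2 * (D + l) * D)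
    e₁ = solve-∀
    e₂ : ∀ D l → 2 * (D + l) * D + l * l ≡ (D + l) * (D + l) + D * D
    e₂ = solve-∀
    e₃ : ∀ k D l P → suc k * P * ((D + l) * (D + l) + D * D) ≡ suc k * ((D + l) * ((D + l) * P)) + D * (suc k * P * D)
    e₃ = solve-∀
    e₄ : ∀ X D k A P E → X + D * (k * (A * P) + E) ≡ X + D * E + k * P * A * D
    e₄ = solve-∀

  -- Convexity in s of (1 + L/Q)^s, which lies below its chord over [0 , Q].
  below-chord : ∀ Q L x .{{_ : NonZero Q}} → (Q + L) ^ Q ≤ suc x * Q ^ Q → ∀ d s → s + d ≡ Q →
    Q * (Q + L) ^ s ≤ (Q + s * x) * Q ^ s
  below-chord Q L x h zero s e rewrite trans (sym (+-identityʳ s)) e = begin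
    Q * (Q + L) ^ Q ≤⟨ *-monoʳ-≤ Q h ⟩
    Q * (suc x * Q ^ Q) ≡⟨ lem Q x (Q ^ Q) ⟩
    (Q + Q * x) * Q ^ Q ∎
    where
    lem : ∀ q x p → q * (suc x * p) ≡ (q + q * x) * p
    lem = solve-∀
  -- Induction downwards from `s = Q`: the value at `s` is compared with the chord between 0 and
  -- `suc s`, which `weighted-AM-GM` provides.
  below-chord Q L x h (suc d) s e = *-cancelˡ-≤ (suc s * Q) {{m*n≢0 (suc s) Q}} (begin
    suc s * Q * (Q * A ^ s) ≡⟨ e₁ s Q (A ^ s) ⟩
    Q * (suc s * A ^ s * Q) ≤⟨ *-monoʳ-≤ Q (weighted-AM-GM Q L s) ⟩
    Q * (s * A ^ suc s + Q ^ suc s) ≡⟨ e₂ Q s (A ^ suc s) (Q ^ suc s) ⟩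
    s * (Q * A ^ suc s) + Q * Q ^ suc s
      ≤⟨ +-monoˡ-≤ (Q * Q ^ suc s) (*-monoʳ-≤ s (below-chord Q L x h d (suc s) (trans (sym (+-suc s d)) e))) ⟩
    s * ((Q + suc s * x) * Q ^ suc s) + Q * Q ^ suc s ≡⟨ e₃ s Q x (Q ^ s) ⟩
    suc s * Q * ((Q + s * x) * Q ^ s) ∎)
    where
    A : ℕ
    A = Q + L
    e₁ : ∀ s Q P → suc s * Q * (Q * P) ≡ Q * (suc s * P * Q)
    e₁ = solve-∀
    e₂ : ∀ Q s P R → Q * (s * P + R) ≡ s * (Q * P) + Q * R
    e₂ = solve-∀
    e₃ : ∀ s Q x R → s * ((Q + suc s * x) * (Q * R)) + Q * (Q * R) ≡ suc s * Q * ((Q + s * x) * R)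
    e₃ = solve-∀

  bernoulli : ∀ Q x j → (Q + j * x) * Q ^ j ≤ Q * (Q + x) ^ j
  bernoulli Q x zero = ≤-reflexive (cong (_* 1) (+-identityʳ Q))
  bernoulli Q x (suc j) = begin
    (Q + suc j * x) * (Q * Q ^ j) ≤⟨ m≤m+n _ (j * x * x * Q ^ j) ⟩
    (Q + suc j * x) * (Q * Q ^ j) + j * x * x * Q ^ j ≡⟨ e₁ Q x j (Q ^ j) ⟩
    (Q + x) * ((Q + j * x) * Q ^ j) ≤⟨ *-monoʳ-≤ (Q + x) (bernoulli Q x j) ⟩
    (Q + x) * (Q * (Q + x) ^ j) ≡⟨ e₂ (Q + x) Q ((Q + x) ^ j) ⟩
    Q * ((Q + x) * (Q + x) ^ j) ∎
    where
    e₁ : ∀ Q x j P → (Q + suc j * x) * (Q * P) + j * x * x * P ≡ (Q + x) * ((Q + j * x) * P)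
    e₁ = solve-∀
    e₂ : ∀ a b c → a * (b * c) ≡ b * (a * c)
    e₂ = solve-∀

  -- With s = j + k and after division by powers of Q: the chord gives j(1 + sx/Q), which is at most
  -- s(1 + jx/Q) because j ≤ s, and Bernoulli bounds this by s(1 + x/Q)^j.
  key-inequality : ∀ Q L x .{{_ : NonZero Q}} → (Q + L) ^ Q ≤ suc x * Q ^ Q → ∀ j k → j + k ≤ Q →
    j * (Q + L) ^ (j + k) ≤ (j + k) * ((Q + x) ^ j * Q ^ k)
  key-inequality Q L x h j k j+k≤Q = *-cancelˡ-≤ Q (begin
    Q * (j * (Q + L) ^ s) ≡⟨ e₁ Q j ((Q + L) ^ s) ⟩
    j * (Q * (Q + L) ^ s) ≤⟨ *-monoʳ-≤ j (below-chord Q L x h (Q ∸ s) s (m+[n∸m]≡n j+k≤Q)) ⟩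
    j * ((Q + s * x) * Q ^ s) ≤⟨ m≤m+n _ (k * Q * Q ^ s) ⟩
    j * ((Q + s * x) * Q ^ s) + k * Q * Q ^ s ≡⟨ e₂ j k Q x (Q ^ s) ⟩
    s * ((Q + j * x) * Q ^ s) ≡⟨ cong (λ z → s * ((Q + j * x) * z)) (^-distribˡ-+-* Q j k) ⟩
    s * ((Q + j * x) * (Q ^ j * Q ^ k)) ≡⟨ cong (s *_) (sym (*-assoc (Q + j * x) (Q ^ j) (Q ^ k))) ⟩
    s * ((Q + j * x) * Q ^ j * Q ^ k) ≤⟨ *-monoʳ-≤ s (*-monoˡ-≤ (Q ^ k) (bernoulli Q x j)) ⟩
    s * (Q * (Q + x) ^ j * Q ^ k) ≡⟨ e₃ s Q ((Q + x) ^ j) (Q ^ k) ⟩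
    Q * (s * ((Q + x) ^ j * Q ^ k)) ∎)
    where
    s : ℕ
    s = j + k
    e₁ : ∀ a b c → a * (b * c) ≡ b * (a * c)
    e₁ = solve-∀
    e₂ : ∀ j k Q x P → j * ((Q + (j + k) * x) * P) + k * Q * P ≡ (j + k) * ((Q + j * x) * P)
    e₂ = solve-∀
    e₃ : ∀ s a b c → s * (a * b * c) ≡ a * (s * (b * c))
    e₃ = solve-∀

  -- This is (1 + x/Q)^m ≤ 1/(1 - mx/Q), with `y` standing for the difference Q - mx.
  inverse-bernoulli : ∀ Q x m y → m * x + y ≡ Q → (Q + x) ^ m * y ≤ Q ^ suc m
  inverse-bernoulli Q x zero y refl = ≤-reflexive (e y)
    where
    e : ∀ y → 1 * y ≡ y * 1
    e = solve-∀
  inverse-bernoulli Q x (suc m) y e = begin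
    (Q + x) * P * y ≡⟨ e₁ Q x P y ⟩
    P * (Q * y + x * y) ≤⟨ *-monoʳ-≤ P (+-monoʳ-≤ (Q * y) (*-monoʳ-≤ x (≤-trans (m≤n+m y (suc m * x)) (≤-reflexive e)))) ⟩
    P * (Q * y + x * Q) ≡⟨ e₂ Q x P y ⟩
    Q * (P * (x + y)) ≤⟨ *-monoʳ-≤ Q (inverse-bernoulli Q x m (x + y) (trans (e₃ m x y) e)) ⟩
    Q * Q ^ suc m ∎
    where
    P : ℕ
    P = (Q + x) ^ m
    e₁ : ∀ Q x P y → (Q + x) * P * y ≡ P * (Q * y + x * y)
    e₁ = solve-∀
    e₂ : ∀ Q x P y → P * (Q * y + x * Q) ≡ Q * (P * (x + y))
    e₂ = solve-∀
    e₃ : ∀ m x y → m * x + (x + y) ≡ suc m * x + y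
    e₃ = solve-∀

  power-at-most-double : ∀ Q x m .{{_ : NonZero Q}} → 2 * (m * x) ≤ Q → (Q + x) ^ m ≤ 2 * Q ^ m
  power-at-most-double Q x m h = *-cancelˡ-≤ Q (begin
    Q * (Q + x) ^ m ≤⟨ *-monoˡ-≤ ((Q + x) ^ m) Q≤2y ⟩
    2 * y * (Q + x) ^ m ≡⟨ e₁ y ((Q + x) ^ m) ⟩
    2 * ((Q + x) ^ m * y) ≤⟨ *-monoʳ-≤ 2 (inverse-bernoulli Q x m y (m+[n∸m]≡n mx≤Q)) ⟩
    2 * (Q * Q ^ m) ≡⟨ e₂ Q (Q ^ m) ⟩
    Q * (2 * Q ^ m) ∎)
    where
    y : ℕ
    y = Q ∸ m * x
    mx≤Q : m * x ≤ Q
    mx≤Q = ≤-trans (m≤n*m (m * x) 2) h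
    Q≤2y : Q ≤ 2 * y
    Q≤2y = +-cancelˡ-≤ (2 * (m * x)) _ _ (begin
      2 * (m * x) + Q ≤⟨ +-monoˡ-≤ Q h ⟩
      Q + Q ≡⟨ cong₂ _+_ (sym (m+[n∸m]≡n mx≤Q)) (sym (m+[n∸m]≡n mx≤Q)) ⟩
      (m * x + y) + (m * x + y) ≡⟨ e₃ (m * x) y ⟩
      2 * (m * x) + 2 * y ∎)
      where
      e₃ : ∀ a b → (a + b) + (a + b) ≡ 2 * a + 2 * b
      e₃ = solve-∀
    e₁ : ∀ a b → 2 * a * b ≡ 2 * (b * a)
    e₁ = solve-∀
    e₂ : ∀ a b → 2 * (a * b) ≡ a * (2 * b)
    e₂ = solve-∀

  -- The exponent is rounded up to `c` blocks of length `m`, each of which costs a factor of at most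
  -- 2.
  power-≤ : ∀ Q x m c a .{{_ : NonZero Q}} → (Q + x) ^ m ≤ 2 * Q ^ m → a ≤ m * c →
    (Q + x) ^ a ≤ 2 ^ c * Q ^ a
  power-≤ Q x m c a h a≤mc = *-cancelʳ-≤ _ _ (Q ^ (m * c ∸ a)) {{m^n≢0 Q (m * c ∸ a)}} (begin
    (Q + x) ^ a * Q ^ (m * c ∸ a) ≤⟨ *-monoʳ-≤ ((Q + x) ^ a) (^-monoˡ-≤ (m * c ∸ a) (m≤m+n Q x)) ⟩
    (Q + x) ^ a * (Q + x) ^ (m * c ∸ a) ≡⟨ ^-distribˡ-+-* (Q + x) a (m * c ∸ a) ⟨
    (Q + x) ^ (a + (m * c ∸ a)) ≡⟨ cong ((Q + x) ^_) (m+[n∸m]≡n a≤mc) ⟩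
    (Q + x) ^ (m * c) ≡⟨ ^-*-assoc (Q + x) m c ⟨
    ((Q + x) ^ m) ^ c ≤⟨ ^-monoˡ-≤ c h ⟩
    (2 * Q ^ m) ^ c ≡⟨ ^-distrib-* 2 (Q ^ m) c ⟩
    2 ^ c * (Q ^ m) ^ c ≡⟨ cong (2 ^ c *_) (^-*-assoc Q m c) ⟩
    2 ^ c * Q ^ (m * c) ≡⟨ cong (λ z → 2 ^ c * Q ^ z) (sym (m+[n∸m]≡n a≤mc)) ⟩
    2 ^ c * Q ^ (a + (m * c ∸ a)) ≡⟨ cong (2 ^ c *_) (^-distribˡ-+-* Q a (m * c ∸ a)) ⟩
    2 ^ c * (Q ^ a * Q ^ (m * c ∸ a)) ≡⟨ *-assoc (2 ^ c) (Q ^ a) _ ⟨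
    2 ^ c * Q ^ a * Q ^ (m * c ∸ a) ∎)

  -- Blocks of length ⌊Q/(2g)⌋ + 1 at least double by Bernoulli, and `g` such blocks fit into the
  -- exponent `Q`.
  power-lower : ∀ Q g .{{_ : NonZero g}} → 4 * g ≤ Q → 2 ^ g * Q ^ Q ≤ (Q + 2 * g) ^ Q
  power-lower Q g h = begin
    2 ^ g * Q ^ Q ≡⟨ cong (λ z → 2 ^ g * Q ^ z) (sym (m+[n∸m]≡n kg≤Q)) ⟩
    2 ^ g * Q ^ (k * g + (Q ∸ k * g)) ≡⟨ cong (2 ^ g *_) (^-distribˡ-+-* Q (k * g) (Q ∸ k * g)) ⟩
    2 ^ g * (Q ^ (k * g) * Q ^ (Q ∸ k * g)) ≡⟨ cong (λ z → 2 ^ g * (z * Q ^ (Q ∸ k * g))) (sym (^-*-assoc Q k g)) ⟩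
    2 ^ g * ((Q ^ k) ^ g * Q ^ (Q ∸ k * g)) ≡⟨ *-assoc (2 ^ g) _ _ ⟨
    2 ^ g * (Q ^ k) ^ g * Q ^ (Q ∸ k * g) ≡⟨ cong (_* Q ^ (Q ∸ k * g)) (sym (^-distrib-* 2 (Q ^ k) g)) ⟩
    (2 * Q ^ k) ^ g * Q ^ (Q ∸ k * g) ≤⟨ *-mono-≤ (^-monoˡ-≤ g doubled) (^-monoˡ-≤ (Q ∸ k * g) (m≤m+n Q (2 * g))) ⟩
    ((Q + 2 * g) ^ k) ^ g * (Q + 2 * g) ^ (Q ∸ k * g) ≡⟨ cong (_* (Q + 2 * g) ^ (Q ∸ k * g)) (^-*-assoc (Q + 2 * g) k g) ⟩
    (Q + 2 * g) ^ (k * g) * (Q + 2 * g) ^ (Q ∸ k * g) ≡⟨ ^-distribˡ-+-* (Q + 2 * g) (k * g) (Q ∸ k * g) ⟨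
    (Q + 2 * g) ^ (k * g + (Q ∸ k * g)) ≡⟨ cong ((Q + 2 * g) ^_) (m+[n∸m]≡n kg≤Q) ⟩
    (Q + 2 * g) ^ Q ∎
    where
    instance
      2g≢0 : NonZero (2 * g)
      2g≢0 = m*n≢0 2 g
      Q≢0 : NonZero Q
      Q≢0 = >-nonZero (≤-trans (>-nonZero⁻¹ (2 * g)) (≤-trans (*-monoˡ-≤ g {2} {4} (s≤s (s≤s z≤n))) h))
    k : ℕ
    k = suc (Q / (2 * g))
    e₁ : ∀ a b → 2 * (a * b) ≡ a * (2 * b)
    e₁ = solve-∀
    kg≤Q : k * g ≤ Q
    kg≤Q = *-cancelˡ-≤ 2 (begin
      2 * (k * g) ≡⟨ e₁ k g ⟩
      2 * g + Q / (2 * g) * (2 * g) ≤⟨ +-mono-≤ (≤-trans (*-monoˡ-≤ g {2} {4} (s≤s (s≤s z≤n))) h) (m/n*n≤m Q (2 * g)) ⟩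
      Q + Q ≡⟨ cong (Q +_) (sym (+-identityʳ Q)) ⟩
      2 * Q ∎)
    doubled : 2 * Q ^ k ≤ (Q + 2 * g) ^ k
    doubled = *-cancelˡ-≤ Q (begin
      Q * (2 * Q ^ k) ≡⟨ e₂ Q (Q ^ k) ⟩
      (Q + Q) * Q ^ k ≤⟨ *-monoˡ-≤ (Q ^ k) (+-monoʳ-≤ Q (<⇒≤ (m<[1+m/n]*n Q (2 * g)))) ⟩
      (Q + k * (2 * g)) * Q ^ k ≤⟨ bernoulli Q (2 * g) k ⟩
      Q * (Q + 2 * g) ^ k ∎)
      where
      e₂ : ∀ a b → a * (2 * b) ≡ (a + a) * b
      e₂ = solve-∀

  -- Blocks of length ⌊Q/(2L)⌋ at most double. This length is at least 1, so `4 * L` blocks cover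
  -- the exponent `Q`.
  power-upper : ∀ Q L .{{_ : NonZero L}} → 2 * L ≤ Q → (Q + L) ^ Q ≤ 2 ^ (4 * L) * Q ^ Q
  power-upper Q L h = power-≤ Q L k (4 * L) Q (power-at-most-double Q L k doubled) long
    where
    instance
      2L≢0 : NonZero (2 * L)
      2L≢0 = m*n≢0 2 L
      Q≢0 : NonZero Q
      Q≢0 = >-nonZero (≤-trans (>-nonZero⁻¹ (2 * L)) h)
    k : ℕ
    k = Q / (2 * L)
    e₁ : ∀ a b → 2 * (a * b) ≡ a * (2 * b)
    e₁ = solve-∀
    doubled : 2 * (k * L) ≤ Q
    doubled = ≤-trans (≤-reflexive (e₁ k L)) (m/n*n≤m Q (2 * L))
    1≤k : 1 ≤ k
    1≤k = *-cancelʳ-< (2 * L) 0 k (≤∧≢⇒< z≤n λ z → <⇒≱ (m<[1+m/n]*n Q (2 * L))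
      (≤-trans (≤-reflexive (trans (+-comm (2 * L) _) (cong (_+ 2 * L) (sym z)))) h))
    long : Q ≤ k * (4 * L)
    long = begin
      Q ≤⟨ <⇒≤ (m<[1+m/n]*n Q (2 * L)) ⟩
      2 * L + k * (2 * L) ≤⟨ +-monoˡ-≤ (k * (2 * L)) (≤-trans (≤-reflexive (sym (*-identityˡ (2 * L)))) (*-monoˡ-≤ (2 * L) 1≤k)) ⟩
      k * (2 * L) + k * (2 * L) ≡⟨ e₂ k L ⟩
      k * (4 * L) ∎
      where
      e₂ : ∀ k L → k * (2 * L) + k * (2 * L) ≡ k * (4 * L)
      e₂ = solve-∀

-- Client's strategy

prepend : ∀ {n} → ℕ → (Fin n → ℕ) → Fin (suc n) → ℕ
prepend c f zero = c
prepend c f (suc i) = f i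

labellings : ∀ n (K : ℕ) → List (Fin n → ℕ)
labellings zero K = (λ ()) ∷ []
labellings (suc n) K = cartesianProductWith prepend (upTo K) (labellings n K)

length-cartesianProductWith : ∀ {A B C : Set} (f : A → B → C) xs ys →
  length (cartesianProductWith f xs ys) ≡ length xs * length ys
length-cartesianProductWith f [] ys = refl
length-cartesianProductWith f (x ∷ xs) ys = trans (length-++ (map (f x) ys))
  (cong₂ _+_ (length-map (f x) ys) (length-cartesianProductWith f xs ys))

length-labellings : ∀ n K → length (labellings n K) ≡ K ^ n
length-labellings zero K = refl
length-labellings (suc n) K = trans (length-cartesianProductWith prepend (upTo K) (labellings n K))
  (cong₂ _*_ (length-upTo K) (length-labellings n K))

-- A labelling is found in the list up to pointwise equality; `allowed-cong` carries the statements
-- about it across.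
labellings-complete : ∀ {n K} (χ : Fin n → ℕ) → (∀ v → χ v < K) → ∃[ f ] (f ∈ labellings n K × (∀ v → f v ≡ χ v))
labellings-complete {zero} χ h = (λ ()) , here refl , λ ()
labellings-complete {suc n} χ h with labellings-complete (χ ∘ suc) (h ∘ suc)
... | f , m , e = prepend (χ zero) f , ∈-cartesianProductWith⁺ prepend (∈-upTo⁺ (h zero)) m ,
      λ { zero → refl ; (suc v) → e v }

allowed : ∀ {n} → (Fin n → ℕ) → Pair n → Bool
allowed χ (i , j) = ⌊ χ i ≟ 0 ⌋ ∨ (⌊ χ j ≟ 0 ⌋ ∨ ⌊ χ i ≟ χ j ⌋)

allowed-cong : ∀ {n} {f χ : Fin n → ℕ} → (∀ v → f v ≡ χ v) → ∀ e → allowed f e ≡ allowed χ e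
allowed-cong h (i , j) rewrite h i | h j = refl

-- By rows: a vertex labelled 0 allows at most n pairs, any other vertex those with label 0 and
-- those in its own class.
count-allowed : ∀ {n} (χ : Fin n → ℕ) m → (∀ c → # (λ v → ⌊ χ v ≟ suc c ⌋) ≤ m) →
  cnt (allowed χ) (edges n) ≤ # (λ v → ⌊ χ v ≟ 0 ⌋) * n + n * (# (λ v → ⌊ χ v ≟ 0 ⌋) + m)
count-allowed {n} χ m small = begin
  cnt (allowed χ) (edges n) ≤⟨ cnt-edges n (λ i j → allowed χ (i , j)) ⟩
  Σ[ allFin n ] (λ i → # (λ j → allowed χ (i , j))) ≤⟨ Σ-mono (allFin n) (λ i _ → row i) ⟩
  Σ[ allFin n ] (λ i → bit ⌊ χ i ≟ 0 ⌋ * n + (z + m)) ≡⟨ Σ-+ (allFin n) _ _ ⟩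
  Σ[ allFin n ] (λ i → bit ⌊ χ i ≟ 0 ⌋ * n) + Σ[ allFin n ] (λ _ → z + m)
    ≡⟨ cong₂ _+_ (Σ-*ʳ (allFin n) _ n) (trans (Σ-const (allFin n) (z + m)) (cong (_* (z + m)) (length-tabulate {n = n} id))) ⟩
  z * n + n * (z + m) ∎
  where
  open ≤-Reasoning
  z : ℕ
  z = # (λ v → ⌊ χ v ≟ 0 ⌋)
  row : ∀ i → # (λ j → allowed χ (i , j)) ≤ bit ⌊ χ i ≟ 0 ⌋ * n + (z + m)
  row i with χ i
  ... | zero = ≤-trans (#≤n {n} (λ _ → true)) (≤-trans (≤-reflexive (sym (+-identityʳ n))) (m≤m+n (n + 0) (z + m)))
  ... | suc c = ≤-trans (cnt-∪ (allFin n) {r = λ j → ⌊ χ j ≟ suc c ⌋} f) (+-monoʳ-≤ z (small c))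
    where
    f : ∀ j → ⌊ χ j ≟ 0 ⌋ ∨ ⌊ suc c ≟ χ j ⌋ ≡ true → ⌊ χ j ≟ 0 ⌋ ≡ true ⊎ ⌊ χ j ≟ suc c ⌋ ≡ true
    f j h with ∨-elim {⌊ χ j ≟ 0 ⌋} h
    ... | inj₁ p = inj₁ p
    ... | inj₂ p = inj₂ (dec-intro (χ j ≟ suc c) (sym (dec-true (suc c ≟ χ j) p)))

module _ {n : ℕ} (s : Position n) where

  client-sym : ∀ {u v} → ClientGraph s u v → ClientGraph s v u
  client-sym = swap

  client? : ∀ u v → Dec (ClientGraph s u v)
  client? u v = (toℕ u <? toℕ v ×-dec is-client? (s u v)) ⊎-dec (toℕ v <? toℕ u ×-dec is-client? (s v u))
    where
    is-client? : (o : Owner) → Dec (o ≡ client)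
    is-client? free = no λ ()
    is-client? client = yes refl
    is-client? waiter = no λ ()

module Escape {n : ℕ} (t ρ m K : ℕ) (2≤t : 2 ≤ t) (large-ρ : n < ρ * suc (t * suc ρ))
  (small-s : 4 * (t * (t * suc ρ)) ≤ m) (m≤ : m ≤ 2 * t * n)
  (few : ∀ k → k * m ≤ 2 * t * n → k < K)
  (small-separator : ∀ k → k < K → 2 * (t * (t * suc ρ) * k) ≤ m) where

  -- Restricting to few allowed pairs keeps the initial weights small. The cap `2 * n * m` is what
  -- `count-allowed` gives once label 0 has at most `m` / 2 vertices.
  family : List (Pair n → Bool)
  family = filter (λ p → cnt p (edges n) ≤? 2 * n * m) (map allowed (labellings n K))

  family-small : ∀ p → p ∈ family → cnt p (edges n) ≤ 2 * n * m
  family-small p m∈ = proj₂ (∈-filter⁻ (λ p → cnt p (edges n) ≤? 2 * n * m) {xs = map allowed (labellings n K)} m∈)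

  length-family : length family ≤ K ^ n
  length-family = ≤-trans (length-filter (λ p → cnt p (edges n) ≤? 2 * n * m) (map allowed (labellings n K)))
    (≤-reflexive (trans (length-map allowed (labellings n K)) (length-labellings n K)))

  -- Without the minor the whole vertex set shatters. The resulting labelling belongs to the family,
  -- so Client owns an edge it does not allow, and this contradicts `no-edge`.
  escapes⇒minor : ∀ (s : Position n) →
    (∀ p → p ∈ family → ∃[ e ] (IsEdge e × at s e ≡ client × p e ≡ false)) → HasMinor (ClientGraph s) t
  escapes⇒minor s escape with shatter everything (subst (m ≤_) (cong (2 * t *_) (sym all≡n)) m≤)
    where
    open Shatter (ClientGraph s) (client-sym s) (client? s) t ρ 2≤t large-ρ m small-s
    everything : Sub n
    everything _ = true
    all≡n : # everything ≡ n
    all≡n = trans (cnt-true (allFin n) (λ _ → refl)) (length-tabulate id)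
  ... | inj₁ minor = minor
  ... | inj₂ Sh = ⊥-elim (contradiction-at (escape (allowed f) (∈-filter⁺ (λ p → cnt p (edges n) ≤? 2 * n * m)
          (∈-map⁺ allowed f∈) f-small)))
    where
    open Shatter (ClientGraph s) (client-sym s) (client? s) t ρ 2≤t large-ρ m small-s
    open Shattering Sh renaming (few to few-labels)
    sep : ℕ
    sep = t * (t * suc ρ)
    k<K : k < K
    k<K = few k (≤-trans few-labels (≤-reflexive (cong (2 * t *_) all≡n)))
      where
      all≡n : # {n} (λ _ → true) ≡ n
      all≡n = trans (cnt-true (allFin n) (λ _ → refl)) (length-tabulate id)
    lab : ∃[ f ] (f ∈ labellings n K × (∀ v → f v ≡ χ v))
    lab = labellings-complete χ (λ v → ≤-<-trans (bound v) k<K)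
    f : Fin n → ℕ
    f = proj₁ lab
    f∈ : f ∈ labellings n K
    f∈ = proj₁ (proj₂ lab)
    z : ℕ
    z = # (λ v → ⌊ χ v ≟ 0 ⌋)
    2z≤m : 2 * z ≤ m
    2z≤m = ≤-trans (*-monoʳ-≤ 2 (≤-trans (m≤m+n z sep) separator)) (small-separator k k<K)
    arith : ∀ z n m → z * n + n * (z + m) ≡ n * (2 * z + m)
    arith = solve-∀
    arith₂ : ∀ n m → n * (m + m) ≡ 2 * n * m
    arith₂ = solve-∀
    f-small : cnt (allowed f) (edges n) ≤ 2 * n * m
    f-small = begin
      cnt (allowed f) (edges n) ≡⟨ cnt-cong (edges n) (allowed-cong (proj₂ (proj₂ lab))) ⟩
      cnt (allowed χ) (edges n) ≤⟨ count-allowed χ m classes ⟩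
      z * n + n * (z + m) ≡⟨ arith z n m ⟩
      n * (2 * z + m) ≤⟨ *-monoʳ-≤ n (+-monoˡ-≤ m 2z≤m) ⟩
      n * (m + m) ≡⟨ arith₂ n m ⟩
      2 * n * m ∎
      where open ≤-Reasoning
    contradiction-at : ∃[ e ] (IsEdge e × at s e ≡ client × allowed f e ≡ false) → ⊥
    contradiction-at ((i , j) , ie , c , na) with trans (sym (allowed-cong (proj₂ (proj₂ lab)) (i , j))) na
    ... | na′ = apart (no-edge i j refl refl nz₁ nz₂ (inj₁ (ie , c)))
      where
      nz₁ : χ i ≢ 0
      nz₁ e = true≢false (∨-introˡ (dec-intro (χ i ≟ 0) e)) na′
      nz₂ : χ j ≢ 0
      nz₂ e = true≢false (∨-introʳ {⌊ χ i ≟ 0 ⌋} (∨-introˡ (dec-intro (χ j ≟ 0) e))) na′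
      apart : χ i ≢ χ j
      apart e = true≢false (∨-introʳ {⌊ χ i ≟ 0 ⌋} (∨-introʳ {⌊ χ j ≟ 0 ⌋} (dec-intro (χ i ≟ χ j) e))) na′

  client-minor : ∀ {q} Q L x .{{_ : NonZero Q}} → suc q ≤ Q → (Q + L) ^ Q ≤ suc x * Q ^ Q →
    2 * n * m ≤ length (edges n) →
    K ^ n * ((Q + x) ^ (2 * n * m) * Q ^ (length (edges n) ∸ 2 * n * m)) < (Q + L) ^ length (edges n) →
    ClientBuilds q (λ G → HasMinor G t) (initial n)
  client-minor Q L x q<Q h a≤N small = client-escapes q<Q family (λ G → HasMinor G t) escapes⇒minor
    (≤-<-trans (total-initial (m≤m+n Q x) family (2 * n * m) a≤N family-small)
      (≤-<-trans (*-monoˡ-≤ _ length-family) small))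
    where
    instance
      Z≢0 : NonZero (Q + L)
      Z≢0 = >-nonZero (≤-trans (>-nonZero⁻¹ Q) (m≤m+n Q L))
    open Potential {n} Q (Q + x) Q (Q + L) (key-inequality Q L x h)

edge-minor : ∀ {n} {G : Graph n} u v → u ≢ v → G u v → G v u → HasMinor G 2
edge-minor {n} {G} u v u≢v g g′ = β , surj , conn , adj
  where
  β : Fin n → Maybe (Fin 2)
  β w with w Fin.≟ u | w Fin.≟ v
  ... | yes _ | _ = just zero
  ... | no _ | yes _ = just (suc zero)
  ... | no _ | no _ = nothing
  βu : β u ≡ just zero
  βu with u Fin.≟ u
  ... | yes _ = refl
  ... | no h = ⊥-elim (h refl)
  βv : β v ≡ just (suc zero)
  βv with v Fin.≟ u | v Fin.≟ v
  ... | yes e | _ = ⊥-elim (u≢v (sym e))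
  ... | no _ | yes _ = refl
  ... | no _ | no h = ⊥-elim (h refl)
  surj : ∀ i → ∃[ w ] β w ≡ just i
  surj zero = u , βu
  surj (suc zero) = v , βv
  only : ∀ i w → β w ≡ just i → w ≡ proj₁ (surj i)
  only i w e with w Fin.≟ u | w Fin.≟ v
  only zero w e | yes p | _ = p
  only (suc zero) w () | yes p | _
  only zero w () | no _ | yes p
  only (suc zero) w e | no _ | yes p = p
  only _ w () | no _ | no _
  conn : ∀ i a b → β a ≡ just i → β b ≡ just i → PathIn G (λ w → β w ≡ just i) a b
  conn i a b ea eb with trans (only i a ea) (sym (only i b eb))
  ... | refl = here
  adj : ∀ i j → i ≢ j → ∃[ a ] ∃[ b ] (β a ≡ just i × β b ≡ just j × G a b)
  adj zero zero h = ⊥-elim (h refl)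
  adj zero (suc zero) _ = u , v , βu , βv , g
  adj (suc zero) zero _ = v , u , βv , βu , g′
  adj (suc zero) (suc zero) h = ⊥-elim (h refl)

edges-nonempty : ∀ n → 2 ≤ n → NonZero (length (edges n))
edges-nonempty (suc zero) (s≤s ())
edges-nonempty (suc (suc n)) _ = _

client-edge : ∀ n q → 2 ≤ n → ClientBuilds q (λ G → HasMinor G 2) (initial n)
client-edge n q 2≤n = client-escapes ≤-refl ((λ _ → false) ∷ []) (λ G → HasMinor G 2) goal
    (≤-<-trans (≤-reflexive (trans (+-identityʳ _) (Π-const (edges n) (suc q)))) (^-monoˡ-< (length (edges n)) (m<m+n (suc q) (s≤s z≤n))))
  where
  -- The family consists of the empty set of pairs, so its weight starts at W^N < Z^N. The huge `x`
  -- makes the chord hypothesis immediate.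
  open Potential {n} (suc q) (suc q + (suc q + 1) ^ suc q) (suc q) (suc q + 1)
    (key-inequality (suc q) 1 ((suc q + 1) ^ suc q)
      (≤-trans (n≤1+n _) (m≤m*n (suc ((suc q + 1) ^ suc q)) (suc q ^ suc q) {{m^n≢0 (suc q) (suc q)}})))
  goal : ∀ s → (∀ p → p ∈ (λ _ → false) ∷ [] → Escapes p s) → HasMinor (ClientGraph s) 2
  goal s escape with escape _ (here refl)
  ... | (u , v) , ie , c , _ = edge-minor u v (λ { refl → <-irrefl refl ie }) (inj₁ (ie , c)) (inj₂ (ie , c))
  instance
    N≢0 : NonZero (length (edges n))
    N≢0 = edges-nonempty n 2≤n

-- Choice of the parameters

n<2^n : ∀ n → n < 2 ^ n
n<2^n zero = s≤s z≤n
n<2^n (suc n) = begin-strict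
  suc n <⟨ s≤s (n<2^n n) ⟩
  1 + 2 ^ n ≤⟨ +-monoˡ-≤ (2 ^ n) (m^n>0 2 n) ⟩
  2 ^ n + 2 ^ n ≡⟨ cong (2 ^ n +_) (sym (+-identityʳ (2 ^ n))) ⟩
  2 ^ suc n ∎
  where open ≤-Reasoning

-- With x about (1 + 2g/Q)^Q, the shattered pieces have at most 16m = 8Q/x vertices.
module BigMinor (n q Q e g τ : ℕ) (q<Q : suc q ≤ Q) (n≤4Q : n ≤ 4 * Q)
  (rounds : 2 * (Q * (n + e)) + n ≤ n * n) (e≤n : e ≤ n) (1≤τ : 1 ≤ τ)
  (excess : (34 + τ) * n < g * e) (n-lower : 2 ^ (64 * g) ≤ n) (n-upper : n < 2 ^ (64 * g + 64)) where
  open ≤-Reasoning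

  n≥1 : 1 ≤ n
  n≥1 = ≤-trans (m^n>0 2 (64 * g)) n-lower

  g-large : 34 + τ < g
  g-large = *-cancelʳ-< n (34 + τ) g (≤-trans excess (*-monoʳ-≤ g e≤n))

  5≤g : 5 ≤ g
  5≤g = ≤-trans (≤-trans (m≤m+n 5 (30 + τ)) ≤-refl) g-large

  instance
    n≢0 : NonZero n
    n≢0 = >-nonZero n≥1
    g≢0 : NonZero g
    g≢0 = >-nonZero (≤-trans (s≤s z≤n) g-large)
    2g≢0 : NonZero (2 * g)
    2g≢0 = m*n≢0 2 g
    Q≢0 : NonZero Q
    Q≢0 = >-nonZero (≤-trans (s≤s z≤n) q<Q)
    Q^Q≢0 : NonZero (Q ^ Q)
    Q^Q≢0 = m^n≢0 Q Q

  4g≤Q : 4 * g ≤ Q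
  4g≤Q = *-cancelˡ-≤ 4 (begin
    4 * (4 * g) ≡⟨ *-assoc 4 4 g ⟨
    16 * g ≤⟨ *-monoˡ-≤ g (m≤m+n 16 48) ⟩
    64 * g ≤⟨ <⇒≤ (n<2^n (64 * g)) ⟩
    2 ^ (64 * g) ≤⟨ n-lower ⟩
    n ≤⟨ n≤4Q ⟩
    4 * Q ∎)

  2Q≤n : 2 * Q ≤ n
  2Q≤n = *-cancelʳ-≤ (2 * Q) n n (begin
    2 * Q * n ≡⟨ *-assoc 2 Q n ⟩
    2 * (Q * n) ≤⟨ *-monoʳ-≤ 2 (*-monoʳ-≤ Q (m≤m+n n e)) ⟩
    2 * (Q * (n + e)) ≤⟨ m≤m+n _ n ⟩
    2 * (Q * (n + e)) + n ≤⟨ rounds ⟩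
    n * n ∎)

  t x ρ : ℕ
  t = 2 ^ τ
  -- The integer part serves both sides: `x` bounds the gain of a block of `Q` edges from below, and
  -- `suc x` satisfies the chord hypothesis.
  x = (Q + 2 * g) ^ Q / Q ^ Q
  -- Of order √n, chosen so that ρ² > n.
  ρ = 2 ^ (32 * g + 32)

  x-below : x * Q ^ Q ≤ (Q + 2 * g) ^ Q
  x-below = m/n*n≤m ((Q + 2 * g) ^ Q) (Q ^ Q)

  x-above : (Q + 2 * g) ^ Q ≤ suc x * Q ^ Q
  x-above = <⇒≤ (m<[1+m/n]*n ((Q + 2 * g) ^ Q) (Q ^ Q))

  x-lower : 2 ^ g ≤ x
  x-lower = ≤-pred (*-cancelʳ-< (Q ^ Q) (2 ^ g) (suc x)
    (≤-<-trans (power-lower Q g 4g≤Q) (m<[1+m/n]*n ((Q + 2 * g) ^ Q) (Q ^ Q))))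

  x-upper : x ≤ 2 ^ (8 * g)
  x-upper = *-cancelʳ-≤ x (2 ^ (8 * g)) (Q ^ Q) (begin
    x * Q ^ Q ≤⟨ x-below ⟩
    (Q + 2 * g) ^ Q ≤⟨ power-upper Q (2 * g) (≤-trans (≤-reflexive (sym (*-assoc 2 2 g))) 4g≤Q) ⟩
    2 ^ (4 * (2 * g)) * Q ^ Q ≡⟨ cong (λ z → 2 ^ z * Q ^ Q) (sym (*-assoc 4 2 g)) ⟩
    2 ^ (8 * g) * Q ^ Q ∎)

  32≤x : 32 ≤ x
  32≤x = ≤-trans (^-monoʳ-≤ 2 5≤g) x-lower

  1≤x : 1 ≤ x
  1≤x = ≤-trans (s≤s z≤n) 32≤x

  2≤t : 2 ≤ t
  2≤t = ^-monoʳ-≤ 2 1≤τ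

  instance
    x≢0 : NonZero x
    x≢0 = >-nonZero 1≤x
    2x≢0 : NonZero (2 * x)
    2x≢0 = m*n≢0 2 x
    t≢0 : NonZero t
    t≢0 = m^n≢0 2 τ

  s : ℕ
  s = t * (t * suc ρ)

  -- Of the `64 * g` bits of n, `ρ` takes `32 * g` and x² takes `16 * g`. The remaining `16 * g`
  -- hold t³ and the constants because g > 34 + τ.
  s-small : 4 * s * (t * x) * x ≤ n
  s-small = begin
    4 * s * (t * x) * x ≤⟨ *-monoˡ-≤ x (*-monoˡ-≤ (t * x) (*-monoʳ-≤ 4 (*-monoʳ-≤ t (*-monoʳ-≤ t (+-monoˡ-≤ ρ (m^n>0 2 (32 * g + 32))))))) ⟩
    4 * (t * (t * (ρ + ρ))) * (t * x) * x ≡⟨ e₁ t ρ x ⟩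
    8 * ((t * (t * t)) * (ρ * (x * x))) ≤⟨ *-monoʳ-≤ 8 (*-monoʳ-≤ (t * (t * t)) (*-monoʳ-≤ ρ (*-mono-≤ x-upper x-upper))) ⟩
    2 ^ 3 * ((t * (t * t)) * (ρ * (2 ^ (8 * g) * 2 ^ (8 * g))))
      ≡⟨ cong (2 ^ 3 *_) (cong₂ _*_ (trans (cong (t *_) (pow τ τ)) (pow τ (τ + τ)))
           (trans (cong (ρ *_) (pow (8 * g) (8 * g))) (pow (32 * g + 32) (8 * g + 8 * g)))) ⟩
    2 ^ 3 * (2 ^ (τ + (τ + τ)) * 2 ^ ((32 * g + 32) + (8 * g + 8 * g)))
      ≡⟨ trans (cong (2 ^ 3 *_) (pow (τ + (τ + τ)) ((32 * g + 32) + (8 * g + 8 * g)))) (pow 3 ((τ + (τ + τ)) + ((32 * g + 32) + (8 * g + 8 * g)))) ⟩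
    2 ^ (3 + ((τ + (τ + τ)) + ((32 * g + 32) + (8 * g + 8 * g)))) ≤⟨ ^-monoʳ-≤ 2 exponent ⟩
    2 ^ (64 * g) ≤⟨ n-lower ⟩
    n ∎
    where
    e₁ : ∀ t r x → 4 * (t * (t * (r + r))) * (t * x) * x ≡ 8 * ((t * (t * t)) * (r * (x * x)))
    e₁ = solve-∀
    pow : ∀ a b → 2 ^ a * 2 ^ b ≡ 2 ^ (a + b)
    pow a b = sym (^-distribˡ-+-* 2 a b)
    e₂ : ∀ τ g → 3 + ((τ + (τ + τ)) + ((32 * g + 32) + (8 * g + 8 * g))) ≡ 48 * g + (3 * τ + 35)
    e₂ = solve-∀
    e₃ : ∀ τ → 3 * τ + 35 + (13 * τ + 525) ≡ 16 * (35 + τ)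
    e₃ = solve-∀
    e₄ : ∀ g → 48 * g + 16 * g ≡ 64 * g
    e₄ = solve-∀
    exponent : 3 + ((τ + (τ + τ)) + ((32 * g + 32) + (8 * g + 8 * g))) ≤ 64 * g
    exponent = begin
      3 + ((τ + (τ + τ)) + ((32 * g + 32) + (8 * g + 8 * g))) ≡⟨ e₂ τ g ⟩
      48 * g + (3 * τ + 35) ≤⟨ +-monoʳ-≤ (48 * g) (≤-trans (m≤m+n _ (13 * τ + 525)) (≤-reflexive (e₃ τ))) ⟩
      48 * g + 16 * (35 + τ) ≤⟨ +-monoʳ-≤ (48 * g) (*-monoʳ-≤ 16 g-large) ⟩
      48 * g + 16 * g ≡⟨ e₄ g ⟩
      64 * g ∎

  m : ℕ
  m = Q / (2 * x)

  m-below : 2 * (m * x) ≤ Q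
  m-below = ≤-trans (≤-reflexive (e₁ m x)) (m/n*n≤m Q (2 * x))
    where
    e₁ : ∀ m x → 2 * (m * x) ≡ m * (2 * x)
    e₁ = solve-∀

  8x≤n : 8 * x ≤ n
  8x≤n = begin
    8 * x ≤⟨ *-monoˡ-≤ x (*-monoʳ-≤ 4 (≤-trans 2≤t (m≤m*n t x))) ⟩
    4 * (t * x) * x ≤⟨ *-monoˡ-≤ x (*-monoˡ-≤ (t * x) (*-monoʳ-≤ 4 1≤s)) ⟩
    4 * s * (t * x) * x ≤⟨ s-small ⟩
    n ∎
    where
    1≤s : 1 ≤ s
    1≤s = *-mono-≤ (m^n>0 2 τ) (*-mono-≤ (m^n>0 2 τ) (s≤s (z≤n {ρ})))

  1≤m : 1 ≤ m
  1≤m = ≤-pred (*-cancelʳ-< (2 * x) 1 (suc m) (≤-<-trans (*-cancelˡ-≤ 4 (begin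
    4 * (1 * (2 * x)) ≡⟨ e₁ x ⟩
    8 * x ≤⟨ 8x≤n ⟩
    n ≤⟨ n≤4Q ⟩
    4 * Q ∎)) (m<[1+m/n]*n Q (2 * x))))
    where
    e₁ : ∀ x → 4 * (1 * (2 * x)) ≡ 8 * x
    e₁ = solve-∀

  n≤16mx : n ≤ x * (16 * m)
  n≤16mx = begin
    n ≤⟨ n≤4Q ⟩
    4 * Q ≤⟨ *-monoʳ-≤ 4 (<⇒≤ (m<[1+m/n]*n Q (2 * x))) ⟩
    4 * ((1 + m) * (2 * x)) ≤⟨ *-monoʳ-≤ 4 (*-monoˡ-≤ (2 * x) (+-monoˡ-≤ m 1≤m)) ⟩
    4 * ((m + m) * (2 * x)) ≡⟨ e₁ m x ⟩
    x * (16 * m) ∎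
    where
    e₁ : ∀ m x → 4 * ((m + m) * (2 * x)) ≡ x * (16 * m)
    e₁ = solve-∀

  stx≤m : 4 * s * (t * x) ≤ 16 * m
  stx≤m = *-cancelˡ-≤ x (≤-trans (≤-reflexive (*-comm x _)) (≤-trans s-small n≤16mx))

  small-s : 4 * s ≤ 16 * m
  small-s = ≤-trans (m≤m*n (4 * s) (t * x) {{m*n≢0 t x}}) stx≤m

  large-ρ : n < ρ * suc (t * suc ρ)
  large-ρ = begin-strict
    n <⟨ n-upper ⟩
    2 ^ (64 * g + 64) ≡⟨ cong (2 ^_) (e₁ g) ⟩
    2 ^ ((32 * g + 32) + (32 * g + 32)) ≡⟨ ^-distribˡ-+-* 2 (32 * g + 32) (32 * g + 32) ⟩
    ρ * ρ ≤⟨ *-monoʳ-≤ ρ (≤-trans (n≤1+n ρ) (≤-trans (m≤n*m (suc ρ) t) (n≤1+n _))) ⟩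
    ρ * suc (t * suc ρ) ∎
    where
    e₁ : ∀ g → 64 * g + 64 ≡ (32 * g + 32) + (32 * g + 32)
    e₁ = solve-∀

  16m≤n : 16 * m ≤ n
  16m≤n = begin
    16 * m ≡⟨ e₁ m ⟩
    m * 16 ≤⟨ *-monoʳ-≤ m (≤-trans (m≤m+n 16 16) 32≤x) ⟩
    m * x ≤⟨ m≤n*m (m * x) 2 ⟩
    2 * (m * x) ≤⟨ m-below ⟩
    Q ≤⟨ m≤n*m Q 2 ⟩
    2 * Q ≤⟨ 2Q≤n ⟩
    n ∎
    where
    e₁ : ∀ m → 16 * m ≡ m * 16
    e₁ = solve-∀

  K : ℕ
  -- Each piece accounts for a share 16m/(2t) of n ≤ 16mx, so there are at most 2tx pieces, and
  -- label 0 is one more.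
  K = suc (2 * t * x)

  few : ∀ k → k * (16 * m) ≤ 2 * t * n → k < K
  few k h = s≤s (*-cancelʳ-≤ k (2 * t * x) (16 * m) {{m*n≢0 16 m {{_}} {{>-nonZero 1≤m}}}} (begin
    k * (16 * m) ≤⟨ h ⟩
    2 * t * n ≤⟨ *-monoʳ-≤ (2 * t) n≤16mx ⟩
    2 * t * (x * (16 * m)) ≡⟨ *-assoc (2 * t) x _ ⟨
    2 * t * x * (16 * m) ∎))

  small-separator : ∀ k → k < K → 2 * (s * k) ≤ 16 * m
  small-separator k (s≤s k≤) = begin
    2 * (s * k) ≤⟨ *-monoʳ-≤ 2 (*-monoʳ-≤ s k≤) ⟩
    2 * (s * (2 * t * x)) ≡⟨ e₁ s t x ⟩
    4 * s * (t * x) ≤⟨ stx≤m ⟩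
    16 * m ∎
    where
    e₁ : ∀ s t x → 2 * (s * (2 * t * x)) ≡ 4 * s * (t * x)
    e₁ = solve-∀

  N a : ℕ
  N = length (edges n)
  a = 2 * n * (16 * m)

  many-rounds : Q * (n + e) ≤ N
  many-rounds = *-cancelˡ-≤ 2 (+-cancelʳ-≤ n _ _ (≤-trans rounds (≤-reflexive (sym (length-edges n)))))

  a≤N : a ≤ N
  a≤N = begin
    2 * n * (16 * m) ≡⟨ e₁ n m ⟩
    n * (m * 32) ≤⟨ *-monoʳ-≤ n (*-monoʳ-≤ m 32≤x) ⟩
    n * (m * x) ≤⟨ *-monoʳ-≤ n (≤-trans (m≤n*m (m * x) 2) m-below) ⟩
    n * Q ≡⟨ *-comm n Q ⟩
    Q * n ≤⟨ *-monoʳ-≤ Q (m≤m+n n e) ⟩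
    Q * (n + e) ≤⟨ many-rounds ⟩
    N ∎
    where
    e₁ : ∀ n m → 2 * n * (16 * m) ≡ n * (m * 32)
    e₁ = solve-∀

  -- The entropy balance. Here K ≤ 4tx, and 2^(32n) is the price of the allowed pairs. After
  -- cancelling x^n, the rest is 2^((34 + τ)n), which `excess` bounds by (2^g)^e ≤ x^e.
  labels : K ^ n * 2 ^ (32 * n) < x ^ (n + e)
  labels = begin-strict
    K ^ n * 2 ^ (32 * n) ≤⟨ *-monoˡ-≤ (2 ^ (32 * n)) (^-monoˡ-≤ n K≤) ⟩
    (2 ^ (2 + τ) * x) ^ n * 2 ^ (32 * n) ≡⟨ cong (_* 2 ^ (32 * n)) (^-distrib-* (2 ^ (2 + τ)) x n) ⟩
    (2 ^ (2 + τ)) ^ n * x ^ n * 2 ^ (32 * n) ≡⟨ cong (λ z → z * x ^ n * 2 ^ (32 * n)) (^-*-assoc 2 (2 + τ) n) ⟩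
    2 ^ ((2 + τ) * n) * x ^ n * 2 ^ (32 * n) ≡⟨ e₁ (2 ^ ((2 + τ) * n)) (x ^ n) (2 ^ (32 * n)) ⟩
    x ^ n * (2 ^ ((2 + τ) * n) * 2 ^ (32 * n)) ≡⟨ cong (x ^ n *_) (sym (^-distribˡ-+-* 2 ((2 + τ) * n) (32 * n))) ⟩
    x ^ n * 2 ^ ((2 + τ) * n + 32 * n) ≡⟨ cong (λ z → x ^ n * 2 ^ z) (e₂ τ n) ⟩
    x ^ n * 2 ^ ((34 + τ) * n) <⟨ *-monoʳ-< (x ^ n) {{m^n≢0 x n}} (^-monoʳ-< 2 (s≤s (s≤s z≤n)) excess) ⟩
    x ^ n * 2 ^ (g * e) ≡⟨ cong (x ^ n *_) (sym (^-*-assoc 2 g e)) ⟩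
    x ^ n * (2 ^ g) ^ e ≤⟨ *-monoʳ-≤ (x ^ n) (^-monoˡ-≤ e x-lower) ⟩
    x ^ n * x ^ e ≡⟨ ^-distribˡ-+-* x n e ⟨
    x ^ (n + e) ∎
    where
    e₁ : ∀ a b c → a * b * c ≡ b * (a * c)
    e₁ = solve-∀
    e₂ : ∀ τ n → (2 + τ) * n + 32 * n ≡ (34 + τ) * n
    e₂ = solve-∀
    e₃ : ∀ T x → 2 * T * x + 2 * T * x ≡ 2 * (2 * T) * x
    e₃ = solve-∀
    K≤ : K ≤ 2 ^ (2 + τ) * x
    K≤ = begin
      1 + 2 * t * x ≤⟨ +-monoˡ-≤ (2 * t * x) (*-mono-≤ (*-mono-≤ (s≤s (z≤n {1})) (m^n>0 2 τ)) 1≤x) ⟩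
      2 * t * x + 2 * t * x ≡⟨ e₃ t x ⟩
      2 ^ (2 + τ) * x ∎

  gain : x ^ (n + e) * Q ^ N ≤ (Q + 2 * g) ^ N
  gain = begin
    x ^ (n + e) * Q ^ N ≡⟨ cong (λ z → x ^ (n + e) * Q ^ z) (sym (m+[n∸m]≡n many-rounds)) ⟩
    x ^ (n + e) * Q ^ (D + (N ∸ D)) ≡⟨ cong (x ^ (n + e) *_) (^-distribˡ-+-* Q D (N ∸ D)) ⟩
    x ^ (n + e) * (Q ^ D * Q ^ (N ∸ D)) ≡⟨ *-assoc (x ^ (n + e)) _ _ ⟨
    x ^ (n + e) * Q ^ D * Q ^ (N ∸ D) ≡⟨ cong (λ z → x ^ (n + e) * z * Q ^ (N ∸ D)) (sym (^-*-assoc Q Q (n + e))) ⟩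
    x ^ (n + e) * (Q ^ Q) ^ (n + e) * Q ^ (N ∸ D) ≡⟨ cong (_* Q ^ (N ∸ D)) (sym (^-distrib-* x (Q ^ Q) (n + e))) ⟩
    (x * Q ^ Q) ^ (n + e) * Q ^ (N ∸ D) ≤⟨ *-mono-≤ (^-monoˡ-≤ (n + e) x-below) (^-monoˡ-≤ (N ∸ D) (m≤m+n Q (2 * g))) ⟩
    ((Q + 2 * g) ^ Q) ^ (n + e) * (Q + 2 * g) ^ (N ∸ D) ≡⟨ cong (_* (Q + 2 * g) ^ (N ∸ D)) (^-*-assoc (Q + 2 * g) Q (n + e)) ⟩
    (Q + 2 * g) ^ D * (Q + 2 * g) ^ (N ∸ D) ≡⟨ ^-distribˡ-+-* (Q + 2 * g) D (N ∸ D) ⟨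
    (Q + 2 * g) ^ (D + (N ∸ D)) ≡⟨ cong ((Q + 2 * g) ^_) (m+[n∸m]≡n many-rounds) ⟩
    (Q + 2 * g) ^ N ∎
    where
    D : ℕ
    D = Q * (n + e)

  potential-small : K ^ n * ((Q + x) ^ a * Q ^ (N ∸ a)) < (Q + 2 * g) ^ N
  potential-small = begin-strict
    K ^ n * ((Q + x) ^ a * Q ^ (N ∸ a))
      -- The `a` allowed pairs form `32 * n` blocks of length `m`, and `m` is small enough for (1 +
      -- x/Q)^m ≤ 2.
      ≤⟨ *-monoʳ-≤ (K ^ n) (*-monoˡ-≤ (Q ^ (N ∸ a)) (power-≤ Q x m (32 * n) a (power-at-most-double Q x m m-below) (≤-reflexive (e₁ n m)))) ⟩
    K ^ n * (2 ^ (32 * n) * Q ^ a * Q ^ (N ∸ a)) ≡⟨ e₂ (K ^ n) (2 ^ (32 * n)) (Q ^ a) (Q ^ (N ∸ a)) ⟩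
    K ^ n * 2 ^ (32 * n) * (Q ^ a * Q ^ (N ∸ a)) ≡⟨ cong (K ^ n * 2 ^ (32 * n) *_) (sym (^-distribˡ-+-* Q a (N ∸ a))) ⟩
    K ^ n * 2 ^ (32 * n) * Q ^ (a + (N ∸ a)) ≡⟨ cong (λ z → K ^ n * 2 ^ (32 * n) * Q ^ z) (m+[n∸m]≡n a≤N) ⟩
    K ^ n * 2 ^ (32 * n) * Q ^ N <⟨ *-monoˡ-< (Q ^ N) {{m^n≢0 Q N}} labels ⟩
    x ^ (n + e) * Q ^ N ≤⟨ gain ⟩
    (Q + 2 * g) ^ N ∎
    where
    e₁ : ∀ n m → 2 * n * (16 * m) ≡ m * (32 * n)
    e₁ = solve-∀
    e₂ : ∀ a b c d → a * (b * c * d) ≡ a * b * (c * d)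
    e₂ = solve-∀

  client-builds : ClientBuilds q (λ G → HasMinor G t) (initial n)
  client-builds = client-minor Q (2 * g) x q<Q x-above a≤N potential-small
    where open Escape {n} t ρ (16 * m) K 2≤t large-ρ small-s
                 (≤-trans 16m≤n (m≤n*m n (2 * t) {{m*n≢0 2 t}})) few small-separator

client-builds-map : ∀ {n q} {P P′ : Graph n → Set} → (∀ {G} → P G → P′ G) →
  ∀ {s} → ClientBuilds q P s → ClientBuilds q P′ s
client-builds-map f (finished c p) = finished c (f p)
client-builds-map f (chooseMove ¬c choose) = chooseMove ¬c λ offer valid →
  let e , m , next = choose offer valid in e , m , client-builds-map f next

floor-log₂ : ∀ n → 1 ≤ n → ∃[ b ] (2 ^ b ≤ n × n < 2 ^ suc b)
floor-log₂ (suc zero) _ = 0 , s≤s z≤n , s≤s (s≤s z≤n)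
floor-log₂ (suc (suc n)) _ with floor-log₂ (suc n) (s≤s z≤n)
... | b , lo , hi with suc (suc n) <? 2 ^ suc b
...   | yes h = b , m≤n⇒m≤1+n lo , h
...   | no h = suc b , ≮⇒≥ h , (begin-strict
        suc (suc n) ≤⟨ hi ⟩
        2 ^ suc b <⟨ ^-monoʳ-< 2 (s≤s (s≤s z≤n)) (n<1+n (suc b)) ⟩
        2 ^ suc (suc b) ∎)
  where open ≤-Reasoning

-- Writing e as 3 plus a natural number gives the difference of the two sides, the polynomial
-- `slack`, nonnegative coefficients only.
enough-rounds : ∀ {n e} r y → n ≡ r + (e + y) * 2 → 3 ≤ e → 2 * (suc y * (n + e)) + n ≤ n * n
enough-rounds {e = suc (suc (suc e))} r y refl _ = ≤-trans (m≤m+n _ slack) (≤-reflexive (lem e y r))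
  where
  slack : ℕ
  slack = 4 * e * e + 16 * e + 12 + 2 * e * y + r * r + 9 * r + 4 * e * r + 2 * y * r
  lem : ∀ e y r → 2 * (suc y * ((r + ((3 + e) + y) * 2) + (3 + e))) + (r + ((3 + e) + y) * 2)
      + (4 * e * e + 16 * e + 12 + 2 * e * y + r * r + 9 * r + 4 * e * r + 2 * y * r)
    ≡ (r + ((3 + e) + y) * 2) * (r + ((3 + e) + y) * 2)
  lem = solve-∀
enough-rounds {e = suc zero} _ _ _ (s≤s ())
enough-rounds {e = suc (suc zero)} _ _ _ (s≤s (s≤s ()))

module LongGame (κ n q p d b : ℕ) {{_ : NonZero d}} (κ-large : 36 * (128 * 4) ≤ κ) (bias : 2 * (q * d) + 2 * (p * n) ≤ n * d)
  (n-lower : 2 ^ b ≤ n) (n-upper : n < 2 ^ suc b) (long : κ * d < suc b * p) where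
  open ≤-Reasoning

  instance
    2d≢0 : NonZero (2 * d)
    2d≢0 = m*n≢0 2 d
    κ≢0 : NonZero κ
    κ≢0 = >-nonZero (≤-trans (s≤s z≤n) κ-large)
    κd≢0 : NonZero (κ * d)
    κd≢0 = m*n≢0 κ d
    n≢0 : NonZero n
    n≢0 = >-nonZero (≤-trans (m^n>0 2 b) n-lower)

  e h y τ g : ℕ
  e = p * n / (2 * d)
  h = n / 2
  -- `Q` will be `suc y`, about (1 - ε)n/2, which can be larger than `suc q`. This keeps `Q` of
  -- order n even for small `q` and still leaves room for n + e rounds.
  y = h ∸ e
  τ = suc (suc b * p / (κ * d))
  g = b / 64

  e-below : 2 * (e * d) ≤ p * n
  e-below = ≤-trans (≤-reflexive (lem e d)) (m/n*n≤m (p * n) (2 * d))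
    where
    lem : ∀ e d → 2 * (e * d) ≡ e * (2 * d)
    lem = solve-∀

  e-above : p * n < suc e * (2 * d)
  e-above = m<[1+m/n]*n (p * n) (2 * d)

  q+2e≤h : q + 2 * e ≤ h
  q+2e≤h = ≤-pred (*-cancelʳ-< 2 _ _ (≤-<-trans (*-cancelʳ-≤ ((q + 2 * e) * 2) n d (begin
    (q + 2 * e) * 2 * d ≡⟨ lem q e d ⟩
    2 * (q * d) + 2 * (2 * (e * d)) ≤⟨ +-monoʳ-≤ (2 * (q * d)) (*-monoʳ-≤ 2 e-below) ⟩
    2 * (q * d) + 2 * (p * n) ≤⟨ bias ⟩
    n * d ∎)) (m<[1+m/n]*n n 2)))
    where
    lem : ∀ q e d → (q + 2 * e) * 2 * d ≡ 2 * (q * d) + 2 * (2 * (e * d))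
    lem = solve-∀

  2e≤h : 2 * e ≤ h
  2e≤h = ≤-trans (m≤n+m (2 * e) q) q+2e≤h

  h≡ : e + y ≡ h
  h≡ = m+[n∸m]≡n (≤-trans (m≤n*m e 2) 2e≤h)

  e≤y : e ≤ y
  e≤y = +-cancelˡ-≤ e e y (≤-trans (≤-reflexive (cong (e +_) (sym (+-identityʳ e)))) (≤-trans 2e≤h (≤-reflexive (sym h≡))))

  e≤n : e ≤ n
  e≤n = ≤-trans (m≤n*m e 2) (≤-trans 2e≤h (≤-trans (m≤m*n h 2) (m/n*n≤m n 2)))

  parity : ℕ
  parity = n % 2

  n≡ : n ≡ parity + (e + y) * 2
  n≡ = trans (m≡m%n+[m/n]*n n 2) (cong (λ z → parity + z * 2) (sym h≡))

  suc-b≤n : suc b ≤ n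
  suc-b≤n = ≤-trans (n<2^n b) n-lower

  κd<pn : κ * d < p * n
  κd<pn = begin-strict
    κ * d <⟨ long ⟩
    suc b * p ≤⟨ *-monoˡ-≤ p suc-b≤n ⟩
    n * p ≡⟨ *-comm n p ⟩
    p * n ∎

  3≤e : 3 ≤ e
  3≤e = ≤-pred (*-cancelʳ-< (2 * d) 3 (suc e) (begin-strict
    3 * (2 * d) ≡⟨ *-assoc 3 2 d ⟨
    6 * d ≤⟨ *-monoˡ-≤ d {6} {κ} (≤-trans (m≤m+n 6 18426) κ-large) ⟩
    κ * d <⟨ κd<pn ⟩
    p * n <⟨ e-above ⟩
    suc e * (2 * d) ∎))

  rounds : 2 * (suc y * (n + e)) + n ≤ n * n
  rounds = enough-rounds parity y n≡ 3≤e

  q<Q : suc q ≤ suc y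
  q<Q = s≤s (+-cancelˡ-≤ e q y (begin
    e + q ≤⟨ +-monoˡ-≤ q (m≤n*m e 2) ⟩
    2 * e + q ≡⟨ +-comm (2 * e) q ⟩
    q + 2 * e ≤⟨ q+2e≤h ⟩
    h ≡⟨ h≡ ⟨
    e + y ∎))

  n≤4Q : n ≤ 4 * suc y
  n≤4Q = begin
    n ≡⟨ n≡ ⟩
    parity + (e + y) * 2 ≤⟨ +-mono-≤ (≤-trans (<⇒≤ (m%n<n n 2)) (m≤m+n 2 2)) (*-monoˡ-≤ 2 (+-monoˡ-≤ y e≤y)) ⟩
    4 + (y + y) * 2 ≡⟨ lem y ⟩
    4 * suc y ∎
    where
    lem : ∀ y → 4 + (y + y) * 2 ≡ 4 * suc y
    lem = solve-∀

  g-below : 64 * g ≤ b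
  g-below = ≤-trans (≤-reflexive (*-comm 64 g)) (m/n*n≤m b 64)

  g-above : suc b ≤ 64 * g + 64
  g-above = ≤-trans (m<[1+m/n]*n b 64) (≤-reflexive (lem g))
    where
    lem : ∀ g → suc g * 64 ≡ 64 * g + 64
    lem = solve-∀

  2p≤d : 2 * p ≤ d
  2p≤d = *-cancelʳ-≤ (2 * p) d n (begin
    2 * p * n ≡⟨ *-assoc 2 p n ⟩
    2 * (p * n) ≤⟨ m≤n+m _ (2 * (q * d)) ⟩
    2 * (q * d) + 2 * (p * n) ≤⟨ bias ⟩
    n * d ≡⟨ *-comm n d ⟩
    d * n ∎)

  1≤g : 1 ≤ g
  1≤g = *-cancelˡ-< 64 0 g (+-cancelʳ-< 64 0 (64 * g) (≤-trans 64<suc-b g-above))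
    where
    64<suc-b : 64 < suc b
    64<suc-b = *-cancelʳ-< d 64 (suc b) (begin-strict
      64 * d ≤⟨ *-monoˡ-≤ d {64} {κ} (≤-trans (m≤m+n 64 18368) κ-large) ⟩
      κ * d <⟨ long ⟩
      suc b * p ≤⟨ *-monoʳ-≤ (suc b) (≤-trans (m≤n*m p 2) 2p≤d) ⟩
      suc b * d ∎)

  τ-large : suc b * p ≤ τ * (κ * d)
  τ-large = <⇒≤ (m<[1+m/n]*n (suc b * p) (κ * d))

  -- Origin of 36 · 128 · 4: `34 + τ` is 35 plus a quotient, and both parts are measured by
  -- `suc b * p`, 36 times in all. Further, `suc b` is at most `128 * g`, and p · n < 2d(e + 1) ≤
  -- 4de.
  excess : (34 + τ) * n < g * e
  excess = *-cancelʳ-< (κ * d) _ _ (begin-strict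
    (34 + τ) * n * (κ * d) ≡⟨ e₁ (suc b * p / (κ * d)) n (κ * d) ⟩
    n * (35 * (κ * d) + suc b * p / (κ * d) * (κ * d))
      ≤⟨ *-monoʳ-≤ n (+-mono-≤ (*-monoʳ-≤ 35 (<⇒≤ long)) (m/n*n≤m (suc b * p) (κ * d))) ⟩
    n * (35 * (suc b * p) + suc b * p) ≡⟨ e₂ n (suc b) p ⟩
    36 * (suc b * (p * n)) <⟨ *-monoʳ-< 36 (*-monoʳ-< (suc b) e-above) ⟩
    36 * (suc b * (suc e * (2 * d)))
      ≤⟨ *-monoʳ-≤ 36 (*-mono-≤ suc-b≤128g (*-monoˡ-≤ (2 * d) suc-e≤2e)) ⟩
    36 * (128 * g * (2 * e * (2 * d))) ≡⟨ e₃ 36 128 g e d ⟩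
    36 * (128 * 4) * (g * e * d) ≤⟨ *-monoˡ-≤ (g * e * d) {36 * (128 * 4)} {κ} κ-large ⟩
    κ * (g * e * d) ≡⟨ e₄ κ (g * e) d ⟩
    g * e * (κ * d) ∎)
    where
    suc-b≤128g : suc b ≤ 128 * g
    suc-b≤128g = ≤-trans g-above (≤-trans (+-monoʳ-≤ (64 * g) (≤-trans (≤-reflexive (sym (*-identityʳ 64))) (*-monoʳ-≤ 64 1≤g)))
      (≤-reflexive (lem g)))
      where
      lem : ∀ g → 64 * g + 64 * g ≡ 128 * g
      lem = solve-∀
    suc-e≤2e : suc e ≤ 2 * e
    suc-e≤2e = ≤-trans (+-monoˡ-≤ e (≤-trans (s≤s z≤n) 3≤e)) (≤-reflexive (cong (e +_) (sym (+-identityʳ e))))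
    e₁ : ∀ w n k → (34 + suc w) * n * k ≡ n * (35 * k + w * k)
    e₁ = solve-∀
    e₂ : ∀ n b p → n * (35 * (b * p) + b * p) ≡ 36 * (b * (p * n))
    e₂ = solve-∀
    e₃ : ∀ a b g e d → a * (b * g * (2 * e * (2 * d))) ≡ a * (b * 4) * (g * e * d)
    e₃ = solve-∀
    e₄ : ∀ k a d → k * (a * d) ≡ a * (k * d)
    e₄ = solve-∀

  builds : ClientBuilds q (λ G → HasMinor G (2 ^ τ)) (initial n)
  builds = BigMinor.client-builds n q (suc y) e g τ q<Q n≤4Q rounds e≤n (s≤s z≤n) excess
    (≤-trans (^-monoʳ-≤ 2 g-below) n-lower) (≤-trans n-upper (^-monoʳ-≤ 2 g-above))

-- In logarithms the bound on `τ` gives n^(ε/κ) ≤ 2^τ. If ε(b + 1) ≤ κ then `τ = 1` satisfies it,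
-- and a single Client edge suffices; otherwise the long game applies.
client-natural : ∀ κ n q p d b → {{_ : NonZero d}} → 36 * (128 * 4) ≤ κ → 2 ≤ n → 2 * (q * d) + 2 * (p * n) ≤ n * d →
  2 ^ b ≤ n → n < 2 ^ suc b →
  ∃[ τ ] (suc b * p ≤ τ * (κ * d) × ClientBuilds q (λ G → HasMinor G (2 ^ τ)) (initial n))
client-natural κ n q p d b κ-large 2≤n bias lo hi with suc b * p ≤? κ * d
... | yes short = 1 , ≤-trans short (≤-reflexive (sym (*-identityˡ (κ * d)))) , client-edge n q 2≤n
... | no long = LongGame.τ κ n q p d b κ-large bias lo hi (≰⇒> long) , LongGame.τ-large κ n q p d b κ-large bias lo hi (≰⇒> long) ,
                LongGame.builds κ n q p d b κ-large bias lo hi (≰⇒> long)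

-- Transfer between rational and natural inequalities.

toℚᵘ-toℚ : ∀ n → toℚᵘ (toℚ n) ℚᵘ.≃ ℚᵘ.mkℚᵘ (ℤ.+ n) 0
toℚᵘ-toℚ n = ℚ.toℚᵘ-fromℚᵘ (ℚᵘ.mkℚᵘ (ℤ.+ n) 0)

toℚ-+ : ∀ a b → toℚ (a + b) ≡ toℚ a +ℚ toℚ b
toℚ-+ a b = ℚ.toℚᵘ-injective (ℚᵘ.≃-trans (toℚᵘ-toℚ (a + b)) (ℚᵘ.≃-trans
  (ℚᵘ.*≡* (cong (ℤ._* ℤ.+ 1) (cong₂ ℤ._+_ (sym (ℤ.*-identityʳ (ℤ.+ a))) (sym (ℤ.*-identityʳ (ℤ.+ b))))))
  (ℚᵘ.≃-sym (ℚᵘ.≃-trans (ℚ.toℚᵘ-homo-+ (toℚ a) (toℚ b)) (ℚᵘ.+-cong (toℚᵘ-toℚ a) (toℚᵘ-toℚ b))))))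

toℚ-* : ∀ a b → toℚ (a * b) ≡ toℚ a *ℚ toℚ b
toℚ-* a b = ℚ.toℚᵘ-injective (ℚᵘ.≃-trans (toℚᵘ-toℚ (a * b)) (ℚᵘ.≃-trans
  (ℚᵘ.*≡* (cong (ℤ._* ℤ.+ 1) (ℤ.pos-* a b)))
  (ℚᵘ.≃-sym (ℚᵘ.≃-trans (ℚ.toℚᵘ-homo-* (toℚ a) (toℚ b)) (ℚᵘ.*-cong (toℚᵘ-toℚ a) (toℚᵘ-toℚ b))))))

toℚ-mono : ∀ a b → a ≤ b → toℚ a ≤ℚ toℚ b
toℚ-mono a b h = ℚ.toℚᵘ-cancel-≤ (ℚᵘ.≤-respˡ-≃ (ℚᵘ.≃-sym (toℚᵘ-toℚ a)) (ℚᵘ.≤-respʳ-≃ (ℚᵘ.≃-sym (toℚᵘ-toℚ b))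
  (ℚᵘ.*≤* (ℤ.*-monoʳ-≤-nonNeg (ℤ.+ 1) (ℤ.+≤+ h)))))

toℚ-cancel : ∀ a b → toℚ a ≤ℚ toℚ b → a ≤ b
toℚ-cancel a b h with ℚᵘ.≤-respˡ-≃ (toℚᵘ-toℚ a) (ℚᵘ.≤-respʳ-≃ (toℚᵘ-toℚ b) (ℚ.toℚᵘ-mono-≤ h))
... | ℚᵘ.*≤* h′ = ℤ.drop‿+≤+ (subst₂ ℤ._≤_ (ℤ.*-identityʳ (ℤ.+ a)) (ℤ.*-identityʳ (ℤ.+ b)) h′)

toℚ-injective : ∀ a b → toℚ a ≡ toℚ b → a ≡ b
toℚ-injective a b h = ≤-antisym (toℚ-cancel a b (ℚ.≤-reflexive h)) (toℚ-cancel b a (ℚ.≤-reflexive (sym h)))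

toℚ-^ : ∀ a k → toℚ (a ^ k) ≡ toℚ a ^ℚ k
toℚ-^ a zero = refl
toℚ-^ a (suc k) = trans (toℚ-* a (a ^ k)) (cong (toℚ a *ℚ_) (toℚ-^ a k))

0≤toℚ : ∀ n → 0ℚ ≤ℚ toℚ n
0≤toℚ n = toℚ-mono 0 n z≤n

scale : ∀ r → 0ℚ ≤ℚ r → r *ℚ toℚ (↧ₙ r) ≡ toℚ ∣ ↥ r ∣
scale (mkℚ (ℤ.+ p) d-1 c) _ = ℚ.toℚᵘ-injective (ℚᵘ.≃-trans (ℚ.toℚᵘ-homo-* r (toℚ (suc d-1)))
  (ℚᵘ.≃-trans (ℚᵘ.*-congˡ {toℚᵘ r} (toℚᵘ-toℚ (suc d-1)))
  (ℚᵘ.≃-trans (ℚᵘ.*≡* lem) (ℚᵘ.≃-sym (toℚᵘ-toℚ p)))))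
  where
  r : ℚ
  r = mkℚ (ℤ.+ p) d-1 c
  lem : ℤ.+ p ℤ.* ℤ.+ suc d-1 ℤ.* ℤ.+ 1 ≡ ℤ.+ p ℤ.* ℤ.+ (suc d-1 * 1)
  lem = trans (ℤ.*-identityʳ _) (cong (λ z → ℤ.+ p ℤ.* ℤ.+ z) (sym (*-identityʳ (suc d-1))))
scale (mkℚ ℤ.-[1+ p ] d-1 c) (ℚ-Base.*≤* ())

*-nonNeg : ∀ {x y} → 0ℚ ≤ℚ x → 0ℚ ≤ℚ y → 0ℚ ≤ℚ x *ℚ y
*-nonNeg {x} {y} hx hy = ℚ.≤-trans (ℚ.≤-reflexive (sym (ℚ.*-zeroʳ x))) (ℚ.*-monoˡ-≤-nonNeg x {{nonNegative hx}} hy)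

^ℚ-nonNeg : ∀ {x} → 0ℚ ≤ℚ x → ∀ k → 0ℚ ≤ℚ x ^ℚ k
^ℚ-nonNeg hx zero = 0≤toℚ 1
^ℚ-nonNeg hx (suc k) = *-nonNeg hx (^ℚ-nonNeg hx k)

^ℚ-mono : ∀ {x y} → 0ℚ ≤ℚ x → x ≤ℚ y → ∀ k → x ^ℚ k ≤ℚ y ^ℚ k
^ℚ-mono hx h zero = ℚ.≤-refl
^ℚ-mono {x} {y} hx h (suc k) = ℚ.≤-trans (ℚ.*-monoˡ-≤-nonNeg x {{nonNegative hx}} (^ℚ-mono hx h k))
  (ℚ.*-monoʳ-≤-nonNeg (y ^ℚ k) {{nonNegative (^ℚ-nonNeg (ℚ.≤-trans hx h) k)}} h)

module Rational (κ : ℕ) .{{_ : NonZero κ}} (c ε : ℚ) (0≤c : 0ℚ ≤ℚ c) (cκ : c *ℚ toℚ κ ≡ 1ℚ) (0≤ε : 0ℚ ≤ℚ ε) where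

  p d num den : ℕ
  p = ∣ ↥ ε ∣
  d = ↧ₙ ε
  num = ∣ ↥ (c *ℚ ε) ∣
  den = ↧ₙ (c *ℚ ε)

  open ℚ-Solver.+-*-Solver

  -- Both num/den and p/(κd) equal ε/κ, because c = 1/κ. The reduced fraction of cε need not have
  -- denominator κd, hence the cross-multiplied form.
  cross : num * (κ * d) ≡ p * den
  cross = toℚ-injective (num * (κ * d)) (p * den) (begin
    toℚ (num * (κ * d)) ≡⟨ trans (toℚ-* num (κ * d)) (cong (toℚ num *ℚ_) (toℚ-* κ d)) ⟩
    toℚ num *ℚ (toℚ κ *ℚ toℚ d) ≡⟨ cong (_*ℚ (toℚ κ *ℚ toℚ d)) (sym (scale (c *ℚ ε) (*-nonNeg 0≤c 0≤ε))) ⟩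
    c *ℚ ε *ℚ toℚ den *ℚ (toℚ κ *ℚ toℚ d)
      ≡⟨ solve 5 (λ c e x k d → c :* e :* x :* (k :* d) := (c :* k) :* ((e :* d) :* x)) refl c ε (toℚ den) (toℚ κ) (toℚ d) ⟩
    (c *ℚ toℚ κ) *ℚ ((ε *ℚ toℚ d) *ℚ toℚ den) ≡⟨ cong₂ (λ a b → a *ℚ (b *ℚ toℚ den)) cκ (scale ε 0≤ε) ⟩
    1ℚ *ℚ (toℚ p *ℚ toℚ den) ≡⟨ trans (ℚ.*-identityˡ (toℚ p *ℚ toℚ den)) (sym (toℚ-* p den)) ⟩
    toℚ (p * den) ∎)
    where open ≡-Reasoning

  bias : ∀ n q → toℚ q ≤ℚ (½ -ℚ ε) *ℚ toℚ n → 2 * (q * d) + 2 * (p * n) ≤ n * d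
  bias n q h = toℚ-cancel (2 * (q * d) + 2 * (p * n)) (n * d) (begin
    toℚ (2 * (q * d) + 2 * (p * n))
      ≡⟨ trans (toℚ-+ (2 * (q * d)) (2 * (p * n))) (cong₂ _+ℚ_
           (trans (toℚ-* 2 (q * d)) (cong (toℚ 2 *ℚ_) (toℚ-* q d)))
           (trans (toℚ-* 2 (p * n)) (cong (toℚ 2 *ℚ_) (trans (toℚ-* p n) (cong (_*ℚ toℚ n) (sym (scale ε 0≤ε))))))) ⟩
    toℚ 2 *ℚ (toℚ q *ℚ toℚ d) +ℚ toℚ 2 *ℚ ((ε *ℚ toℚ d) *ℚ toℚ n)
      ≤⟨ ℚ.+-monoˡ-≤ (toℚ 2 *ℚ ((ε *ℚ toℚ d) *ℚ toℚ n)) (ℚ.*-monoˡ-≤-nonNeg (toℚ 2) {{nonNegative (0≤toℚ 2)}}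
           (ℚ.*-monoʳ-≤-nonNeg (toℚ d) {{nonNegative (0≤toℚ d)}} h)) ⟩
    toℚ 2 *ℚ ((½ -ℚ ε) *ℚ toℚ n *ℚ toℚ d) +ℚ toℚ 2 *ℚ ((ε *ℚ toℚ d) *ℚ toℚ n)
      ≡⟨ solve 5 (λ w h e n d → w :* ((h :- e) :* n :* d) :+ w :* ((e :* d) :* n) := (w :* h) :* (n :* d)) refl (toℚ 2) ½ ε (toℚ n) (toℚ d) ⟩
    (toℚ 2 *ℚ ½) *ℚ (toℚ n *ℚ toℚ d) ≡⟨ cong (_*ℚ (toℚ n *ℚ toℚ d)) two-halves ⟩
    1ℚ *ℚ (toℚ n *ℚ toℚ d) ≡⟨ trans (ℚ.*-identityˡ (toℚ n *ℚ toℚ d)) (sym (toℚ-* n d)) ⟩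
    toℚ (n * d) ∎)
    where
    open ℚ.≤-Reasoning
    two-halves : toℚ 2 *ℚ ½ ≡ 1ℚ
    two-halves = refl

  -- Since cε = num/den, the bound t ≥ (εn)^(cε) compares a `num`-th with a `den`-th power. Bounding
  -- ε by 1 replaces εn by a power of 2, and the exponents are then compared through `cross`.
  power-bound : ∀ n b τ → p ≤ d → n < 2 ^ suc b → suc b * p ≤ τ * (κ * d) →
    (ε *ℚ toℚ n) ^ℚ num ≤ℚ toℚ (2 ^ τ) ^ℚ den
  power-bound n b τ p≤d hi large = begin
    (ε *ℚ toℚ n) ^ℚ num ≤⟨ ^ℚ-mono (*-nonNeg 0≤ε (0≤toℚ n)) εn≤ num ⟩
    toℚ (2 ^ suc b) ^ℚ num ≡⟨ sym (toℚ-^ (2 ^ suc b) num) ⟩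
    toℚ ((2 ^ suc b) ^ num) ≤⟨ toℚ-mono ((2 ^ suc b) ^ num) ((2 ^ τ) ^ den) exponents ⟩
    toℚ ((2 ^ τ) ^ den) ≡⟨ toℚ-^ (2 ^ τ) den ⟩
    toℚ (2 ^ τ) ^ℚ den ∎
    where
    open ℚ.≤-Reasoning
    ε≤1 : ε ≤ℚ 1ℚ
    ε≤1 = ℚ.*-cancelʳ-≤-pos (toℚ d) {{positive (ℚ.<-≤-trans (positive⁻¹-1) (toℚ-mono 1 d (>-nonZero⁻¹ d)))}}
      (ℚ.≤-trans (ℚ.≤-reflexive (scale ε 0≤ε)) (ℚ.≤-trans (toℚ-mono p d p≤d) (ℚ.≤-reflexive (sym (ℚ.*-identityˡ (toℚ d))))))
      where
      positive⁻¹-1 : 0ℚ <ℚ 1ℚ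
      positive⁻¹-1 = ℚ.positive⁻¹ 1ℚ
    εn≤ : ε *ℚ toℚ n ≤ℚ toℚ (2 ^ suc b)
    εn≤ = ℚ.≤-trans (ℚ.*-monoʳ-≤-nonNeg (toℚ n) {{nonNegative (0≤toℚ n)}} ε≤1)
      (ℚ.≤-trans (ℚ.≤-reflexive (ℚ.*-identityˡ (toℚ n))) (toℚ-mono n (2 ^ suc b) (<⇒≤ hi)))
    instance
      κd≢0 : NonZero (κ * d)
      κd≢0 = m*n≢0 κ d
    exponents : (2 ^ suc b) ^ num ≤ (2 ^ τ) ^ den
    exponents = subst₂ _≤_ (sym (^-*-assoc 2 (suc b) num)) (sym (^-*-assoc 2 τ den))
      (^-monoʳ-≤ 2 (*-cancelʳ-≤ (suc b * num) (τ * den) (κ * d) (subst₂ _≤_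
        (trans (*-assoc (suc b) p den) (trans (cong (suc b *_) (sym cross)) (sym (*-assoc (suc b) num (κ * d)))))
        (lem τ (κ * d) den)
        (*-monoˡ-≤ den large))))
      where
      lem : ∀ t k x → t * k * x ≡ t * x * k
      lem = solve-∀

p≤d : ∀ {n q p d} → {{_ : NonZero n}} → 2 * (q * d) + 2 * (p * n) ≤ n * d → p ≤ d
p≤d {n} {q} {p} {d} h = *-cancelʳ-≤ p d n (begin
  p * n ≤⟨ m≤n*m (p * n) 2 ⟩
  2 * (p * n) ≤⟨ m≤n+m _ (2 * (q * d)) ⟩
  2 * (q * d) + 2 * (p * n) ≤⟨ h ⟩
  n * d ≡⟨ *-comm n d ⟩
  d * n ∎)
  where open ≤-Reasoning

client-part : ∀ κ → 36 * (128 * 4) ≤ κ → ∀ c → 0ℚ ≤ℚ c → c *ℚ toℚ κ ≡ 1ℚ → ∀ n → 2 ≤ n → ∀ ε → 0ℚ ≤ℚ ε →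
  ∀ q → toℚ q ≤ℚ (½ -ℚ ε) *ℚ toℚ n →
  ClientBuilds q
    (λ G → ∃[ t ] ((((ε *ℚ toℚ n) ^ℚ ∣ ↥ (c *ℚ ε) ∣) ≤ℚ (toℚ t ^ℚ (↧ₙ (c *ℚ ε)))) × HasMinor G t))
    (initial n)
client-part κ κ-large c 0≤c cκ n 2≤n ε 0≤ε q h = go (floor-log₂ n n≥1)
  where
  n≥1 : 1 ≤ n
  n≥1 = ≤-trans (s≤s z≤n) 2≤n
  open Rational κ {{>-nonZero (≤-trans (s≤s z≤n) κ-large)}} c ε 0≤c cκ 0≤ε
  biased : 2 * (q * d) + 2 * (p * n) ≤ n * d
  biased = bias n q h
  ε-small : p ≤ d
  ε-small = p≤d {n} {q} {p} {d} {{>-nonZero n≥1}} biased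
  Goal : Graph n → Set
  Goal G = ∃[ t ] ((((ε *ℚ toℚ n) ^ℚ num) ≤ℚ (toℚ t ^ℚ den)) × HasMinor G t)
  finish : ∀ b → n < 2 ^ suc b →
    ∃[ τ ] (suc b * p ≤ τ * (κ * d) × ClientBuilds q (λ G → HasMinor G (2 ^ τ)) (initial n)) →
    ClientBuilds q Goal (initial n)
  finish b hi (τ , large , builds) =
    client-builds-map {P = λ G → HasMinor G (2 ^ τ)} {P′ = Goal} (λ minor → 2 ^ τ , bound , minor) builds
    where
    bound : (ε *ℚ toℚ n) ^ℚ num ≤ℚ toℚ (2 ^ τ) ^ℚ den
    bound = power-bound n b τ ε-small hi large
  go : ∃[ b ] (2 ^ b ≤ n × n < 2 ^ suc b) →
    ClientBuilds q Goal (initial n)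
  go (b , lo , hi) = finish b hi (client-natural κ n q p d b κ-large 2≤n biased lo hi)

theorem1p3 : Σ ℚ λ c → (0ℚ <ℚ c) × ∃[ n₀ ] ∀ (n : ℕ) → n₀ ≤ n → ∀ (ε : ℚ) → 0ℚ <ℚ ε →
    (∀ (q : ℕ) → 1 ≤ q → n ≤ 2 * q + 2 →
    WaiterKeeps q (λ G → ¬ HasMinor G 3) (initial n))
    × (∀ (q : ℕ) → 1 ≤ q → toℚ q ≤ℚ ((½ -ℚ ε) *ℚ toℚ n) →
    ClientBuilds q
    (λ G → ∃[ t ] ((((ε *ℚ toℚ n) ^ℚ ∣ ↥ (c *ℚ ε) ∣) ≤ℚ (toℚ t ^ℚ (↧ₙ (c *ℚ ε))))
    × HasMinor G t))
    (initial n))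
theorem1p3 = c , ℚ.positive⁻¹ c , 2 , λ n 2≤n ε 0<ε →
    (λ q _ n≤ → waiter-keeps-forest n q (≤-trans (s≤s z≤n) 2≤n) n≤) ,
    -- 32768 = 2^15 is the least power of two above 36 · 128 · 4 = 18432.
    (λ q _ h → client-part 32768 (m≤m+n 18432 14336) c (ℚ.nonNegative⁻¹ c) refl n 2≤n ε (ℚ.<⇒≤ 0<ε) q h)
  where
  c : ℚ
  c = ℤ.+ 1 /ℚ 32768
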